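{- Let $\mathcal{C}=(\mathcal{P},\mathcal{L},\mathcal{I})$ be a linear point-line configuration with $n$ points and with connected components $\mathcal{C}_1,\dots,\mathcal{C}_\omega$. Assume that each of $\mathcal{C}_1,\dots,\mathcal{C}_\omega$ is the point-line configuration of a maximal matroid. Then the following statements are equivalent: (1) The configuration $\mathcal{C}$ is liftable (over $\mathbb{C}$). (2) For every $n$-tuple of distinct collinear points of $\mathbb{P}^2_{\mathbb{C}}$ labelled by the points of $\mathcal{C}$, the linear system $\Lambda z=0$, where $\Lambda$ is the collinearity matrix of $\mathcal{C}$ at these points, has solution space of dimension at least $3\omega$, or equivalently $n-3\omega\ge\operatorname{rk}\Lambda$.
   Context: A point-line configuration $(\mathcal{P},\mathcal{L},\mathcal{I})$ (points, lines, incidences; a line is identified with its set of points) is linear if any two points lie on at most one common line and every line contains at least two points. Given a total order on $\mathcal{P}$, $G_{\mathcal{C}}$ is the graph on $\mathcal{P}$ with an edge $p_ip_j$ ($p_i<p_j$) whenever $p_i,p_j$ lie on a line $\ell$ and no $p_k\in\ell$ satisfies $p_i<p_k<p_j$; the connected components of $\mathcal{C}$ are the sub-configurations corresponding to the connected components of $G_{\mathcal{C}}$, and $\omega$ is their number. Maximal matroids. For a simple rank-$3$ matroid $M$, $\mathcal{C}_M$ is the configuration whose points are the ground set and whose lines are the rank-two flats of size at least $3$. For matroids on the same ground set, $M\le N$ if every dependent set of $M$ is dependent in $N$. A simple rank-$3$ matroid $M$ such that $\mathcal{C}_M$ has no triplets of concurrent lines (every point lies on at most two lines) is maximal if it is maximal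 for this order among the realisable (over $\mathbb{C}$) simple rank-$3$ matroids (on the same ground set) with no triplets of concurrent lines. Liftable. A non-degenerate realisation of $\mathcal{C}$ is an $n$-tuple of points of $\mathbb{P}^2_{\mathbb{C}}$ in bijection with the points of $\mathcal{C}$ such that (non-)collinear points correspond to (non-)collinear points. $\mathcal{C}$ is liftable if every $n$-tuple of distinct collinear points of $\mathbb{P}^2_{\mathbb{C}}$ (labelled by the points of $\mathcal{C}$) is the image, under projection from a point outside their line onto that line, of a non-degenerate realisation of $\mathcal{C}$. Collinearity matrix. Given collinear points $P_1,\dots,P_n$ of $\mathbb{P}^2_{\mathbb{C}}$ and a point $P$ not collinear with them, choose coordinates with $P=(0,0,1)^t$ and $P_j=(x_j,1,0)^t$, and put $[P_iP_j]=x_i-x_j$. The matrix $\Lambda$ has columns indexed by $j\in[n]$ and a row for each triple $i=(i_1,i_2,i_3)$ of points lying on a common line of $\mathcal{C}$, with entries $[P_{i_2}P_{i_3}]$ in column $i_1$, $-[P_{i_1}P_{i_3}]$ in column $i_2$, $[P_{i_1}P_{i_2}]$ in column $i_3$, and $0$ elsewhere. -}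

module Defs where

open import Algebra.Bundles.Raw using (RawRing)
import Algebra.Definitions.RawMonoid as RawMonoidDefs
open import Data.Fin as Fin using (Fin)
open import Data.Fin.Properties using (_≟_)
open import Data.Fin.Subset using (Subset; _∈_; _∉_; _⊆_; ⊥; ⊤; ⁅_⁆; _∪_; ∣_∣)
open import Data.Nat as ℕ using (ℕ)
import Data.Nat.Properties as ℕₚ
open import Data.Product using (Σ; ∃; _×_; _,_; proj₁; proj₂)
open import Data.Rational as ℚ using (ℚ; 0ℚ; 1ℚ; ½)
import Data.Rational.Properties as ℚₚ
open import Data.Rational.Solver using (module +-*-Solver)
open import Function.Bundles using (_⇔_)
open import Level using (0ℓ)
open import Relation.Binary.Construct.Closure.Equivalence using (EqClosure)
open import Relation.Binary.PropositionalEquality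
  using (_≡_; _≢_; refl; sym; trans; cong; cong₂; subst)
open import Relation.Nullary using (¬_; yes; no)

------------------------------------------------------------------------
-- The complex numbers

-- A real number is a Cauchy sequence of rationals; sequences whose
-- difference tends to 0 represent the same real.

Cauchy : (ℕ → ℚ) → Set
Cauchy s = ∀ ε → 0ℚ ℚ.< ε →
  ∃ λ N → ∀ m n → N ℕ.≤ m → N ℕ.≤ n → ℚ.∣ s m ℚ.- s n ∣ ℚ.< ε

record ℝ : Set where
  constructor _isCauchy_
  field
    seq    : ℕ → ℚ
    cauchy : Cauchy seq

open ℝ public

infix 4 _≈ᴿ_

_≈ᴿ_ : ℝ → ℝ → Set
x ≈ᴿ y = ∀ ε → 0ℚ ℚ.< ε →
  ∃ λ N → ∀ n → N ℕ.≤ n → ℚ.∣ seq x n ℚ.- seq y n ∣ ℚ.< ε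

module CauchySequences where

  open +-*-Solver using (solve; _:=_; _:+_; _:-_; _:*_; :-_)

  abstract

    half-pos : ∀ {ε} → 0ℚ ℚ.< ε → 0ℚ ℚ.< ε ℚ.* ½
    half-pos {ε} 0<ε = ℚₚ.positive⁻¹ (ε ℚ.* ½)
      {{ℚₚ.pos*pos⇒pos ε {{ℚ.positive 0<ε}} ½}}

    half+half : ∀ ε → ε ℚ.* ½ ℚ.+ ε ℚ.* ½ ≡ ε
    half+half ε = trans (sym (ℚₚ.*-distribˡ-+ ε ½ ½)) (ℚₚ.*-identityʳ ε)

    const-cauchy : ∀ q → Cauchy (λ _ → q)
    const-cauchy q ε 0<ε = 0 , λ _ _ _ _ →
      subst (ℚ._< ε) (sym (cong ℚ.∣_∣ (ℚₚ.+-inverseʳ q))) 0<ε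

    neg-cauchy : ∀ s → Cauchy s → Cauchy (λ n → ℚ.- s n)
    neg-cauchy s cs ε 0<ε with cs ε 0<ε
    ... | N , h = N , λ m n N≤m N≤n →
      subst (ℚ._< ε)
        (trans (sym (ℚₚ.∣-p∣≡∣p∣ (s m ℚ.- s n)))
          (cong ℚ.∣_∣ (solve 2 (λ a b → :- (a :- b) := (:- a) :- (:- b)) refl (s m) (s n))))
        (h m n N≤m N≤n)

    +-cauchy : ∀ s t → Cauchy s → Cauchy t → Cauchy (λ n → s n ℚ.+ t n)
    +-cauchy s t cs ct ε 0<ε with cs (ε ℚ.* ½) (half-pos 0<ε) | ct (ε ℚ.* ½) (half-pos 0<ε)
    ... | N , h | N′ , h′ = N ℕ.⊔ N′ , λ m n N≤m N≤n →
      let open ℚₚ.≤-Reasoning in begin-strict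
        ℚ.∣ (s m ℚ.+ t m) ℚ.- (s n ℚ.+ t n) ∣
          ≡⟨ cong ℚ.∣_∣ (solve 4 (λ a b c d → (a :+ b) :- (c :+ d) := (a :- c) :+ (b :- d))
               refl (s m) (t m) (s n) (t n)) ⟩
        ℚ.∣ (s m ℚ.- s n) ℚ.+ (t m ℚ.- t n) ∣
          ≤⟨ ℚₚ.∣p+q∣≤∣p∣+∣q∣ (s m ℚ.- s n) (t m ℚ.- t n) ⟩
        ℚ.∣ s m ℚ.- s n ∣ ℚ.+ ℚ.∣ t m ℚ.- t n ∣
          <⟨ ℚₚ.+-mono-<
               (h m n (ℕₚ.m⊔n≤o⇒m≤o N N′ N≤m) (ℕₚ.m⊔n≤o⇒m≤o N N′ N≤n))
               (h′ m n (ℕₚ.m⊔n≤o⇒n≤o N N′ N≤m) (ℕₚ.m⊔n≤o⇒n≤o N N′ N≤n)) ⟩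
        ε ℚ.* ½ ℚ.+ ε ℚ.* ½
          ≡⟨ half+half ε ⟩
        ε ∎

    bounded : ∀ s → Cauchy s →
      ∃ λ B → 0ℚ ℚ.< B × ∃ λ N → ∀ n → N ℕ.≤ n → ℚ.∣ s n ∣ ℚ.≤ B
    bounded s cs with cs 1ℚ (ℚₚ.positive⁻¹ 1ℚ)
    ... | N , h = 1ℚ ℚ.+ ℚ.∣ s N ∣
                , ℚₚ.+-mono-<-≤ (ℚₚ.positive⁻¹ 1ℚ) (ℚₚ.0≤∣p∣ (s N))
                , N , λ n N≤n →
      let open ℚₚ.≤-Reasoning in begin
        ℚ.∣ s n ∣
          ≡⟨ cong ℚ.∣_∣ (solve 2 (λ a b → a := (a :- b) :+ b) refl (s n) (s N)) ⟩
        ℚ.∣ (s n ℚ.- s N) ℚ.+ s N ∣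
          ≤⟨ ℚₚ.∣p+q∣≤∣p∣+∣q∣ (s n ℚ.- s N) (s N) ⟩
        ℚ.∣ s n ℚ.- s N ∣ ℚ.+ ℚ.∣ s N ∣
          ≤⟨ ℚₚ.+-monoˡ-≤ ℚ.∣ s N ∣ (ℚₚ.<⇒≤ (h n N N≤n ℕₚ.≤-refl)) ⟩
        1ℚ ℚ.+ ℚ.∣ s N ∣ ∎

    *-estimate : ∀ {B B′ δ} a b c d → 0ℚ ℚ.< B → 0ℚ ℚ.< B′ →
      ℚ.∣ a ∣ ℚ.≤ B → ℚ.∣ d ∣ ℚ.≤ B′ → ℚ.∣ a ℚ.- c ∣ ℚ.< δ → ℚ.∣ b ℚ.- d ∣ ℚ.< δ →
      ℚ.∣ a ℚ.* b ℚ.- c ℚ.* d ∣ ℚ.< δ ℚ.* (B ℚ.+ B′)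
    *-estimate {B} {B′} {δ} a b c d 0<B 0<B′ ∣a∣≤B ∣d∣≤B′ ∣a-c∣<δ ∣b-d∣<δ =
      let open ℚₚ.≤-Reasoning in begin-strict
        ℚ.∣ a ℚ.* b ℚ.- c ℚ.* d ∣
          ≡⟨ cong ℚ.∣_∣ (solve 4
               (λ a b c d → a :* b :- c :* d := a :* (b :- d) :+ (a :- c) :* d) refl a b c d) ⟩
        ℚ.∣ a ℚ.* (b ℚ.- d) ℚ.+ (a ℚ.- c) ℚ.* d ∣
          ≤⟨ ℚₚ.∣p+q∣≤∣p∣+∣q∣ (a ℚ.* (b ℚ.- d)) ((a ℚ.- c) ℚ.* d) ⟩
        ℚ.∣ a ℚ.* (b ℚ.- d) ∣ ℚ.+ ℚ.∣ (a ℚ.- c) ℚ.* d ∣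
          ≡⟨ cong₂ ℚ._+_ (ℚₚ.∣p*q∣≡∣p∣*∣q∣ a (b ℚ.- d)) (ℚₚ.∣p*q∣≡∣p∣*∣q∣ (a ℚ.- c) d) ⟩
        ℚ.∣ a ∣ ℚ.* ℚ.∣ b ℚ.- d ∣ ℚ.+ ℚ.∣ a ℚ.- c ∣ ℚ.* ℚ.∣ d ∣
          ≤⟨ ℚₚ.+-mono-≤
               (ℚₚ.*-monoʳ-≤-nonNeg ℚ.∣ b ℚ.- d ∣ {{ℚₚ.∣-∣-nonNeg (b ℚ.- d)}} ∣a∣≤B)
               (ℚₚ.*-monoˡ-≤-nonNeg ℚ.∣ a ℚ.- c ∣ {{ℚₚ.∣-∣-nonNeg (a ℚ.- c)}} ∣d∣≤B′) ⟩
        B ℚ.* ℚ.∣ b ℚ.- d ∣ ℚ.+ ℚ.∣ a ℚ.- c ∣ ℚ.* B′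
          <⟨ ℚₚ.+-mono-< (ℚₚ.*-monoʳ-<-pos B {{ℚ.positive 0<B}} ∣b-d∣<δ)
                         (ℚₚ.*-monoˡ-<-pos B′ {{ℚ.positive 0<B′}} ∣a-c∣<δ) ⟩
        B ℚ.* δ ℚ.+ δ ℚ.* B′
          ≡⟨ solve 3 (λ b e c → b :* e :+ e :* c := e :* (b :+ c)) refl B δ B′ ⟩
        δ ℚ.* (B ℚ.+ B′) ∎

    quotient : ∀ ε c → 0ℚ ℚ.< ε → 0ℚ ℚ.< c → ∃ λ δ → 0ℚ ℚ.< δ × δ ℚ.* c ≡ ε
    quotient ε c 0<ε 0<c = ε ℚ.* i
      , ℚₚ.positive⁻¹ (ε ℚ.* i) {{ℚₚ.pos*pos⇒pos ε {{ℚ.positive 0<ε}} i {{ℚₚ.1/pos⇒pos c}}}}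
      , trans (ℚₚ.*-assoc ε i c)
          (trans (cong (ε ℚ.*_) (ℚₚ.*-inverseˡ c)) (ℚₚ.*-identityʳ ε))
      where
      instance
        c>0 : ℚ.Positive c
        c>0 = ℚ.positive 0<c
        c≢0 : ℚ.NonZero c
        c≢0 = ℚₚ.pos⇒nonZero c
      i : ℚ
      i = ℚ.1/ c

    *-cauchy : ∀ s t → Cauchy s → Cauchy t → Cauchy (λ n → s n ℚ.* t n)
    *-cauchy s t cs ct ε 0<ε =
      let B  , 0<B  , K  , b  = bounded s cs
          B′ , 0<B′ , K′ , b′ = bounded t ct
          δ , 0<δ , δ*[B+B′]≡ε = quotient ε (B ℚ.+ B′) 0<ε (ℚₚ.+-mono-< 0<B 0<B′)
      in combine B B′ δ K K′ 0<B 0<B′ δ*[B+B′]≡ε b b′ (cs δ 0<δ) (ct δ 0<δ)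
      where
      combine : ∀ B B′ δ K K′ → 0ℚ ℚ.< B → 0ℚ ℚ.< B′ → δ ℚ.* (B ℚ.+ B′) ≡ ε →
        (∀ n → K ℕ.≤ n → ℚ.∣ s n ∣ ℚ.≤ B) → (∀ n → K′ ℕ.≤ n → ℚ.∣ t n ∣ ℚ.≤ B′) →
        (∃ λ S → ∀ m n → S ℕ.≤ m → S ℕ.≤ n → ℚ.∣ s m ℚ.- s n ∣ ℚ.< δ) →
        (∃ λ T → ∀ m n → T ℕ.≤ m → T ℕ.≤ n → ℚ.∣ t m ℚ.- t n ∣ ℚ.< δ) →
        ∃ λ N → ∀ m n → N ℕ.≤ m → N ℕ.≤ n → ℚ.∣ s m ℚ.* t m ℚ.- s n ℚ.* t n ∣ ℚ.< ε
      combine B B′ δ K K′ 0<B 0<B′ eq b b′ (S , h) (T , h′) =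
        (K ℕ.⊔ K′) ℕ.⊔ (S ℕ.⊔ T) , λ m n N≤m N≤n →
        subst (ℚ.∣ s m ℚ.* t m ℚ.- s n ℚ.* t n ∣ ℚ.<_) eq
          (*-estimate (s m) (t m) (s n) (t n) 0<B 0<B′
            (b m (ℕₚ.m⊔n≤o⇒m≤o K K′ (left N≤m)))
            (b′ n (ℕₚ.m⊔n≤o⇒n≤o K K′ (left N≤n)))
            (h m n (ℕₚ.m⊔n≤o⇒m≤o S T (right N≤m)) (ℕₚ.m⊔n≤o⇒m≤o S T (right N≤n)))
            (h′ m n (ℕₚ.m⊔n≤o⇒n≤o S T (right N≤m)) (ℕₚ.m⊔n≤o⇒n≤o S T (right N≤n))))
        where
        left : ∀ {k} → (K ℕ.⊔ K′) ℕ.⊔ (S ℕ.⊔ T) ℕ.≤ k → K ℕ.⊔ K′ ℕ.≤ k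
        left = ℕₚ.m⊔n≤o⇒m≤o (K ℕ.⊔ K′) (S ℕ.⊔ T)
        right : ∀ {k} → (K ℕ.⊔ K′) ℕ.⊔ (S ℕ.⊔ T) ℕ.≤ k → S ℕ.⊔ T ℕ.≤ k
        right = ℕₚ.m⊔n≤o⇒n≤o (K ℕ.⊔ K′) (S ℕ.⊔ T)

open CauchySequences

infixl 6 _+ᴿ_
infixl 7 _*ᴿ_
infix  8 -ᴿ_

_+ᴿ_ _*ᴿ_ : ℝ → ℝ → ℝ
(s isCauchy cs) +ᴿ (t isCauchy ct) = (λ n → s n ℚ.+ t n) isCauchy +-cauchy s t cs ct
(s isCauchy cs) *ᴿ (t isCauchy ct) = (λ n → s n ℚ.* t n) isCauchy *-cauchy s t cs ct

-ᴿ_ : ℝ → ℝ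
-ᴿ (s isCauchy cs) = (λ n → ℚ.- s n) isCauchy neg-cauchy s cs

0ᴿ 1ᴿ : ℝ
0ᴿ = (λ _ → 0ℚ) isCauchy const-cauchy 0ℚ
1ᴿ = (λ _ → 1ℚ) isCauchy const-cauchy 1ℚ

-- The pair (a , b) is the complex number a + b i.

ℂ : RawRing 0ℓ 0ℓ
ℂ = record
  { Carrier = ℝ × ℝ
  ; _≈_     = λ (a , b) (c , d) → a ≈ᴿ c × b ≈ᴿ d
  ; _+_     = λ (a , b) (c , d) → a +ᴿ c , b +ᴿ d
  ; _*_     = λ (a , b) (c , d) → a *ᴿ c +ᴿ -ᴿ (b *ᴿ d) , a *ᴿ d +ᴿ b *ᴿ c
  ; -_      = λ (a , b) → -ᴿ a , -ᴿ b
  ; 0#      = 0ᴿ , 0ᴿ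
  ; 1#      = 1ᴿ , 0ᴿ
  }

------------------------------------------------------------------------
-- Point-line configurations

-- A line is identified with its set of points; the ambient order on
-- Fin n restricts to the total order on the point set P.

record Configuration {n : ℕ} (P : Subset n) : Set₁ where
  field
    Line   : Subset n → Set
    line⊆P : ∀ {ℓ} → Line ℓ → ℓ ⊆ P

open Configuration public

module _ {n : ℕ} {P : Subset n} (C : Configuration P) where

  record Linear : Set where
    field
      unique-line : ∀ {p q ℓ ℓ′} → p ≢ q → Line C ℓ → Line C ℓ′ →
                    p ∈ ℓ → q ∈ ℓ → p ∈ ℓ′ → q ∈ ℓ′ → ℓ ≡ ℓ′
      two-points  : ∀ {ℓ} → Line C ℓ → 2 ℕ.≤ ∣ ℓ ∣

  Adjacent : Fin n → Fin n → Set
  Adjacent i j = i Fin.< j × ∃ λ ℓ → Line C ℓ × i ∈ ℓ × j ∈ ℓ ×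
                 (∀ k → k ∈ ℓ → ¬ (i Fin.< k × k Fin.< j))

  IsComponent : Subset n → Set
  IsComponent K = ∃ λ p → p ∈ P × (∀ q → q ∈ K ⇔ (q ∈ P × EqClosure Adjacent p q))

  -- The components listed without repetition, so ω is their number.
  record AreComponents {ω : ℕ} (K : Fin ω → Subset n) : Set where
    field
      isComponent : ∀ i → IsComponent (K i)
      distinct    : ∀ {i j} → K i ≡ K j → i ≡ j
      complete    : ∀ {K′} → IsComponent K′ → ∃ λ i → K i ≡ K′

  subconfiguration : (K : Subset n) → Configuration K
  subconfiguration K = record
    { Line   = λ ℓ → Line C ℓ × ℓ ⊆ K
    ; line⊆P = proj₂
    }

  AtMostTwoLinesPerPoint : Set
  AtMostTwoLinesPerPoint = ∀ {p ℓ₁ ℓ₂ ℓ₃} → Line C ℓ₁ → Line C ℓ₂ → Line C ℓ₃ →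
    ℓ₁ ≢ ℓ₂ → ℓ₁ ≢ ℓ₃ → ℓ₂ ≢ ℓ₃ → ¬ (p ∈ ℓ₁ × p ∈ ℓ₂ × p ∈ ℓ₃)

infix 4 _≐_

_≐_ : ∀ {n} {P : Subset n} → Configuration P → Configuration P → Set
C ≐ D = ∀ ℓ → Line C ℓ ⇔ Line D ℓ

------------------------------------------------------------------------
-- Matroids

record Matroid {n : ℕ} (E : Subset n) : Set₁ where
  field
    Indep      : Subset n → Set
    indep⊆E    : ∀ {I} → Indep I → I ⊆ E
    ∅-indep    : Indep ⊥
    hereditary : ∀ {I J} → I ⊆ J → Indep J → Indep I
    exchange   : ∀ {I J} → Indep I → Indep J → ∣ I ∣ ℕ.< ∣ J ∣ →
                 ∃ λ x → x ∈ J × x ∉ I × Indep (I ∪ ⁅ x ⁆)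

open Matroid public

module _ {n : ℕ} {E : Subset n} (M : Matroid E) where

  Dependent : Subset n → Set
  Dependent D = D ⊆ E × ¬ Indep M D

  Rank : Subset n → ℕ → Set
  Rank A r = (∃ λ I → Indep M I × I ⊆ A × ∣ I ∣ ≡ r)
           × (∀ {J} → Indep M J → J ⊆ A → ∣ J ∣ ℕ.≤ r)

  Simple : Set
  Simple = ∀ {A} → A ⊆ E → ∣ A ∣ ℕ.≤ 2 → Indep M A

  Flat : Subset n → Set
  Flat F = F ⊆ E × (∀ {x} → x ∈ E → x ∉ F →
           ∀ {r s} → Rank F r → Rank (F ∪ ⁅ x ⁆) s → r ℕ.< s)

  configuration : Configuration E
  configuration = record
    { Line   = λ ℓ → Flat ℓ × Rank ℓ 2 × 3 ℕ.≤ ∣ ℓ ∣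
    ; line⊆P = λ l → proj₁ (proj₁ l)
    }

infix 4 _≼_

_≼_ : ∀ {n} {E : Subset n} → Matroid E → Matroid E → Set
M ≼ N = ∀ {D} → Dependent M D → Dependent N D

------------------------------------------------------------------------
-- Linear algebra and projective geometry over K

module Geometry (K : RawRing 0ℓ 0ℓ) where

  open RawRing K
  open RawMonoidDefs +-rawMonoid using (sum)

  Vect : ℕ → Set
  Vect m = Fin m → Carrier

  infix 4 _≋_

  _≋_ : ∀ {m} → Vect m → Vect m → Set
  v ≋ w = ∀ i → v i ≈ w i

  𝟎 : ∀ {m} → Vect m
  𝟎 _ = 0#

  infixl 7 _·_

  _·_ : ∀ {m} → Vect m → Vect m → Carrier
  v · w = sum (λ i → v i * w i)

  combination : ∀ {k m} → Vect k → (Fin k → Vect m) → Vect m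
  combination c v j = sum (λ i → c i * v i j)

  LinearlyIndependent : ∀ {k m} → (Fin k → Vect m) → Set
  LinearlyIndependent v = ∀ c → combination c v ≋ 𝟎 → c ≋ 𝟎

  LinearlyIndependentOn : ∀ {k m} → Subset k → (Fin k → Vect m) → Set
  LinearlyIndependentOn I v = ∀ c → (∀ i → i ∉ I → c i ≈ 0#) →
                              combination c v ≋ 𝟎 → c ≋ 𝟎

  Span : ∀ {m} {I : Set} → (I → Vect m) → Vect m → Set
  Span {I = I} f v = ∃ λ k → Σ (Fin k → I) λ r → Σ (Vect k) λ c →
                     v ≋ combination c (λ i → f (r i))

  HasDimension : ∀ {m} → (Vect m → Set) → ℕ → Set
  HasDimension {m} V d = Σ (Fin d → Vect m) λ b →
    (∀ i → V (b i)) × LinearlyIndependent b × (∀ v → V v → Span b v)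

  ----------------------------------------------------------------------
  -- The projective plane

  record Point : Set where
    field
      coord   : Vect 3
      nonzero : ¬ coord ≋ 𝟎

  open Point public

  -- A projective line, given by a nonzero linear form up to scaling.
  record PLine : Set where
    field
      form    : Vect 3
      nonzero : ¬ form ≋ 𝟎

  open PLine public using (form)

  infix 4 _on_ _represents_ _∼_

  _on_ : Point → PLine → Set
  p on m = form m · coord p ≈ 0#

  _represents_ : Vect 3 → Point → Set
  v represents p = ∃ λ a → ¬ a ≈ 0# × v ≋ (λ i → a * coord p i)

  _∼_ : Point → Point → Set
  p ∼ q = coord p represents q

  Distinct : ∀ {n} → (Fin n → Point) → Set
  Distinct P = ∀ {i j} → i ≢ j → ¬ P i ∼ P j

  Collinear : ∀ {n} → (Fin n → Point) → Set
  Collinear P = ∃ λ m → ∀ i → P i on m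

  Collinear₃ : Point → Point → Point → Set
  Collinear₃ p q r = ∃ λ m → p on m × q on m × r on m

  -- p is the image of q under the projection from O onto the line m.
  Projects : Point → PLine → Point → Point → Set
  Projects O m q p = ¬ q ∼ O × p on m × Collinear₃ O q p

  ----------------------------------------------------------------------
  -- Maximal matroids

  Realisable : ∀ {n} {E : Subset n} → Matroid E → Set
  Realisable {n} {E} M = Σ (Fin n → Vect 3) λ v →
    ∀ {I} → I ⊆ E → Indep M I ⇔ LinearlyIndependentOn I v

  record Admissible {n} {E : Subset n} (M : Matroid E) : Set where
    field
      simple     : Simple M
      rank-three : Rank M E 3
      realisable : Realisable M
      noTriplets : AtMostTwoLinesPerPoint (configuration M)

  Maximal : ∀ {n} {E : Subset n} → Matroid E → Set₁
  Maximal {E = E} M = Admissible M × (∀ (N : Matroid E) → Admissible N → M ≼ N → N ≼ M)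

  ----------------------------------------------------------------------
  -- Liftability and the collinearity matrix of a configuration whose
  -- points are all of Fin n

  module _ {n} (C : Configuration (⊤ {n})) where

    -- Any two points of the plane are collinear, so (non-)collinearity
    -- is compared on triples of distinct points.
    record NonDegenerateRealisation (Q : Fin n → Point) : Set where
      field
        distinct  : Distinct Q
        collinear : ∀ {i j k} → i ≢ j → i ≢ k → j ≢ k →
          (∃ λ ℓ → Line C ℓ × i ∈ ℓ × j ∈ ℓ × k ∈ ℓ) ⇔ Collinear₃ (Q i) (Q j) (Q k)

    Liftable : Set
    Liftable = ∀ (P : Fin n → Point) → Distinct P → ∀ m → (∀ i → P i on m) →
      ∃ λ O → ¬ O on m × Σ (Fin n → Point) λ Q →
        NonDegenerateRealisation Q × (∀ i → Projects O m (Q i) (P i))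

    -- One row index for each three-element set of points on a common line.
    record CollinearTriple : Set where
      field
        i₁ i₂ i₃ : Fin n
        i₁<i₂    : i₁ Fin.< i₂
        i₂<i₃    : i₂ Fin.< i₃
        ℓ        : Subset n
        line     : Line C ℓ
        i₁∈ℓ     : i₁ ∈ ℓ
        i₂∈ℓ     : i₂ ∈ ℓ
        i₃∈ℓ     : i₃ ∈ ℓ

    module _ (x : Vect n) where

      bracket : Fin n → Fin n → Carrier
      bracket i j = x i + - x j

      Λ : CollinearTriple → Vect n
      Λ t j with j ≟ i₁ | j ≟ i₂ | j ≟ i₃
        where open CollinearTriple t
      ... | yes _ | _     | _     = bracket i₂ i₃ where open CollinearTriple t
      ... | no _  | yes _ | _     = - bracket i₁ i₃ where open CollinearTriple t
      ... | no _  | no _  | yes _ = bracket i₁ i₂ where open CollinearTriple t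
      ... | no _  | no _  | no _  = 0#

      Solution : Vect n → Set
      Solution z = ∀ t → Λ t · z ≈ 0#

      -- The rank as the dimension of the row space.
      RankΛ : ℕ → Set
      RankΛ r = HasDimension (Span Λ) r

  -- In the basis e₁ e₂ e₃ of the underlying vector space the centre has
  -- coordinates (0,0,1) and the j-th point has coordinates (x j,1,0); in
  -- particular the centre is off the line spanned by e₁ and e₂.  Another
  -- choice of basis rescales the rows and columns of Λ by nonzero factors.
  record Coordinates {n} (P : Fin n → Point) (x : Vect n) : Set where
    field
      centre  : Point
      e       : Fin 3 → Vect 3
      basis   : LinearlyIndependent e
      centre≡ : e (Fin.suc (Fin.suc Fin.zero)) represents centre
      point≡  : ∀ j → (λ i → x j * e Fin.zero i + e (Fin.suc Fin.zero) i) represents P j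

open Geometry ℂ public

{-# OPTIONS --safe #-}

-- A vector z solves Λ z = 0 iff on every line it is an affine function
-- of x, that is, iff the points (x i : 1 : z i) respect the collinearities:
-- solutions are possibly degenerate lifts.
--
-- A configuration with at most two lines through each point is realised
-- by sending its lines to generic tangents of a conic.  Maximality of a
-- component is therefore a combinatorial condition: no lines can be
-- merged, no free point can be moved onto a further line, and no three
-- free points can be put on a new line.
--
-- Since lines cannot be merged, all lines of a component are obtained
-- from any two of them by repeatedly adding a line that meets the earlier
-- ones in two points.  So a solution that is affine on two lines of a
-- component is affine on the component; each component contributes at
-- most 3 to the dimension, and a solution space of dimension 3ω contains
-- solutions that are not affine on a given component.  If a component has
-- more than two lines, then by maximality the last one added meets the
-- earlier ones in three points, and changing x at one of these points
-- destroys the non-affine solutions.  Under (2) the components are thus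
-- pairs of crossing lines, where a generic solution is non-degenerate.
-- Conversely, a non-degenerate lift z gives the independent solutions
-- 1, x and z on every component.

module Submission where

open import Defs using (-ᴿ_; 0ᴿ; 1ᴿ; Adjacent; AreComponents; AtMostTwoLinesPerPoint; Cauchy; Configuration; Indep; Line; Linear; Matroid; Rank; Simple; _*ᴿ_; _+ᴿ_; _isCauchy_; _≈ᴿ_; _≐_; _≼_; cauchy; configuration; exchange; hereditary; indep⊆E; module CauchySequences; module Geometry; seq; subconfiguration; ℂ)
open import Algebra.Bundles using (CommutativeRing)
open import Algebra.Bundles.Raw using (RawRing)
import Algebra.Properties.Ring as RingProperties
import Algebra.Properties.Semiring.Sum as Sum
import Algebra.Solver.Ring as RingSolver
open import Algebra.Solver.Ring.AlmostCommutativeRing using (_-Raw-AlmostCommutative⟶_; fromCommutativeRing)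
open import Axiom.ExcludedMiddle using (ExcludedMiddle)
open import Data.Empty using (⊥-elim)
open import Data.Fin as Fin using (Fin; zero; suc; toℕ; punchIn; _↑ˡ_; _↑ʳ_; combine; remQuot; inject≤)
import Data.Fin.Properties as Finₚ
open import Data.Fin.Subset using (Subset; inside; outside; _∈_; _∉_; _⊆_; ⊥; ⊤; ⁅_⁆; _∪_; ∣_∣)
import Data.Fin.Subset.Properties as Subsetₚ
import Data.Integer as ℤ
import Data.Integer.Properties as ℤₚ
open import Data.List using (List; length; lookup) renaming ([] to []ᴸ; _∷_ to _∷ᴸ_)
open import Data.List.Membership.Propositional using () renaming (_∈_ to _∈ᴸ_)
open import Data.List.Membership.Propositional.Properties using (∈-lookup)
open import Data.List.Relation.Unary.Any using (here; there)
import Data.Maybe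
open import Data.Nat as ℕ using (ℕ; zero; suc)
import Data.Nat.Coprimality as Coprimality
import Data.Nat.Properties as ℕₚ
open import Data.Product using (Σ; ∃; _×_; _,_; proj₁; proj₂)
open import Data.Rational as ℚ using (ℚ; 0ℚ; 1ℚ; ½)
import Data.Rational.Properties as ℚₚ
open import Data.Rational.Solver using (module +-*-Solver)
open import Data.Sum using (_⊎_; inj₁; inj₂; [_,_]′)
import Data.Vec as Vec
open import Data.Vec.Functional using (insertAt; _∷_; _++_)
open import Data.Vec.Functional.Properties using (insertAt-lookup; insertAt-punchIn; lookup-++ˡ; lookup-++ʳ)
import Data.Vec.Properties as Vecₚ
open import Function using (_∘_)
open import Function.Bundles using (_⇔_; mk⇔; Equivalence)
open import Level using (Level; 0ℓ)
open import Relation.Binary.Construct.Closure.Equivalence using (EqClosure; symmetric; transitive; return)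
open import Relation.Binary.Construct.Closure.ReflexiveTransitive using (_◅_) renaming (ε to εˢ)
open import Relation.Binary.Construct.Closure.Symmetric using (SymClosure; fwd; bwd)
open import Relation.Binary.Definitions using (tri<; tri≈; tri>)
open import Relation.Binary.PropositionalEquality as ≡ using (_≡_; _≢_)
open import Relation.Nullary hiding (det)
open import Relation.Nullary.Decidable using (dec-true; toSum)

-- The field of complex numbers

-- Every use of maximality passes through one device. A point is named by a pair of tangents, those
-- of its lines, filled up with private tangents where lines are missing; for generic parameters
-- three distinct points are collinear exactly if their pairs have a common member. So any coarser
-- distribution of the points over lines that keeps "two points share at most one line" and "a point
-- has at most two lines" gives an admissible matroid above the given one, provided some triple
-- stays non-collinear. Maximality then says that no collinearity was added.
--
-- A single position proves little, since a special position may carry solutions that are not affine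
-- on a component. Hence two positions are compared that differ only at one point q₃ of the last
-- line w. Off w the lines never meet each other at q₃, so the two normalised solutions are given
-- there by the same affine functions; two other junctions extend this to w, and the junction at q₃
-- makes two affine functions agree at two arguments. This is why w needs three junctions.
--
-- Generic choices are made among the natural numbers in the field, so characteristic zero replaces
-- Zariski density.

module ComplexField where

  open ≡ using (refl; sym; trans; cong; cong₂; subst)

  open CauchySequences
  open +-*-Solver using (solve; _:=_; _:+_; _:-_; _:*_; :-_; con)
  open ℚₚ.≤-Reasoning

  ≗⇒≈ᴿ : ∀ {x y} → (∀ n → seq x n ≡ seq y n) → x ≈ᴿ y
  ≗⇒≈ᴿ {x} {y} h ε 0<ε = 0 , λ n _ → subst (ℚ._< ε)
    (sym (trans (cong (λ a → ℚ.∣ a ℚ.- seq y n ∣) (h n)) (cong ℚ.∣_∣ (ℚₚ.+-inverseʳ (seq y n))))) 0<ε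

  ∣p-q∣≡∣q-p∣ : ∀ p q → ℚ.∣ p ℚ.- q ∣ ≡ ℚ.∣ q ℚ.- p ∣
  ∣p-q∣≡∣q-p∣ p q = trans (sym (ℚₚ.∣-p∣≡∣p∣ (p ℚ.- q)))
    (cong ℚ.∣_∣ (solve 2 (λ a b → :- (a :- b) := b :- a) refl p q))

  ≈ᴿ-sym : ∀ {x y} → x ≈ᴿ y → y ≈ᴿ x
  ≈ᴿ-sym {x} {y} h ε 0<ε with h ε 0<ε
  ... | N , g = N , λ n N≤n → subst (ℚ._< ε) (∣p-q∣≡∣q-p∣ (seq x n) (seq y n)) (g n N≤n)

  ∣sum∣< : ∀ {ε} a b → ℚ.∣ a ∣ ℚ.< ε ℚ.* ½ → ℚ.∣ b ∣ ℚ.< ε ℚ.* ½ → ℚ.∣ a ℚ.+ b ∣ ℚ.< ε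
  ∣sum∣< {ε} a b p q = begin-strict
    ℚ.∣ a ℚ.+ b ∣             ≤⟨ ℚₚ.∣p+q∣≤∣p∣+∣q∣ a b ⟩
    ℚ.∣ a ∣ ℚ.+ ℚ.∣ b ∣       <⟨ ℚₚ.+-mono-< p q ⟩
    ε ℚ.* ½ ℚ.+ ε ℚ.* ½       ≡⟨ half+half ε ⟩
    ε                         ∎

  ≈ᴿ-trans : ∀ {x y z} → x ≈ᴿ y → y ≈ᴿ z → x ≈ᴿ z
  ≈ᴿ-trans {x} {y} {z} h k ε 0<ε with h (ε ℚ.* ½) (half-pos 0<ε) | k (ε ℚ.* ½) (half-pos 0<ε)
  ... | N , g | N′ , g′ = N ℕ.⊔ N′ , λ n le → subst (λ a → ℚ.∣ a ∣ ℚ.< ε)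
    (solve 3 (λ a b c → (a :- b) :+ (b :- c) := a :- c) refl (seq x n) (seq y n) (seq z n))
    (∣sum∣< (seq x n ℚ.- seq y n) (seq y n ℚ.- seq z n)
      (g n (ℕₚ.m⊔n≤o⇒m≤o N N′ le)) (g′ n (ℕₚ.m⊔n≤o⇒n≤o N N′ le)))

  +ᴿ-cong : ∀ {x x′ y y′} → x ≈ᴿ x′ → y ≈ᴿ y′ → x +ᴿ y ≈ᴿ x′ +ᴿ y′
  +ᴿ-cong {x} {x′} {y} {y′} h k ε 0<ε with h (ε ℚ.* ½) (half-pos 0<ε) | k (ε ℚ.* ½) (half-pos 0<ε)
  ... | N , g | N′ , g′ = N ℕ.⊔ N′ , λ n le → subst (λ a → ℚ.∣ a ∣ ℚ.< ε)
    (solve 4 (λ a b c d → (a :- b) :+ (c :- d) := (a :+ c) :- (b :+ d)) refl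
      (seq x n) (seq x′ n) (seq y n) (seq y′ n))
    (∣sum∣< (seq x n ℚ.- seq x′ n) (seq y n ℚ.- seq y′ n)
      (g n (ℕₚ.m⊔n≤o⇒m≤o N N′ le)) (g′ n (ℕₚ.m⊔n≤o⇒n≤o N N′ le)))

  -ᴿ-cong : ∀ {x y} → x ≈ᴿ y → -ᴿ x ≈ᴿ -ᴿ y
  -ᴿ-cong {x} {y} h ε 0<ε with h ε 0<ε
  ... | N , g = N , λ n N≤n → subst (ℚ._< ε)
    (trans (∣p-q∣≡∣q-p∣ (seq x n) (seq y n)) (cong ℚ.∣_∣
      (solve 2 (λ a b → b :- a := :- a :- :- b) refl (seq x n) (seq y n)))) (g n N≤n)

  *ᴿ-cong : ∀ {x x′ y y′} → x ≈ᴿ x′ → y ≈ᴿ y′ → x *ᴿ y ≈ᴿ x′ *ᴿ y′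
  *ᴿ-cong {x} {x′} {y} {y′} h k ε 0<ε =
    let B  , 0<B  , K  , b  = bounded (seq x) (cauchy x)
        B′ , 0<B′ , K′ , b′ = bounded (seq y′) (cauchy y′)
        δ , 0<δ , δ*[B+B′]≡ε = quotient ε (B ℚ.+ B′) 0<ε (ℚₚ.+-mono-< 0<B 0<B′)
        N , g = h δ 0<δ
        N′ , g′ = k δ 0<δ
    in (K ℕ.⊔ K′) ℕ.⊔ (N ℕ.⊔ N′) , λ n le →
       let l = ℕₚ.m⊔n≤o⇒m≤o (K ℕ.⊔ K′) (N ℕ.⊔ N′) le
           r = ℕₚ.m⊔n≤o⇒n≤o (K ℕ.⊔ K′) (N ℕ.⊔ N′) le
       in subst (ℚ.∣ seq x n ℚ.* seq y n ℚ.- seq x′ n ℚ.* seq y′ n ∣ ℚ.<_) δ*[B+B′]≡ε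
         (*-estimate (seq x n) (seq y n) (seq x′ n) (seq y′ n) 0<B 0<B′
           (b n (ℕₚ.m⊔n≤o⇒m≤o K K′ l)) (b′ n (ℕₚ.m⊔n≤o⇒n≤o K K′ l))
           (g n (ℕₚ.m⊔n≤o⇒m≤o N N′ r)) (g′ n (ℕₚ.m⊔n≤o⇒n≤o N N′ r)))

  open RawRing ℂ using () renaming (Carrier to C; _≈_ to _≈ᶜ_; _+_ to _+ᶜ_; _*_ to _*ᶜ_; -_ to -ᶜ_; 0# to 0ᶜ; 1# to 1ᶜ)

  ≗⇒≈ᶜ : ∀ x y → (∀ n → seq (proj₁ x) n ≡ seq (proj₁ y) n × seq (proj₂ x) n ≡ seq (proj₂ y) n) → x ≈ᶜ y
  ≗⇒≈ᶜ (a , b) (c , d) h = ≗⇒≈ᴿ {a} {c} (λ n → proj₁ (h n)) , ≗⇒≈ᴿ {b} {d} (λ n → proj₂ (h n))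

  module _ (x y z : C) where
    private
      a b c d e f : ℕ → ℚ
      a = seq (proj₁ x)
      b = seq (proj₂ x)
      c = seq (proj₁ y)
      d = seq (proj₂ y)
      e = seq (proj₁ z)
      f = seq (proj₂ z)

    +ᶜ-assoc : (x +ᶜ y) +ᶜ z ≈ᶜ x +ᶜ (y +ᶜ z)
    +ᶜ-assoc = ≗⇒≈ᶜ ((x +ᶜ y) +ᶜ z) (x +ᶜ (y +ᶜ z)) λ n →
      ℚₚ.+-assoc (a n) (c n) (e n) , ℚₚ.+-assoc (b n) (d n) (f n)

    *ᶜ-assoc : (x *ᶜ y) *ᶜ z ≈ᶜ x *ᶜ (y *ᶜ z)
    *ᶜ-assoc = ≗⇒≈ᶜ ((x *ᶜ y) *ᶜ z) (x *ᶜ (y *ᶜ z)) λ n →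
        solve 6 (λ a b c d e f →
          (a :* c :+ :- (b :* d)) :* e :+ :- ((a :* d :+ b :* c) :* f) :=
          a :* (c :* e :+ :- (d :* f)) :+ :- (b :* (c :* f :+ d :* e))) refl
          (a n) (b n) (c n) (d n) (e n) (f n)
      , solve 6 (λ a b c d e f →
          (a :* c :+ :- (b :* d)) :* f :+ (a :* d :+ b :* c) :* e :=
          a :* (c :* f :+ d :* e) :+ b :* (c :* e :+ :- (d :* f))) refl
          (a n) (b n) (c n) (d n) (e n) (f n)

    *ᶜ-distribˡ-+ᶜ : x *ᶜ (y +ᶜ z) ≈ᶜ x *ᶜ y +ᶜ x *ᶜ z
    *ᶜ-distribˡ-+ᶜ = ≗⇒≈ᶜ (x *ᶜ (y +ᶜ z)) (x *ᶜ y +ᶜ x *ᶜ z) λ n →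
        solve 6 (λ a b c d e f →
          a :* (c :+ e) :+ :- (b :* (d :+ f)) :=
          (a :* c :+ :- (b :* d)) :+ (a :* e :+ :- (b :* f))) refl
          (a n) (b n) (c n) (d n) (e n) (f n)
      , solve 6 (λ a b c d e f →
          a :* (d :+ f) :+ b :* (c :+ e) :=
          (a :* d :+ b :* c) :+ (a :* f :+ b :* e)) refl
          (a n) (b n) (c n) (d n) (e n) (f n)

    *ᶜ-distribʳ-+ᶜ : (y +ᶜ z) *ᶜ x ≈ᶜ y *ᶜ x +ᶜ z *ᶜ x
    *ᶜ-distribʳ-+ᶜ = ≗⇒≈ᶜ ((y +ᶜ z) *ᶜ x) (y *ᶜ x +ᶜ z *ᶜ x) λ n →
        solve 6 (λ a b c d e f →
          (c :+ e) :* a :+ :- ((d :+ f) :* b) :=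
          (c :* a :+ :- (d :* b)) :+ (e :* a :+ :- (f :* b))) refl
          (a n) (b n) (c n) (d n) (e n) (f n)
      , solve 6 (λ a b c d e f →
          (c :+ e) :* b :+ (d :+ f) :* a :=
          (c :* b :+ d :* a) :+ (e :* b :+ f :* a)) refl
          (a n) (b n) (c n) (d n) (e n) (f n)

  module _ (x y : C) where
    private
      a b c d : ℕ → ℚ
      a = seq (proj₁ x)
      b = seq (proj₂ x)
      c = seq (proj₁ y)
      d = seq (proj₂ y)

    +ᶜ-comm : x +ᶜ y ≈ᶜ y +ᶜ x
    +ᶜ-comm = ≗⇒≈ᶜ (x +ᶜ y) (y +ᶜ x) λ n → ℚₚ.+-comm (a n) (c n) , ℚₚ.+-comm (b n) (d n)

    *ᶜ-comm : x *ᶜ y ≈ᶜ y *ᶜ x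
    *ᶜ-comm = ≗⇒≈ᶜ (x *ᶜ y) (y *ᶜ x) λ n →
        solve 4 (λ a b c d → a :* c :+ :- (b :* d) := c :* a :+ :- (d :* b)) refl (a n) (b n) (c n) (d n)
      , solve 4 (λ a b c d → a :* d :+ b :* c := c :* b :+ d :* a) refl (a n) (b n) (c n) (d n)

  module _ (x : C) where
    private
      a b : ℕ → ℚ
      a = seq (proj₁ x)
      b = seq (proj₂ x)

    +ᶜ-identityˡ : 0ᶜ +ᶜ x ≈ᶜ x
    +ᶜ-identityˡ = ≗⇒≈ᶜ (0ᶜ +ᶜ x) x λ n → ℚₚ.+-identityˡ (a n) , ℚₚ.+-identityˡ (b n)

    +ᶜ-identityʳ : x +ᶜ 0ᶜ ≈ᶜ x
    +ᶜ-identityʳ = ≗⇒≈ᶜ (x +ᶜ 0ᶜ) x λ n → ℚₚ.+-identityʳ (a n) , ℚₚ.+-identityʳ (b n)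

    +ᶜ-inverseˡ : (-ᶜ x) +ᶜ x ≈ᶜ 0ᶜ
    +ᶜ-inverseˡ = ≗⇒≈ᶜ ((-ᶜ x) +ᶜ x) 0ᶜ λ n → ℚₚ.+-inverseˡ (a n) , ℚₚ.+-inverseˡ (b n)

    +ᶜ-inverseʳ : x +ᶜ (-ᶜ x) ≈ᶜ 0ᶜ
    +ᶜ-inverseʳ = ≗⇒≈ᶜ (x +ᶜ (-ᶜ x)) 0ᶜ λ n → ℚₚ.+-inverseʳ (a n) , ℚₚ.+-inverseʳ (b n)

    *ᶜ-identityˡ : 1ᶜ *ᶜ x ≈ᶜ x
    *ᶜ-identityˡ = ≗⇒≈ᶜ (1ᶜ *ᶜ x) x λ n →
        solve 2 (λ a b → con 1ℚ :* a :+ :- (con 0ℚ :* b) := a) refl (a n) (b n)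
      , solve 2 (λ a b → con 1ℚ :* b :+ con 0ℚ :* a := b) refl (a n) (b n)

    *ᶜ-identityʳ : x *ᶜ 1ᶜ ≈ᶜ x
    *ᶜ-identityʳ = ≗⇒≈ᶜ (x *ᶜ 1ᶜ) x λ n →
        solve 2 (λ a b → a :* con 1ℚ :+ :- (b :* con 0ℚ) := a) refl (a n) (b n)
      , solve 2 (λ a b → a :* con 0ℚ :+ b :* con 1ℚ := b) refl (a n) (b n)

  ℂ-commutativeRing : CommutativeRing 0ℓ 0ℓ
  ℂ-commutativeRing = record
    { Carrier = C
    ; _≈_     = _≈ᶜ_
    ; _+_     = _+ᶜ_
    ; _*_     = _*ᶜ_
    ; -_      = -ᶜ_
    ; 0#      = 0ᶜ
    ; 1#      = 1ᶜ
    ; isCommutativeRing = record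
      { isRing = record
        { +-isAbelianGroup = record
          { isGroup = record
            { isMonoid = record
              { isSemigroup = record
                { isMagma = record
                  { isEquivalence = record
                    { refl  = λ {x} → ≗⇒≈ᶜ x x (λ _ → refl , refl)
                    ; sym   = λ {(a , b) (c , d)} (p , q) → ≈ᴿ-sym {a} {c} p , ≈ᴿ-sym {b} {d} q
                    ; trans = λ {(a , b) (c , d) (e , f)} (p , q) (p′ , q′) →
                        ≈ᴿ-trans {a} {c} {e} p p′ , ≈ᴿ-trans {b} {d} {f} q q′
                    }
                  ; ∙-cong = λ {(a , b) (a′ , b′) (c , d) (c′ , d′)} (p , q) (r , s) →
                      +ᴿ-cong {a} {a′} {c} {c′} p r , +ᴿ-cong {b} {b′} {d} {d′} q s
                  }
                ; assoc = +ᶜ-assoc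
                }
              ; identity = +ᶜ-identityˡ , +ᶜ-identityʳ
              }
            ; inverse = +ᶜ-inverseˡ , +ᶜ-inverseʳ
            ; ⁻¹-cong = λ {(a , b) (c , d)} (p , q) → -ᴿ-cong {a} {c} p , -ᴿ-cong {b} {d} q
            }
          ; comm = +ᶜ-comm
          }
        ; *-cong = λ {(a , b) (a′ , b′) (c , d) (c′ , d′)} (p , q) (r , s) →
              +ᴿ-cong {a *ᴿ c} {a′ *ᴿ c′} { -ᴿ (b *ᴿ d)} { -ᴿ (b′ *ᴿ d′)} (*ᴿ-cong {a} {a′} {c} {c′} p r)
                (-ᴿ-cong {b *ᴿ d} {b′ *ᴿ d′} (*ᴿ-cong {b} {b′} {d} {d′} q s))
            , +ᴿ-cong {a *ᴿ d} {a′ *ᴿ d′} {b *ᴿ c} {b′ *ᴿ c′} (*ᴿ-cong {a} {a′} {d} {d′} p s)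
                (*ᴿ-cong {b} {b′} {c} {c′} q r)
        ; *-assoc = *ᶜ-assoc
        ; *-identity = *ᶜ-identityˡ , *ᶜ-identityʳ
        ; distrib = *ᶜ-distribˡ-+ᶜ , *ᶜ-distribʳ-+ᶜ
        }
      ; *-comm = *ᶜ-comm
      }
    }

  module _ (em : ∀ {P : Set} → Dec P) where

    ¬∀⟶∃¬ : ∀ {A : Set} {P : A → Set} → ¬ (∀ a → P a) → ∃ λ a → ¬ P a
    ¬∀⟶∃¬ {P = P} h with em {∃ λ a → ¬ P a}
    ... | yes w = w
    ... | no ¬w = ⊥-elim (h (λ a → decidable-stable em (λ ¬p → ¬w (a , ¬p))))

    -- Failure to tend to 0 only gives, beyond every index, some term of size at least ε. The Cauchy
    -- property with tolerance ε/2 spreads the bound ε/2 to all later terms.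
    apart : ∀ x → ¬ x ≈ᴿ 0ᴿ → ∃ λ δ → 0ℚ ℚ.< δ × ∃ λ N → ∀ n → N ℕ.≤ n → δ ℚ.≤ ℚ.∣ seq x n ∣
    apart x x≉0 =
      let ε , h = ¬∀⟶∃¬ x≉0
          0<ε , h′ = ¬∀⟶∃¬ h
          N , c = cauchy x (ε ℚ.* ½) (half-pos 0<ε)
          n , k = ¬∀⟶∃¬ {P = λ n → N ℕ.≤ n → ℚ.∣ seq x n ℚ.- 0ℚ ∣ ℚ.< ε} (λ g → h′ (N , g))
          N≤n , far = ¬∀⟶∃¬ k
      in ε ℚ.* ½ , half-pos 0<ε , N , λ m N≤m → ℚₚ.≮⇒≥ λ small → far (begin-strict
           ℚ.∣ seq x n ℚ.- 0ℚ ∣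
             ≡⟨ cong ℚ.∣_∣ (solve 2 (λ a b → a :- con 0ℚ := (a :- b) :+ b) refl (seq x n) (seq x m)) ⟩
           ℚ.∣ (seq x n ℚ.- seq x m) ℚ.+ seq x m ∣
             <⟨ ∣sum∣< (seq x n ℚ.- seq x m) (seq x m) (c n m N≤n N≤m) small ⟩
           ε ∎)

    -- The value 0 at 0 is a default that makes the sequence of reciprocals total. A sequence
    -- bounded away from 0 meets it only finitely often.
    recip : ℚ → ℚ
    recip q with q ℚ.≟ 0ℚ
    ... | yes _  = 0ℚ
    ... | no q≢0 = ℚ.1/_ q {{ℚ.≢-nonZero q≢0}}

    recip-inverse : ∀ q → q ≢ 0ℚ → q ℚ.* recip q ≡ 1ℚ
    recip-inverse q q≢0 with q ℚ.≟ 0ℚ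
    ... | yes q≡0 = ⊥-elim (q≢0 q≡0)
    ... | no q≢0′ = ℚₚ.*-inverseʳ q {{ℚ.≢-nonZero q≢0′}}

    ≤∣∣⇒≢0 : ∀ {δ} q → 0ℚ ℚ.< δ → δ ℚ.≤ ℚ.∣ q ∣ → q ≢ 0ℚ
    ≤∣∣⇒≢0 q 0<δ δ≤ refl = ℚₚ.<-irrefl refl (ℚₚ.<-≤-trans 0<δ δ≤)

    ∣recip∣≤ : ∀ {δ E} q → 0ℚ ℚ.< δ → 0ℚ ℚ.< E → E ℚ.* δ ≡ 1ℚ → δ ℚ.≤ ℚ.∣ q ∣ → ℚ.∣ recip q ∣ ℚ.≤ E
    ∣recip∣≤ {δ} {E} q 0<δ 0<E E*δ≡1 δ≤∣q∣ = begin
      ℚ.∣ r ∣                            ≡⟨ sym (ℚₚ.*-identityˡ ℚ.∣ r ∣) ⟩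
      1ℚ ℚ.* ℚ.∣ r ∣                     ≡⟨ cong (ℚ._* ℚ.∣ r ∣) (sym E*δ≡1) ⟩
      E ℚ.* δ ℚ.* ℚ.∣ r ∣                ≡⟨ ℚₚ.*-assoc E δ ℚ.∣ r ∣ ⟩
      E ℚ.* (δ ℚ.* ℚ.∣ r ∣)              ≤⟨ ℚₚ.*-monoˡ-≤-nonNeg E {{ℚₚ.pos⇒nonNeg E {{ℚ.positive 0<E}}}}
                                             (ℚₚ.*-monoʳ-≤-nonNeg ℚ.∣ r ∣ {{ℚₚ.∣-∣-nonNeg r}} δ≤∣q∣) ⟩
      E ℚ.* (ℚ.∣ q ∣ ℚ.* ℚ.∣ r ∣)        ≡⟨ cong (E ℚ.*_) (sym (ℚₚ.∣p*q∣≡∣p∣*∣q∣ q r)) ⟩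
      E ℚ.* ℚ.∣ q ℚ.* r ∣                ≡⟨ cong (λ a → E ℚ.* ℚ.∣ a ∣) (recip-inverse q (≤∣∣⇒≢0 q 0<δ δ≤∣q∣)) ⟩
      E ℚ.* 1ℚ                           ≡⟨ ℚₚ.*-identityʳ E ⟩
      E                                  ∎
      where
      r = recip q

    recip-difference : ∀ p q → p ≢ 0ℚ → q ≢ 0ℚ →
      recip p ℚ.- recip q ≡ (recip p ℚ.* recip q) ℚ.* (q ℚ.- p)
    recip-difference p q p≢0 q≢0 = sym (begin-equality
      (a ℚ.* b) ℚ.* (q ℚ.- p)
        ≡⟨ solve 4 (λ a b p q → (a :* b) :* (q :- p) := a :* (q :* b) :- b :* (p :* a)) refl a b p q ⟩
      a ℚ.* (q ℚ.* b) ℚ.- b ℚ.* (p ℚ.* a)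
        ≡⟨ cong₂ (λ u v → a ℚ.* u ℚ.- b ℚ.* v) (recip-inverse q q≢0) (recip-inverse p p≢0) ⟩
      a ℚ.* 1ℚ ℚ.- b ℚ.* 1ℚ
        ≡⟨ cong₂ ℚ._-_ (ℚₚ.*-identityʳ a) (ℚₚ.*-identityʳ b) ⟩
      a ℚ.- b ∎)
      where
      a = recip p
      b = recip q

    -- The difference of two reciprocals 1/p and 1/q is (q - p)/(pq), of size at most E² times that
    -- of q - p, where E = 1/δ and δ bounds the terms from below. Hence the tolerance θ = η/E² for
    -- the sequence itself.
    recip-cauchy : ∀ x → ¬ x ≈ᴿ 0ᴿ → Cauchy (λ n → recip (seq x n))
    recip-cauchy x x≉0 η 0<η =
      let δ , 0<δ , K , far = apart x x≉0
          E , 0<E , E*δ≡1 = quotient 1ℚ δ (ℚₚ.positive⁻¹ 1ℚ) 0<δ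
          0<EE = ℚₚ.positive⁻¹ (E ℚ.* E) {{ℚₚ.pos*pos⇒pos E {{ℚ.positive 0<E}} E {{ℚ.positive 0<E}}}}
          θ , 0<θ , θ*EE≡η = quotient η (E ℚ.* E) 0<η 0<EE
          N , c = cauchy x θ 0<θ
          0≤ : ∀ q → ℚ.NonNegative ℚ.∣ q ∣
          0≤ = ℚₚ.∣-∣-nonNeg
      in K ℕ.⊔ N , λ m n le le′ →
         let p = seq x m
             q = seq x n
             p-far = far m (ℕₚ.m⊔n≤o⇒m≤o K N le)
             q-far = far n (ℕₚ.m⊔n≤o⇒m≤o K N le′)
             near = c n m (ℕₚ.m⊔n≤o⇒n≤o K N le′) (ℕₚ.m⊔n≤o⇒n≤o K N le)
         in begin-strict
           ℚ.∣ recip p ℚ.- recip q ∣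
             ≡⟨ cong ℚ.∣_∣ (recip-difference p q (≤∣∣⇒≢0 p 0<δ p-far) (≤∣∣⇒≢0 q 0<δ q-far)) ⟩
           ℚ.∣ (recip p ℚ.* recip q) ℚ.* (q ℚ.- p) ∣
             ≡⟨ trans (ℚₚ.∣p*q∣≡∣p∣*∣q∣ (recip p ℚ.* recip q) (q ℚ.- p))
                  (cong (ℚ._* ℚ.∣ q ℚ.- p ∣) (ℚₚ.∣p*q∣≡∣p∣*∣q∣ (recip p) (recip q))) ⟩
           (ℚ.∣ recip p ∣ ℚ.* ℚ.∣ recip q ∣) ℚ.* ℚ.∣ q ℚ.- p ∣
             ≤⟨ ℚₚ.*-monoʳ-≤-nonNeg ℚ.∣ q ℚ.- p ∣ {{0≤ (q ℚ.- p)}}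
                  (ℚₚ.≤-trans
                    (ℚₚ.*-monoʳ-≤-nonNeg ℚ.∣ recip q ∣ {{0≤ (recip q)}} (∣recip∣≤ p 0<δ 0<E E*δ≡1 p-far))
                    (ℚₚ.*-monoˡ-≤-nonNeg E {{ℚₚ.pos⇒nonNeg E {{ℚ.positive 0<E}}}} (∣recip∣≤ q 0<δ 0<E E*δ≡1 q-far))) ⟩
           (E ℚ.* E) ℚ.* ℚ.∣ q ℚ.- p ∣
             <⟨ ℚₚ.*-monoʳ-<-pos (E ℚ.* E) {{ℚ.positive 0<EE}} near ⟩
           (E ℚ.* E) ℚ.* θ
             ≡⟨ trans (ℚₚ.*-comm (E ℚ.* E) θ) θ*EE≡η ⟩
           η ∎

    inverseᴿ : ∀ x → ¬ x ≈ᴿ 0ᴿ → ∃ λ y → x *ᴿ y ≈ᴿ 1ᴿ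
    inverseᴿ x x≉0 = ((λ n → recip (seq x n)) isCauchy recip-cauchy x x≉0)
      , λ ε 0<ε → let δ , 0<δ , N , far = apart x x≉0 in
        N , λ n N≤n → subst (ℚ._< ε)
          (sym (trans (cong (λ a → ℚ.∣ a ℚ.- 1ℚ ∣)
            (recip-inverse (seq x n) (≤∣∣⇒≢0 (seq x n) 0<δ (far n N≤n)))) refl)) 0<ε

    square-nonNeg : ∀ q → 0ℚ ℚ.≤ q ℚ.* q
    square-nonNeg q with ℚₚ.≤-total 0ℚ q
    ... | inj₁ 0≤q = ℚₚ.nonNegative⁻¹ (q ℚ.* q)
            {{ℚₚ.nonNeg*nonNeg⇒nonNeg q {{ℚ.nonNegative 0≤q}} q {{ℚ.nonNegative 0≤q}}}}
    ... | inj₂ q≤0 = subst (0ℚ ℚ.≤_) (solve 1 (λ q → :- q :* :- q := q :* q) refl q)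
            (ℚₚ.nonNegative⁻¹ (ℚ.- q ℚ.* ℚ.- q) {{ℚₚ.nonNeg*nonNeg⇒nonNeg (ℚ.- q) {{0≤-q}} (ℚ.- q) {{0≤-q}}}})
      where 0≤-q = ℚ.nonNegative (ℚₚ.neg-antimono-≤ q≤0)

    square≤ : ∀ a b → a ℚ.* a ℚ.≤ ℚ.∣ a ℚ.* a ℚ.+ b ℚ.* b ∣
    square≤ a b = begin
      a ℚ.* a                            ≡⟨ sym (ℚₚ.+-identityʳ (a ℚ.* a)) ⟩
      a ℚ.* a ℚ.+ 0ℚ                     ≤⟨ ℚₚ.+-monoʳ-≤ (a ℚ.* a) (square-nonNeg b) ⟩
      a ℚ.* a ℚ.+ b ℚ.* b                ≡⟨ sym (ℚₚ.0≤p⇒∣p∣≡p (ℚₚ.+-mono-≤ (square-nonNeg a) (square-nonNeg b))) ⟩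
      ℚ.∣ a ℚ.* a ℚ.+ b ℚ.* b ∣          ∎

    -- A term of size at least ε makes the sum of squares at least ε². So the hypothesis is applied
    -- with tolerance ε², directly to the rational terms.
    sumOfSquares≈0 : ∀ x y → x *ᴿ x +ᴿ y *ᴿ y ≈ᴿ 0ᴿ → x ≈ᴿ 0ᴿ
    sumOfSquares≈0 x y h ε 0<ε =
      let ε>0 = ℚ.positive 0<ε
          N , g = h (ε ℚ.* ε) (ℚₚ.positive⁻¹ (ε ℚ.* ε) {{ℚₚ.pos*pos⇒pos ε {{ε>0}} ε {{ε>0}}}})
      in N , λ n N≤n → ℚₚ.≰⇒> λ ε≤ →
        let a = seq x n
            b = seq y n
            ε≤∣a∣ = subst (λ q → ε ℚ.≤ ℚ.∣ q ∣) (solve 1 (λ a → a :- con 0ℚ := a) refl a) ε≤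
        in ℚₚ.<-irrefl refl (begin-strict
          ε ℚ.* ε
            ≤⟨ ℚₚ.*-monoʳ-≤-nonNeg ε {{ℚₚ.pos⇒nonNeg ε {{ε>0}}}} ε≤∣a∣ ⟩
          ℚ.∣ a ∣ ℚ.* ε
            ≤⟨ ℚₚ.*-monoˡ-≤-nonNeg ℚ.∣ a ∣ {{ℚₚ.∣-∣-nonNeg a}} ε≤∣a∣ ⟩
          ℚ.∣ a ∣ ℚ.* ℚ.∣ a ∣
            ≡⟨ trans (sym (ℚₚ.∣p*q∣≡∣p∣*∣q∣ a a)) (ℚₚ.0≤p⇒∣p∣≡p (square-nonNeg a)) ⟩
          a ℚ.* a
            ≤⟨ square≤ a b ⟩
          ℚ.∣ a ℚ.* a ℚ.+ b ℚ.* b ∣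
            ≡⟨ cong ℚ.∣_∣ (solve 1 (λ q → q := q :- con 0ℚ) refl (a ℚ.* a ℚ.+ b ℚ.* b)) ⟩
          ℚ.∣ (a ℚ.* a ℚ.+ b ℚ.* b) ℚ.- 0ℚ ∣
            <⟨ g n N≤n ⟩
          ε ℚ.* ε ∎)

    -- The inverse is the conjugate divided by the norm a² + b². The norm is nonzero because its
    -- vanishing would kill both parts.
    inverseᶜ : ∀ x → ¬ x ≈ᶜ 0ᶜ → ∃ λ y → x *ᶜ y ≈ᶜ 1ᶜ
    inverseᶜ x@(a , b) x≉0 =
      let N = a *ᴿ a +ᴿ b *ᴿ b
          N≉0 : ¬ N ≈ᴿ 0ᴿ
          N≉0 N≈0 = x≉0 (sumOfSquares≈0 a b N≈0 ,
            sumOfSquares≈0 b a (≈ᴿ-trans {b *ᴿ b +ᴿ a *ᴿ a} {N} {0ᴿ}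
              (≗⇒≈ᴿ {b *ᴿ b +ᴿ a *ᴿ a} {N} (λ n → ℚₚ.+-comm (seq b n ℚ.* seq b n) (seq a n ℚ.* seq a n))) N≈0))
          u , Nu≈1 = inverseᴿ N N≉0
          y = a *ᴿ u , -ᴿ (b *ᴿ u)
          xy = x *ᶜ y
      in y
       , ≈ᴿ-trans {proj₁ xy} {N *ᴿ u} {1ᴿ}
           (≗⇒≈ᴿ {proj₁ xy} {N *ᴿ u} (λ n → solve 3 (λ a b u →
             a :* (a :* u) :+ :- (b :* :- (b :* u)) := (a :* a :+ b :* b) :* u) refl
             (seq a n) (seq b n) (seq u n))) Nu≈1
       , ≗⇒≈ᴿ {proj₂ xy} {0ᴿ} (λ n → solve 3 (λ a b u →
             a :* :- (b :* u) :+ b :* (a :* u) := con 0ℚ) refl (seq a n) (seq b n) (seq u n))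

  fromℚ : ℚ → C
  fromℚ q = ((λ _ → q) isCauchy const-cauchy q) , 0ᴿ

  fromℚ-injective : ∀ {p q} → fromℚ p ≈ᶜ fromℚ q → p ≡ q
  fromℚ-injective {p} {q} (h , _) with p ℚ.≟ q
  ... | yes p≡q = p≡q
  ... | no p≢q =
    let N , g = h ℚ.∣ p ℚ.- q ∣ (ℚₚ.≰⇒> λ ≤0 → p≢q
          (trans (solve 2 (λ p q → p := (p :- q) :+ q) refl p q)
            (trans (cong (ℚ._+ q) (ℚₚ.∣p∣≡0⇒p≡0 (p ℚ.- q) (ℚₚ.≤-antisym ≤0 (ℚₚ.0≤∣p∣ (p ℚ.- q)))))
              (ℚₚ.+-identityˡ q))))
    in ⊥-elim (ℚₚ.<-irrefl refl (g N ℕₚ.≤-refl))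

  fromℚ-homomorphism : CommutativeRing.rawRing ℚₚ.+-*-commutativeRing
                       -Raw-AlmostCommutative⟶ fromCommutativeRing ℂ-commutativeRing
  fromℚ-homomorphism = record
    { ⟦_⟧    = fromℚ
    ; +-homo = λ p q → ≗⇒≈ᶜ (fromℚ (p ℚ.+ q)) (fromℚ p +ᶜ fromℚ q) λ _ → refl , refl
    ; *-homo = λ p q → ≗⇒≈ᶜ (fromℚ (p ℚ.* q)) (fromℚ p *ᶜ fromℚ q) λ _ →
        solve 2 (λ p q → p :* q := p :* q :+ :- (con 0ℚ :* con 0ℚ)) refl p q
      , solve 2 (λ p q → con 0ℚ := p :* con 0ℚ :+ con 0ℚ :* q) refl p q
    ; -‿homo = λ p → ≗⇒≈ᶜ (fromℚ (ℚ.- p)) (-ᶜ fromℚ p) λ _ → refl , refl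
    ; 0-homo = ≗⇒≈ᶜ (fromℚ 0ℚ) 0ᶜ λ _ → refl , refl
    ; 1-homo = ≗⇒≈ᶜ (fromℚ 1ℚ) 1ᶜ λ _ → refl , refl
    }

-- Linear algebra

-- The embedding ι of ℚ expresses characteristic zero; it also supplies
-- the coefficients of the ring solver.
record ClassicalField : Set₁ where
  field
    em : ∀ {P : Set} → Dec P
    R  : CommutativeRing 0ℓ 0ℓ
  open CommutativeRing R
  field
    inverse : ∀ x → ¬ x ≈ 0# → ∃ λ y → x * y ≈ 1#
    ι       : CommutativeRing.rawRing ℚₚ.+-*-commutativeRing -Raw-AlmostCommutative⟶ fromCommutativeRing R
  open _-Raw-AlmostCommutative⟶_ ι
  field
    ι-injective : ∀ {p q} → ⟦ p ⟧ ≈ ⟦ q ⟧ → p ≡ q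

module LinearAlgebra (F : ClassicalField) where

  open ClassicalField F public
  open CommutativeRing R hiding (zero) public
  open _-Raw-AlmostCommutative⟶_ ι using (⟦_⟧; 0-homo; 1-homo)
  open RingProperties ring using (-0#≈0#; -‿distribˡ-*) public
  open Geometry rawRing public
  open Sum semiring public using (sum; sum-cong-≋; sum-remove; ∑-distrib-+; ∑-comm; *-distribˡ-sum; *-distribʳ-sum; sum-replicate-zero)
  open import Relation.Binary.Reasoning.Setoid setoid

  module Solver = RingSolver (CommutativeRing.rawRing ℚₚ.+-*-commutativeRing) (fromCommutativeRing R) ι
    (λ p q → Data.Maybe.map (λ p≡q → reflexive (≡.cong ⟦_⟧ p≡q)) (dec⇒maybe (p ℚ.≟ q)))
  open Solver using (solve; _:=_; _:+_; _:-_; _:*_; :-_; con)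

  0≉1 : ¬ 0# ≈ 1#
  0≉1 0≈1 with ι-injective (trans 0-homo (trans 0≈1 (sym 1-homo)))
  ... | ()

  x-x≈0 : ∀ x → x - x ≈ 0#
  x-x≈0 = -‿inverseʳ

  -≈0⇒≈ : ∀ {x y} → x - y ≈ 0# → x ≈ y
  -≈0⇒≈ {x} {y} h = begin
    x            ≈⟨ solve 2 (λ x y → x := (x :- y) :+ y) refl x y ⟩
    (x - y) + y  ≈⟨ +-congʳ h ⟩
    0# + y       ≈⟨ +-identityˡ y ⟩
    y            ∎

  ≈⇒-≈0 : ∀ {x y} → x ≈ y → x - y ≈ 0#
  ≈⇒-≈0 {x} {y} h = trans (+-congʳ h) (x-x≈0 y)

  *≈0⇒≈0 : ∀ {x y} → ¬ x ≈ 0# → x * y ≈ 0# → y ≈ 0#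
  *≈0⇒≈0 {x} {y} x≉0 xy≈0 with inverse x x≉0
  ... | u , xu≈1 = begin
    y            ≈⟨ *-identityˡ y ⟨
    1# * y       ≈⟨ *-congʳ xu≈1 ⟨
    (x * u) * y  ≈⟨ solve 3 (λ x u y → (x :* u) :* y := u :* (x :* y)) refl x u y ⟩
    u * (x * y)  ≈⟨ *-congˡ xy≈0 ⟩
    u * 0#       ≈⟨ zeroʳ u ⟩
    0#           ∎

  *≉0 : ∀ {x y} → ¬ x ≈ 0# → ¬ y ≈ 0# → ¬ x * y ≈ 0#
  *≉0 x≉0 y≉0 = y≉0 ∘ *≈0⇒≈0 x≉0

  sum-zero : ∀ {n} {f : Vect n} → f ≋ 𝟎 → sum f ≈ 0#
  sum-zero {n} h = trans (sum-cong-≋ h) (sum-replicate-zero n)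

  sum-single : ∀ {n} (f : Vect n) j → (∀ i → i ≢ j → f i ≈ 0#) → sum f ≈ f j
  sum-single {suc n} f j h = begin
    sum f                        ≈⟨ sum-remove {i = j} f ⟩
    f j + sum (f ∘ punchIn j)    ≈⟨ +-congˡ (sum-zero (λ i → h (punchIn j i) (Finₚ.punchInᵢ≢i j i))) ⟩
    f j + 0#                     ≈⟨ +-identityʳ (f j) ⟩
    f j                          ∎

  δ : ∀ {n} → Fin n → Vect n
  δ i j with i Finₚ.≟ j
  ... | yes _ = 1#
  ... | no _  = 0#

  δ-diagonal : ∀ {n} (i : Fin n) → δ i i ≈ 1#
  δ-diagonal i with i Finₚ.≟ i
  ... | yes _  = refl
  ... | no i≢i = ⊥-elim (i≢i ≡.refl)

  δ-off : ∀ {n} {i j : Fin n} → i ≢ j → δ i j ≈ 0#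
  δ-off {i = i} {j} i≢j with i Finₚ.≟ j
  ... | yes i≡j = ⊥-elim (i≢j i≡j)
  ... | no _    = refl

  δ-symmetric : ∀ {n} (i j : Fin n) → δ i j ≈ δ j i
  δ-symmetric i j with i Finₚ.≟ j
  ... | yes ≡.refl = sym (δ-diagonal i)
  ... | no i≢j     = sym (δ-off (i≢j ∘ ≡.sym))

  sum-δ : ∀ {n} (f : Vect n) j → sum (λ i → f i * δ j i) ≈ f j
  sum-δ f j = trans
    (sum-single (λ i → f i * δ j i) j (λ i i≢j → trans (*-congˡ (δ-off (λ j≡i → i≢j (≡.sym j≡i)))) (zeroʳ (f i))))
    (trans (*-congˡ (δ-diagonal j)) (*-identityʳ (f j)))

  record Subspace {m} (V : Vect m → Set) : Set where
    field
      resp : ∀ {v w} → v ≋ w → V v → V w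
      zero∈ : V 𝟎
      step∈ : ∀ a {v w} → V v → V w → V (λ j → a * v j + w j)

  open Subspace public

  combination∈ : ∀ {m k} {V : Vect m → Set} → Subspace V → (f : Fin k → Vect m) → (∀ i → V (f i)) →
    ∀ c → V (combination c f)
  combination∈ {k = zero}  S f f∈V c = zero∈ S
  combination∈ {k = suc k} S f f∈V c = step∈ S (c zero) (f∈V zero) (combination∈ S (f ∘ suc) (f∈V ∘ suc) (c ∘ suc))

  InSpan : ∀ {m k} → (Fin k → Vect m) → Vect m → Set
  InSpan f v = ∃ λ c → v ≋ combination c f

  combination-cong : ∀ {m k} {c d : Vect k} {f g : Fin k → Vect m} → c ≋ d → (∀ i → f i ≋ g i) →
    combination c f ≋ combination d g
  combination-cong c≋d f≋g j = sum-cong-≋ (λ i → *-cong (c≋d i) (f≋g i j))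

  combination-step : ∀ {m k} a (c d : Vect k) (f : Fin k → Vect m) →
    combination (λ i → a * c i + d i) f ≋ (λ j → a * combination c f j + combination d f j)
  combination-step a c d f j = begin
    sum (λ i → (a * c i + d i) * f i j)
      ≈⟨ sum-cong-≋ (λ i → solve 4 (λ a c d f → (a :* c :+ d) :* f := a :* (c :* f) :+ d :* f) refl a (c i) (d i) (f i j)) ⟩
    sum (λ i → a * (c i * f i j) + d i * f i j)
      ≈⟨ ∑-distrib-+ (λ i → a * (c i * f i j)) (λ i → d i * f i j) ⟩
    sum (λ i → a * (c i * f i j)) + combination d f j
      ≈⟨ +-congʳ (*-distribˡ-sum a (λ i → c i * f i j)) ⟨
    a * combination c f j + combination d f j ∎

  combination-δ : ∀ {m k} (f : Fin k → Vect m) i → f i ≋ combination (δ i) f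
  combination-δ f i j = sym (trans (sum-cong-≋ (λ l → *-comm (δ i l) (f l j))) (sum-δ (λ l → f l j) i))

  span-subspace : ∀ {m k} (f : Fin k → Vect m) → Subspace (InSpan f)
  span-subspace f = record
    { resp  = λ v≋w (c , v≋) → c , λ j → trans (sym (v≋w j)) (v≋ j)
    ; zero∈ = 𝟎 , λ j → sym (sum-zero (λ i → zeroˡ (f i j)))
    ; step∈ = λ a (c , v≋) (d , w≋) → (λ i → a * c i + d i) , λ j →
        trans (+-cong (*-congˡ (v≋ j)) (w≋ j)) (sym (combination-step a c d f j))
    }

  Span-subspace : ∀ {m} {I : Set} (f : I → Vect m) → Subspace (Span f)
  Span-subspace {m} f = record
    { resp  = λ v≋w (k , r , c , v≋) → k , r , c , λ j → trans (sym (v≋w j)) (v≋ j)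
    ; zero∈ = 0 , (λ ()) , (λ ()) , λ j → refl
    ; step∈ = λ a (k , r , c , v≋) w∈ → resp′ a k r c w∈ v≋
    }
    where
    Span′ = Span f
    add : ∀ k (r : Fin k → _) c {w} → Span′ w → Span′ (λ j → combination c (f ∘ r) j + w j)
    add zero    r c (l , s , d , w≋) = l , s , d , λ j → trans (+-identityˡ _) (w≋ j)
    add (suc k) r c {w} w∈ with add k (r ∘ suc) (c ∘ suc) w∈
    ... | l , s , d , ≋ = suc l , r zero ∷ s , c zero ∷ d , λ j → trans (+-assoc _ _ _) (+-congˡ (≋ j))
    resp′ : ∀ a k (r : Fin k → _) c {v w} → Span′ w → v ≋ combination c (f ∘ r) → Span′ (λ j → a * v j + w j)
    resp′ a k r c {v} {w} w∈ v≋ with add k r (λ i → a * c i) w∈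
    ... | l , s , d , ≋ = l , s , d , λ j → trans (+-congʳ (trans (*-congˡ (v≋ j))
      (trans (*-distribˡ-sum a (λ i → c i * f (r i) j)) (sum-cong-≋ (λ i → sym (*-assoc a (c i) (f (r i) j))))))) (≋ j)

  Span⊆ : ∀ {m} {I : Set} {V : Vect m → Set} → Subspace V → (f : I → Vect m) → (∀ i → V (f i)) → ∀ {v} → Span f v → V v
  Span⊆ S f f∈V (k , r , c , v≋) = resp S (λ j → sym (v≋ j)) (combination∈ S (f ∘ r) (f∈V ∘ r) c)

  ∈Span : ∀ {m} {I : Set} (f : I → Vect m) i → Span f (f i)
  ∈Span f i = 1 , (λ _ → i) , (λ _ → 1#) , λ j → sym (trans (+-identityʳ _) (*-identityˡ (f i j)))

  InSpan⇒Span : ∀ {m k} (f : Fin k → Vect m) {v} → InSpan f v → Span f v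
  InSpan⇒Span {k = k} f (c , v≋) = k , (λ i → i) , c , v≋

  Span⇒InSpan : ∀ {m k} (f : Fin k → Vect m) {v} → Span f v → InSpan f v
  Span⇒InSpan f = Span⊆ (span-subspace f) f (λ i → δ i , combination-δ f i)

  -- Gaussian elimination on the first coordinate. If it vanishes on all vectors, it is dropped;
  -- otherwise a pivot clears it in the other vectors, and the coefficient `c₀` of the pivot is the
  -- one that cancels the first coordinate of the relation found for the reduced vectors.
  dependent : ∀ {m k} → m ℕ.< k → (v : Fin k → Vect m) → ∃ λ c → ¬ c ≋ 𝟎 × combination c v ≋ 𝟎
  dependent {zero} {suc k} _ v = (λ _ → 1#) , (λ h → 0≉1 (sym (h zero))) , λ ()
  dependent {suc m} {suc k} (ℕ.s≤s m<k) v with em {∃ λ i → ¬ v i zero ≈ 0#}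
  ... | no none = let c , c≉0 , h = dependent (ℕₚ.m<n⇒m<1+n m<k) (λ i → v i ∘ suc) in
    c , c≉0 , λ where
      zero    → sum-zero (λ i → trans (*-congˡ (decidable-stable em (λ ≉0 → none (i , ≉0)))) (zeroʳ (c i)))
      (suc j) → h j
  ... | yes (p , a≉0) = c , (λ c≋0 → c′≉0 (λ i → trans (sym (c-punchIn i)) (c≋0 (punchIn p i)))) , λ where
      zero    → begin
        combination c v zero                                     ≈⟨ split zero ⟩
        c₀ * a + sum (λ i → c′ i * u i zero)
          ≈⟨ solve 3 (λ t w a → (:- (t :* w)) :* a :+ t := t :* (con 1ℚ :- a :* w)) refl t w a ⟩
        t * (⟦ 1ℚ ⟧ - a * w)         ≈⟨ *-congˡ (≈⇒-≈0 (trans 1-homo (sym aw≈1))) ⟩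
        t * 0#                                                   ≈⟨ zeroʳ t ⟩
        0#                                                       ∎
      (suc j) → begin
        combination c v (suc j)                                  ≈⟨ split (suc j) ⟩
        c₀ * v p (suc j) + sum (λ i → c′ i * u i (suc j))
          ≈⟨ +-congʳ (trans (solve 3 (λ t w b → (:- (t :* w)) :* b := t :* (:- (w :* b))) refl t w (v p (suc j)))
               (*-distribʳ-sum (- (w * v p (suc j))) (λ i → c′ i * u i zero))) ⟩
        sum (λ i → (c′ i * u i zero) * (- (w * v p (suc j)))) + sum (λ i → c′ i * u i (suc j))
          ≈⟨ ∑-distrib-+ (λ i → (c′ i * u i zero) * (- (w * v p (suc j)))) (λ i → c′ i * u i (suc j)) ⟨
        sum (λ i → (c′ i * u i zero) * (- (w * v p (suc j))) + c′ i * u i (suc j))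
          ≈⟨ sum-cong-≋ (λ i → solve 5 (λ c a w b d → (c :* a) :* (:- (w :* b)) :+ c :* d := c :* (d :- (a :* w) :* b)) refl
               (c′ i) (u i zero) w (v p (suc j)) (u i (suc j))) ⟩
        combination c′ reduced j                                 ≈⟨ h j ⟩
        0#                                                       ∎
    where
    a = v p zero
    w = proj₁ (inverse a a≉0)
    aw≈1 = proj₂ (inverse a a≉0)
    u : Fin k → Vect (suc m)
    u i = v (punchIn p i)
    reduced : Fin k → Vect m
    reduced i j = u i (suc j) - (u i zero * w) * v p (suc j)
    IH = dependent m<k reduced
    c′ = proj₁ IH
    c′≉0 = proj₁ (proj₂ IH)
    h = proj₂ (proj₂ IH)
    t = sum (λ i → c′ i * u i zero)
    c₀ = - (t * w)
    c = insertAt c′ p c₀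
    c-punchIn : ∀ i → c (punchIn p i) ≈ c′ i
    c-punchIn i = reflexive (insertAt-punchIn c′ p c₀ i)
    split : ∀ j → combination c v j ≈ c₀ * v p j + sum (λ i → c′ i * u i j)
    split j = trans (sum-remove {i = p} (λ i → c i * v i j))
      (+-cong (*-congʳ (reflexive (insertAt-lookup c′ p c₀))) (sum-cong-≋ (λ i → *-congʳ (c-punchIn i))))

  independent⇒≤ : ∀ {m k} (v : Fin k → Vect m) → LinearlyIndependent v → k ℕ.≤ m
  independent⇒≤ {m} {k} v ind with k ℕ.≤? m
  ... | yes k≤m = k≤m
  ... | no k≰m = let c , c≉0 , h = dependent (ℕₚ.≰⇒> k≰m) v in ⊥-elim (c≉0 (ind c h))

  combination-combination : ∀ {m k l} (c : Vect k) (A : Fin k → Vect l) (w : Fin l → Vect m) →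
    combination c (λ i → combination (A i) w) ≋ combination (combination c A) w
  combination-combination c A w j = begin
    sum (λ i → c i * sum (λ l → A i l * w l j))
      ≈⟨ sum-cong-≋ (λ i → *-distribˡ-sum (c i) (λ l → A i l * w l j)) ⟩
    sum (λ i → sum (λ l → c i * (A i l * w l j)))
      ≈⟨ ∑-comm (λ i l → c i * (A i l * w l j)) ⟩
    sum (λ l → sum (λ i → c i * (A i l * w l j)))
      ≈⟨ sum-cong-≋ (λ l → sum-cong-≋ (λ i → sym (*-assoc (c i) (A i l) (w l j)))) ⟩
    sum (λ l → sum (λ i → (c i * A i l) * w l j))
      ≈⟨ sum-cong-≋ (λ l → sym (*-distribʳ-sum (w l j) (λ i → c i * A i l))) ⟩
    combination (combination c A) w j ∎

  independent≤spanning : ∀ {m k l} (b : Fin k → Vect m) (w : Fin l → Vect m) →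
    LinearlyIndependent b → (∀ i → InSpan w (b i)) → k ℕ.≤ l
  independent≤spanning b w ind inSpan = independent⇒≤ (proj₁ ∘ inSpan) λ c h → ind c λ j → begin
    combination c b j
      ≈⟨ combination-cong {c = c} (λ _ → refl) (proj₂ ∘ inSpan) j ⟩
    combination c (λ i → combination (proj₁ (inSpan i)) w) j
      ≈⟨ combination-combination c (proj₁ ∘ inSpan) w j ⟩
    combination (combination c (proj₁ ∘ inSpan)) w j
      ≈⟨ sum-zero (λ l → trans (*-congʳ (h l)) (zeroˡ (w l j))) ⟩
    0# ∎

  extend-independent : ∀ {m k} (b : Fin k → Vect m) v → LinearlyIndependent b → ¬ InSpan b v →
    LinearlyIndependent (v ∷ b)
  extend-independent b v ind v∉ c h = λ where
      zero    → c₀≈0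
      (suc i) → ind (c ∘ suc) (λ j → trans (sym (trans (+-congʳ (trans (*-congʳ c₀≈0) (zeroˡ (v j)))) (+-identityˡ _))) (h j)) i
    where
    c₀≈0 : c zero ≈ 0#
    c₀≈0 = decidable-stable em λ c₀≉0 → let u , cu≈1 = inverse (c zero) c₀≉0 in
      v∉ ((λ i → - u * c (suc i)) , λ j → begin
        v j
          ≈⟨ solve 3 (λ x c u → x := (:- u) :* (:- (c :* x)) :+ (con 1ℚ :- c :* u) :* x) refl (v j) (c zero) u ⟩
        - u * (- (c zero * v j)) + (⟦ 1ℚ ⟧ - c zero * u) * v j
          ≈⟨ +-congˡ (trans (*-congʳ (≈⇒-≈0 (trans 1-homo (sym cu≈1)))) (zeroˡ (v j))) ⟩
        - u * (- (c zero * v j)) + 0#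
          ≈⟨ +-identityʳ _ ⟩
        - u * (- (c zero * v j))
          ≈⟨ *-congˡ (sym (-≈0⇒≈ (trans (solve 2 (λ x y → y :- (:- x) := x :+ y) refl (c zero * v j) (combination (c ∘ suc) b j)) (h j)))) ⟩
        - u * combination (c ∘ suc) b j
          ≈⟨ trans (*-distribˡ-sum (- u) (λ i → c (suc i) * b i j)) (sum-cong-≋ (λ i → sym (*-assoc (- u) (c (suc i)) (b i j)))) ⟩
        combination (λ i → - u * c (suc i)) b j ∎)

  square⇒spanning : ∀ {m} (b : Fin m → Vect m) → LinearlyIndependent b → ∀ v → InSpan b v
  square⇒spanning b ind v = decidable-stable em λ v∉ →
    ℕₚ.<-irrefl ≡.refl (independent⇒≤ (v ∷ b) (extend-independent b v ind v∉))

  -- An independent family inside `V` is extended as long as some vector of `V` escapes its span.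
  -- The `fuel` is `m` minus the current size, which suffices since `m + 1` vectors cannot be
  -- independent.
  hasDimension : ∀ {m} {V : Vect m → Set} → Subspace V → ∃ (HasDimension V)
  hasDimension {m} {V} S = go m zero (λ ()) (λ ()) (λ c h ()) (ℕₚ.+-identityʳ m)
    where
    go : ∀ fuel k (b : Fin k → Vect m) → (∀ i → V (b i)) → LinearlyIndependent b → fuel ℕ.+ k ≡ m → ∃ (HasDimension V)
    go fuel k b b∈V ind eq with em {∃ λ v → V v × ¬ InSpan b v}
    ... | no none = k , b , b∈V , ind , λ v v∈V → InSpan⇒Span b (decidable-stable em (λ v∉ → none (v , v∈V , v∉)))
    ... | yes (v , v∈V , v∉) with fuel
    ...   | zero  = ⊥-elim (ℕₚ.<-irrefl eq (independent⇒≤ (v ∷ b) (extend-independent b v ind v∉)))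
    ...   | suc f = go f (suc k) (v ∷ b) (λ { zero → v∈V ; (suc i) → b∈V i }) (extend-independent b v ind v∉)
                      (≡.trans (ℕₚ.+-suc f k) eq)

  independent≤dimension : ∀ {m k d} {V : Vect m → Set} (b : Fin k → Vect m) → LinearlyIndependent b →
    (∀ i → V (b i)) → HasDimension V d → k ℕ.≤ d
  independent≤dimension b ind b∈V (w , _ , _ , spans) =
    independent≤spanning b w ind (λ i → Span⇒InSpan w (spans (b i) (b∈V i)))

  sum-↑ : ∀ d {r} (f : Vect (d ℕ.+ r)) → sum f ≈ sum (λ i → f (i ↑ˡ r)) + sum (λ i → f (d ↑ʳ i))
  sum-↑ zero    f = sym (+-identityˡ _)
  sum-↑ (suc d) f = trans (+-congˡ (sum-↑ d (f ∘ suc))) (sym (+-assoc _ _ _))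

  combination-++ : ∀ {m d r} (c : Vect (d ℕ.+ r)) (w : Fin d → Vect m) (u : Fin r → Vect m) →
    combination c (w ++ u) ≋ (λ j → combination (λ i → c (i ↑ˡ r)) w j + combination (λ i → c (d ↑ʳ i)) u j)
  combination-++ {d = d} {r} c w u j = trans (sum-↑ d _) (+-cong
    (sum-cong-≋ (λ i → reflexive (≡.cong (λ v → c (i ↑ˡ r) * v j) (lookup-++ˡ w u i))))
    (sum-cong-≋ (λ i → reflexive (≡.cong (λ v → c (d ↑ʳ i) * v j) (lookup-++ʳ w u i)))))

  ↑-elim : ∀ d {r} {P : Fin (d ℕ.+ r) → Set} → (∀ i → P (i ↑ˡ r)) → (∀ i → P (d ↑ʳ i)) → ∀ i → P i
  ↑-elim zero    h k i       = k i
  ↑-elim (suc d) h k zero    = h zero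
  ↑-elim (suc d) h k (suc i) = ↑-elim d (h ∘ suc) k i

  ·-combination : ∀ {m k} (b : Vect m) (c : Vect k) (f : Fin k → Vect m) → b · combination c f ≈ sum (λ i → c i * (b · f i))
  ·-combination b c f = begin
    sum (λ j → b j * sum (λ i → c i * f i j))      ≈⟨ sum-cong-≋ (λ j → *-distribˡ-sum (b j) (λ i → c i * f i j)) ⟩
    sum (λ j → sum (λ i → b j * (c i * f i j)))    ≈⟨ ∑-comm (λ j i → b j * (c i * f i j)) ⟩
    sum (λ i → sum (λ j → b j * (c i * f i j)))
      ≈⟨ sum-cong-≋ (λ i → sum-cong-≋ (λ j → solve 3 (λ b c f → b :* (c :* f) := c :* (b :* f)) refl (b j) (c i) (f i j))) ⟩
    sum (λ i → sum (λ j → c i * (b j * f i j)))    ≈⟨ sum-cong-≋ (λ i → *-distribˡ-sum (c i) (λ j → b j * f i j)) ⟨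
    sum (λ i → c i * (b · f i))                    ∎

  ·-comm : ∀ {m} (v w : Vect m) → v · w ≈ w · v
  ·-comm v w = sum-cong-≋ (λ i → *-comm (v i) (w i))

  ·-cong : ∀ {m} {v v′ w w′ : Vect m} → v ≋ v′ → w ≋ w′ → v · w ≈ v′ · w′
  ·-cong h k = sum-cong-≋ (λ i → *-cong (h i) (k i))

  ·-step : ∀ {m} (b : Vect m) a (v w : Vect m) → b · (λ j → a * v j + w j) ≈ a * (b · v) + b · w
  ·-step b a v w = begin
    sum (λ j → b j * (a * v j + w j))
      ≈⟨ sum-cong-≋ (λ j → solve 4 (λ b a v w → b :* (a :* v :+ w) := a :* (b :* v) :+ b :* w) refl (b j) a (v j) (w j)) ⟩
    sum (λ j → a * (b j * v j) + b j * w j)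
      ≈⟨ ∑-distrib-+ (λ j → a * (b j * v j)) (λ j → b j * w j) ⟩
    sum (λ j → a * (b j * v j)) + b · w
      ≈⟨ +-congʳ (*-distribˡ-sum a (λ j → b j * v j)) ⟨
    a * (b · v) + b · w ∎

  ·-δ : ∀ {m} (b : Vect m) i → b · δ i ≈ b i
  ·-δ b i = sum-δ b i

  orthogonal-subspace : ∀ {m} {I : Set} (b : I → Vect m) → Subspace (λ z → ∀ i → b i · z ≈ 0#)
  orthogonal-subspace b = record
    { resp  = λ v≋w h i → trans (·-cong {v = b i} (λ _ → refl) (λ j → sym (v≋w j))) (h i)
    ; zero∈ = λ i → sum-zero (λ j → zeroʳ (b i j))
    ; step∈ = λ a {v} {w} h k i → trans (·-step (b i) a v w)
        (trans (+-cong (trans (*-congˡ (h i)) (zeroʳ a)) (k i)) (+-identityˡ 0#))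
    }

  -- A proper image of z ↦ (b i · z)ᵢ would be annihilated by a nonzero
  -- functional, that is, by a linear relation between the b i.
  independent⇒dual : ∀ {m k} (b : Fin k → Vect m) → LinearlyIndependent b →
    ∀ y → ∃ λ z → ∀ i → b i · z ≈ y i
  independent⇒dual {m} {k} b ind y with hasDimension image-subspace
    where
    image-subspace : Subspace (λ y → ∃ λ z → ∀ i → b i · z ≈ y i)
    image-subspace = record
      { resp  = λ v≋w (z , h) → z , λ i → trans (h i) (v≋w i)
      ; zero∈ = 𝟎 , zero∈ (orthogonal-subspace b)
      ; step∈ = λ a (z , h) (z′ , h′) → (λ j → a * z j + z′ j) , λ i →
          trans (·-step (b i) a z z′) (+-cong (*-congˡ (h i)) (h′ i))
      }
  ... | s , g , g∈ , g-ind , g-spans with s ℕ.≟ k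
  ...   | yes ≡.refl = let c , y≋ = square⇒spanning g g-ind y in
    combination c (proj₁ ∘ g∈) , λ i → trans (·-combination (b i) c (proj₁ ∘ g∈))
      (trans (sum-cong-≋ (λ l → *-congˡ (proj₂ (g∈ l) i))) (sym (y≋ i)))
  ...   | no s≢k = ⊥-elim (c≉0 (ind c λ j →
          trans (sum-cong-≋ (λ i → *-congˡ (sym (·-δ (b i) j))))
            (Span⊆ (orthogonal-subspace {I = Fin 1} (λ _ → c)) g
              (λ l _ → h l)
              (g-spans (λ i → b i · δ j) (δ j , λ i → refl)) zero)))
    where
    ∃c = dependent (ℕₚ.≤∧≢⇒< (independent⇒≤ g g-ind) s≢k) (λ i l → g l i)
    c = proj₁ ∃c
    c≉0 = proj₁ (proj₂ ∃c)
    h = proj₂ (proj₂ ∃c)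

  -- The vectors `u l` dual to the `b i` complement the kernel: pairing with `b` reads off their
  -- coefficients and kills those of the kernel basis `w`. So `w ++ u` is a basis of the whole
  -- space.
  rank-nullity : ∀ {m d k} (b : Fin k → Vect m) → LinearlyIndependent b →
    HasDimension (λ z → ∀ i → b i · z ≈ 0#) d → d ℕ.+ k ≡ m
  rank-nullity {m} {d} {k} b b-ind (w , w∈ , w-ind , w-spans) = ℕₚ.≤-antisym
      (independent⇒≤ (w ++ u) wu-ind)
      (independent≤spanning δ (w ++ u) (λ c h j → trans (sym (trans (sum-cong-≋ (λ i → *-congˡ (δ-symmetric i j))) (sum-δ c j))) (h j)) (λ i → spans (δ i)))
    where
    u : Fin k → Vect m
    u l = proj₁ (independent⇒dual b b-ind (δ l))
    b·u : ∀ i l → b i · u l ≈ δ l i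
    b·u i l = proj₂ (independent⇒dual b b-ind (δ l)) i
    b·combination-u : ∀ i (β : Vect k) → b i · combination β u ≈ β i
    b·combination-u i β = trans (·-combination (b i) β u)
      (trans (sum-cong-≋ (λ l → *-congˡ (trans (b·u i l) (δ-symmetric l i)))) (sum-δ β i))
    wu-ind : LinearlyIndependent (w ++ u)
    wu-ind c h = ↑-elim d α≈0 β≈0
      where
      α = λ i → c (i ↑ˡ k)
      β = λ i → c (d ↑ʳ i)
      h′ : ∀ j → combination α w j + combination β u j ≈ 0#
      h′ j = trans (sym (combination-++ c w u j)) (h j)
      β≈0 : ∀ i → β i ≈ 0#
      β≈0 i = begin
        β i                                                  ≈⟨ b·combination-u i β ⟨
        b i · combination β u                                ≈⟨ trans (+-congʳ (trans (*-congˡ (combination∈ (orthogonal-subspace b) w w∈ α i)) (zeroʳ 1#))) (+-identityˡ _) ⟨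
        1# * (b i · combination α w) + b i · combination β u ≈⟨ ·-step (b i) 1# (combination α w) (combination β u) ⟨
        b i · (λ j → 1# * combination α w j + combination β u j)
          ≈⟨ sum-zero (λ j → trans (*-congˡ (trans (+-congʳ (*-identityˡ _)) (h′ j))) (zeroʳ (b i j))) ⟩
        0# ∎
      α≈0 : ∀ i → α i ≈ 0#
      α≈0 = w-ind α λ j → trans (sym (trans (+-congˡ (sum-zero (λ i → trans (*-congʳ (β≈0 i)) (zeroˡ (u i j))))) (+-identityʳ _))) (h′ j)
    spans : ∀ v → InSpan (w ++ u) v
    spans v = let β = λ i → b i · v
                  v′ = λ j → - 1# * combination β u j + v j
                  α , v′≋ = Span⇒InSpan w (w-spans v′ (λ i → trans (·-step (b i) (- 1#) (combination β u) v)
                    (trans (+-congʳ (*-congˡ (b·combination-u i β)))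
                      (trans (+-congʳ (trans (sym (-‿distribˡ-* 1# (β i))) (-‿cong (*-identityˡ (β i))))) (-‿inverseˡ (β i))))))
                  c = α ++ β
              in c , λ j → sym (begin
                combination c (w ++ u) j
                  ≈⟨ combination-++ c w u j ⟩
                combination (λ i → c (i ↑ˡ k)) w j + combination (λ i → c (d ↑ʳ i)) u j
                  ≈⟨ +-cong (sum-cong-≋ (λ i → *-congʳ (reflexive (lookup-++ˡ α β i))))
                            (sum-cong-≋ (λ i → *-congʳ (reflexive (lookup-++ʳ α β i)))) ⟩
                combination α w j + combination β u j
                  ≈⟨ +-congʳ (sym (v′≋ j)) ⟩
                (- 1# * combination β u j + v j) + combination β u j
                  ≈⟨ +-congʳ (+-congʳ (trans (sym (-‿distribˡ-* 1# _)) (-‿cong (*-identityˡ _)))) ⟩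
                (- combination β u j + v j) + combination β u j
                  ≈⟨ solve 2 (λ x v → (:- x :+ v) :+ x := v) refl (combination β u j) (v j) ⟩
                v j ∎)

  -- The fraction is given in lowest terms, the argument 0 being the denominator minus one, so that
  -- injectivity can be read off the numerator.
  fromℕ : ℕ → Carrier
  fromℕ k = ⟦ ℚ.mkℚ (ℤ.+ k) 0 (Coprimality.sym (Coprimality.1-coprimeTo k)) ⟧

  fromℕ-injective : ∀ {k l} → fromℕ k ≈ fromℕ l → k ≡ l
  fromℕ-injective h = ℤₚ.+-injective (≡.cong ℚ.numerator (ι-injective h))

  -- Holding at all large natural numbers plays the part of holding generically on the affine line:
  -- finitely many such conditions can be met together, and avoiding the root of a nonzero
  -- polynomial of degree at most one is such a condition.
  record Eventually (P : Carrier → Set) : Set where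
    constructor _,_
    field
      from  : ℕ
      holds : ∀ k → from ℕ.≤ k → P (fromℕ k)

  eventually-witness : ∀ {P} → Eventually P → ∃ P
  eventually-witness (N , h) = fromℕ N , h N ℕₚ.≤-refl

  eventually-× : ∀ {P Q} → Eventually P → Eventually Q → Eventually (λ t → P t × Q t)
  eventually-× (N , h) (N′ , h′) = N ℕ.⊔ N′ , λ k le → h k (ℕₚ.m⊔n≤o⇒m≤o N N′ le) , h′ k (ℕₚ.m⊔n≤o⇒n≤o N N′ le)

  eventually-∀ : ∀ {m} {P : Fin m → Carrier → Set} → (∀ i → Eventually (P i)) → Eventually (λ t → ∀ i → P i t)
  eventually-∀ {zero}  h = 0 , λ _ _ ()
  eventually-∀ {suc m} h with eventually-× (h zero) (eventually-∀ (h ∘ suc))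
  ... | N , g = N , λ k le → λ { zero → proj₁ (g k le) ; (suc i) → proj₂ (g k le) i }

  eventually-⇒ : ∀ {H : Set} {P : Carrier → Set} → (H → Eventually P) → Eventually (λ t → H → P t)
  eventually-⇒ {H} f with em {H}
  ... | yes h = let N , g = f h in N , λ k le _ → g k le
  ... | no ¬h = 0 , λ _ _ h → ⊥-elim (¬h h)

  eventually-≉ : ∀ a → Eventually (λ t → ¬ t ≈ a)
  eventually-≉ a with em {∃ λ k → fromℕ k ≈ a}
  ... | no none    = 0 , λ k _ h → none (k , h)
  ... | yes (k , h) = suc k , λ l k<l h′ → ℕₚ.<-irrefl (fromℕ-injective (trans h (sym h′))) k<l

  eventually-linear : ∀ a b → ¬ (a ≈ 0# × b ≈ 0#) → Eventually (λ t → ¬ t * a + b ≈ 0#)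
  eventually-linear a b ≉0 with em {a ≈ 0#}
  ... | yes a≈0 = 0 , λ k _ h → ≉0 (a≈0 , trans (sym (trans (+-congʳ (trans (*-congˡ a≈0) (zeroʳ _))) (+-identityˡ b))) h)
  ... | no a≉0 with inverse a a≉0 | eventually-≉ (- (b * proj₁ (inverse a a≉0)))
  ...   | u , au≈1 | N , g = N , λ k le h → g k le (let t = fromℕ k in begin
      t                            ≈⟨ *-identityʳ t ⟨
      t * 1#                       ≈⟨ *-congˡ au≈1 ⟨
      t * (a * u)                  ≈⟨ solve 4 (λ t a b u → t :* (a :* u) := (t :* a :+ b) :* u :- b :* u) refl t a b u ⟩
      (t * a + b) * u - b * u      ≈⟨ +-congʳ (trans (*-congʳ h) (zeroˡ u)) ⟩
      0# - b * u                   ≈⟨ +-identityˡ _ ⟩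
      - (b * u)                    ∎)

  -- A vector space over an infinite field is not a finite union of proper subspaces. If `z` avoids
  -- the later kernels and `w` the first one, then `t w + z` avoids all of them for all but finitely
  -- many `t`. The predicate `H` selects the functionals that matter.
  common-nonzero : ∀ {m k} {V : Vect m → Set} → Subspace V → (φ : Fin k → Vect m → Carrier) →
    (∀ i a v w → φ i (λ j → a * v j + w j) ≈ a * φ i v + φ i w) → (H : Fin k → Set) →
    (∀ i → H i → ∃ λ z → V z × ¬ φ i z ≈ 0#) → ∃ λ z → V z × ∀ i → H i → ¬ φ i z ≈ 0#
  common-nonzero {k = zero}  S φ lin H h = 𝟎 , zero∈ S , λ ()
  common-nonzero {k = suc k} S φ lin H h with common-nonzero S (φ ∘ suc) (lin ∘ suc) (H ∘ suc) (h ∘ suc) | em {H zero}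
  ... | z , z∈ , good | no ¬H = z , z∈ , λ { zero H₀ → ⊥-elim (¬H H₀) ; (suc i) → good i }
  ... | z , z∈ , good | yes H₀ with h zero H₀
  ...   | w , w∈ , φw≉0 with eventually-witness (eventually-×
            (eventually-linear (φ zero w) (φ zero z) (φw≉0 ∘ proj₁))
            (eventually-∀ (λ i → eventually-⇒ (λ Hi → eventually-linear (φ (suc i) w) (φ (suc i) z) (good i Hi ∘ proj₂)))))
  ...     | t , g₀ , g = (λ j → t * w j + z j) , step∈ S t w∈ z∈ , λ where
              zero _     → g₀ ∘ trans (sym (lin zero t w z))
              (suc i) Hi → g i Hi ∘ trans (sym (lin (suc i) t w z))

-- Subsets and vector matroids

module Enumerations where

  record Enumeration {n k} (e : Fin k → Fin n) (I : Subset n) : Set where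
    field
      member    : ∀ i → e i ∈ I
      injective : ∀ {i j} → e i ≡ e j → i ≡ j
      onto      : ∀ {x} → x ∈ I → ∃ λ i → e i ≡ x

  open Enumeration public

  private variable
    n k : ℕ
    I J : Subset n

  enumerate : (I : Subset n) → ∃ λ (e : Fin ∣ I ∣ → Fin n) → Enumeration e I
  enumerate Vec.[] = (λ ()) , record { member = λ () ; injective = λ {i} → ⊥-elim (Finₚ.¬Fin0 i) ; onto = λ () }
  enumerate (outside Vec.∷ I) with enumerate I
  ... | e , en = suc ∘ e , record
    { member    = Vec.there ∘ member en
    ; injective = injective en ∘ Finₚ.suc-injective
    ; onto      = λ { (Vec.there x∈I) → let i , eq = onto en x∈I in i , ≡.cong suc eq }
    }
  enumerate (inside Vec.∷ I) with enumerate I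
  ... | e , en = zero ∷ (suc ∘ e) , record
    { member    = λ { zero → Vec.here ; (suc i) → Vec.there (member en i) }
    ; injective = λ { {zero} {zero} _ → ≡.refl ; {suc i} {suc j} eq → ≡.cong suc (injective en (Finₚ.suc-injective eq)) }
    ; onto      = λ { Vec.here → zero , ≡.refl
                    ; (Vec.there x∈I) → let i , eq = onto en x∈I in suc i , ≡.cong suc eq }
    }

  ∷-enumeration : ∀ {e : Fin k → Fin n} {x} → Enumeration e I → x ∉ I → Enumeration (x ∷ e) (I ∪ ⁅ x ⁆)
  ∷-enumeration {I = I} {e = e} {x} en x∉I = record
    { member    = λ { zero → Subsetₚ.q⊆p∪q I ⁅ x ⁆ (Subsetₚ.x∈⁅x⁆ x) ; (suc i) → Subsetₚ.p⊆p∪q ⁅ x ⁆ (member en i) }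
    ; injective = λ { {zero}  {zero}  _  → ≡.refl
                    ; {zero}  {suc j} eq → ⊥-elim (x∉I (≡.subst (_∈ I) (≡.sym eq) (member en j)))
                    ; {suc i} {zero}  eq → ⊥-elim (x∉I (≡.subst (_∈ I) eq (member en i)))
                    ; {suc i} {suc j} eq → ≡.cong suc (injective en eq) }
    ; onto      = λ y∈ → [ (λ y∈I → let i , eq = onto en y∈I in suc i , eq)
                          , (λ y∈x → zero , ≡.sym (Subsetₚ.x∈⁅y⁆⇒x≡y x y∈x)) ]′ (Subsetₚ.x∈p∪q⁻ I ⁅ x ⁆ y∈)
    }

  injective⇒≤∣∣ : (f : Fin k → Fin n) → (∀ {i j} → f i ≡ f j → i ≡ j) → (∀ i → f i ∈ I) → k ℕ.≤ ∣ I ∣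
  injective⇒≤∣∣ {I = I} f f-inj f∈I with enumerate I
  ... | e , en = Finₚ.injective⇒≤ {f = λ i → proj₁ (onto en (f∈I i))} λ {i} {j} eq →
    f-inj (≡.trans (≡.sym (proj₂ (onto en (f∈I i)))) (≡.trans (≡.cong e eq) (proj₂ (onto en (f∈I j)))))

  enumeration-size : ∀ {e : Fin k → Fin n} → Enumeration e I → ∣ I ∣ ≡ k
  enumeration-size {I = I} {e = e} en with enumerate I
  ... | e′ , en′ = ℕₚ.≤-antisym
    (Finₚ.injective⇒≤ {f = λ i → proj₁ (onto en (member en′ i))} λ {i} {j} eq → injective en′
      (≡.trans (≡.sym (proj₂ (onto en (member en′ i)))) (≡.trans (≡.cong e eq) (proj₂ (onto en (member en′ j))))))
    (injective⇒≤∣∣ e (injective en) (member en))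

  enumerate⁅⁆ : (p : Fin n) → Enumeration {k = 1} (λ _ → p) ⁅ p ⁆
  enumerate⁅⁆ p = record
    { member    = λ _ → Subsetₚ.x∈⁅x⁆ p
    ; injective = λ { {zero} {zero} _ → ≡.refl }
    ; onto      = λ x∈ → zero , ≡.sym (Subsetₚ.x∈⁅y⁆⇒x≡y p x∈)
    }

  pair : Fin n → Fin n → Subset n
  pair p q = ⁅ p ⁆ ∪ ⁅ q ⁆

  triple : Fin n → Fin n → Fin n → Subset n
  triple p q r = pair p q ∪ ⁅ r ⁆

  module _ {p q : Fin n} where

    p∈pair : p ∈ pair p q
    p∈pair = Subsetₚ.p⊆p∪q ⁅ q ⁆ (Subsetₚ.x∈⁅x⁆ p)

    q∈pair : q ∈ pair p q
    q∈pair = Subsetₚ.q⊆p∪q ⁅ p ⁆ ⁅ q ⁆ (Subsetₚ.x∈⁅x⁆ q)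

    ∈pair⁻ : ∀ {x} → x ∈ pair p q → x ≡ p ⊎ x ≡ q
    ∈pair⁻ x∈ = Data.Sum.map (Subsetₚ.x∈⁅y⁆⇒x≡y p) (Subsetₚ.x∈⁅y⁆⇒x≡y q) (Subsetₚ.x∈p∪q⁻ ⁅ p ⁆ ⁅ q ⁆ x∈)

    pair⊆ : p ∈ I → q ∈ I → pair p q ⊆ I
    pair⊆ p∈ q∈ x∈ with ∈pair⁻ x∈
    ... | inj₁ ≡.refl = p∈
    ... | inj₂ ≡.refl = q∈

    enumerate-pair : p ≢ q → Enumeration (q ∷ λ _ → p) (pair p q)
    enumerate-pair p≢q = ∷-enumeration (enumerate⁅⁆ p) (λ q∈ → p≢q (≡.sym (Subsetₚ.x∈⁅y⁆⇒x≡y p q∈)))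

    ∣pair∣≡2 : p ≢ q → ∣ pair p q ∣ ≡ 2
    ∣pair∣≡2 p≢q = enumeration-size (enumerate-pair p≢q)

    ∣pair∣≤2 : ∣ pair p q ∣ ℕ.≤ 2
    ∣pair∣≤2 with p Finₚ.≟ q
    ... | no p≢q = ℕₚ.≤-reflexive (∣pair∣≡2 p≢q)
    ... | yes ≡.refl = ℕₚ.≤-trans (Subsetₚ.p⊆q⇒∣p∣≤∣q∣ {q = ⁅ p ⁆} (pair⊆ (Subsetₚ.x∈⁅x⁆ p) (Subsetₚ.x∈⁅x⁆ p)))
                         (ℕₚ.≤-trans (ℕₚ.≤-reflexive (Subsetₚ.∣⁅x⁆∣≡1 p)) (ℕ.s≤s ℕ.z≤n))

  module _ {p q r : Fin n} where

    p∈triple : p ∈ triple p q r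
    p∈triple = Subsetₚ.p⊆p∪q ⁅ r ⁆ (p∈pair {q = q})

    q∈triple : q ∈ triple p q r
    q∈triple = Subsetₚ.p⊆p∪q ⁅ r ⁆ (q∈pair {p = p})

    r∈triple : r ∈ triple p q r
    r∈triple = Subsetₚ.q⊆p∪q (pair p q) ⁅ r ⁆ (Subsetₚ.x∈⁅x⁆ r)

    ∈triple⁻ : ∀ {x} → x ∈ triple p q r → x ≡ p ⊎ x ≡ q ⊎ x ≡ r
    ∈triple⁻ x∈ with Subsetₚ.x∈p∪q⁻ (pair p q) ⁅ r ⁆ x∈
    ... | inj₂ x∈r = inj₂ (inj₂ (Subsetₚ.x∈⁅y⁆⇒x≡y r x∈r))
    ... | inj₁ x∈pq = [ inj₁ , inj₂ ∘ inj₁ ]′ (∈pair⁻ x∈pq)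

    triple⊆ : p ∈ I → q ∈ I → r ∈ I → triple p q r ⊆ I
    triple⊆ p∈ q∈ r∈ x∈ with ∈triple⁻ x∈
    ... | inj₁ ≡.refl        = p∈
    ... | inj₂ (inj₁ ≡.refl) = q∈
    ... | inj₂ (inj₂ ≡.refl) = r∈

  record Distinct₃ (p q r : Fin n) : Set where
    constructor distinct
    field
      p≢q : p ≢ q
      p≢r : p ≢ r
      q≢r : q ≢ r

  module _ {p q r : Fin n} (d : Distinct₃ p q r) where
    open Distinct₃ d

    enumerate-triple : Enumeration (r ∷ q ∷ λ _ → p) (triple p q r)
    enumerate-triple = ∷-enumeration (enumerate-pair p≢q)
      (λ r∈ → [ p≢r ∘ ≡.sym , q≢r ∘ ≡.sym ]′ (∈pair⁻ r∈))

    ∣triple∣≡3 : ∣ triple p q r ∣ ≡ 3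
    ∣triple∣≡3 = enumeration-size enumerate-triple

    3≤∣∣ : p ∈ I → q ∈ I → r ∈ I → 3 ℕ.≤ ∣ I ∣
    3≤∣∣ {I = I} p∈ q∈ r∈ = ℕₚ.≤-trans (ℕₚ.≤-reflexive (≡.sym ∣triple∣≡3)) (Subsetₚ.p⊆q⇒∣p∣≤∣q∣ {q = I} (triple⊆ p∈ q∈ r∈))

  ∣∣≡3⇒triple : ∣ I ∣ ≡ 3 → ∃ λ p → ∃ λ q → ∃ λ r → Distinct₃ p q r × I ≡ triple p q r
  ∣∣≡3⇒triple {I = I} eq with enumerate I
  ... | e , en = split eq e en
    where
    split : ∀ {k} → k ≡ 3 → (e : Fin k → Fin _) → Enumeration e I →
            ∃ λ p → ∃ λ q → ∃ λ r → Distinct₃ p q r × I ≡ triple p q r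
    split ≡.refl e en = e zero , e (suc zero) , e (suc (suc zero))
      , distinct (λ h → contradiction (injective en h) λ ()) (λ h → contradiction (injective en h) λ ())
                 (λ h → contradiction (injective en h) λ ())
      , Subsetₚ.⊆-antisym to (triple⊆ (member en zero) (member en (suc zero)) (member en (suc (suc zero))))
      where
      to : I ⊆ triple (e zero) (e (suc zero)) (e (suc (suc zero)))
      to x∈ with onto en x∈
      ... | zero , ≡.refl           = p∈triple {q = e (suc zero)} {r = e (suc (suc zero))}
      ... | suc zero , ≡.refl       = q∈triple {p = e zero} {r = e (suc (suc zero))}
      ... | suc (suc zero) , ≡.refl = r∈triple {p = e zero} {q = e (suc zero)}

  ∈∉⇒≢ : ∀ {p q : Fin n} → p ∈ I → q ∉ I → p ≢ q
  ∈∉⇒≢ p∈ q∉ ≡.refl = q∉ p∈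

  -- The points `p` and `q` may coincide; in this way the lemma also picks a point different from a
  -- single given one.
  third : 3 ℕ.≤ ∣ I ∣ → ∀ p q → ∃ λ r → r ∈ I × r ≢ p × r ≢ q
  third {I = I} 3≤ p q with Finₚ.any? (λ r → (r Subsetₚ.∈? I) ×-dec ¬? (r Finₚ.≟ p) ×-dec ¬? (r Finₚ.≟ q))
  ... | yes w = w
  ... | no none = ⊥-elim (ℕₚ.<-irrefl ≡.refl (ℕₚ.≤-trans 3≤ (ℕₚ.≤-trans
      (Subsetₚ.p⊆q⇒∣p∣≤∣q∣ {q = pair p q} I⊆) (∣pair∣≤2 {p = p} {q = q}))))
    where
    I⊆ : I ⊆ pair p q
    I⊆ {x} x∈ with x Finₚ.≟ p | x Finₚ.≟ q
    ... | yes ≡.refl | _          = p∈pair {q = q}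
    ... | no _       | yes ≡.refl = q∈pair {p = p}
    ... | no x≢p     | no x≢q     = ⊥-elim (none (x , x∈ , x≢p , x≢q))

  three : 3 ℕ.≤ ∣ I ∣ → ∃ λ p → ∃ λ q → ∃ λ r → Distinct₃ p q r × p ∈ I × q ∈ I × r ∈ I
  three {I = I} 3≤ with enumerate I
  ... | e , en = go e en 3≤
    where
    go : ∀ {k} (e : Fin k → Fin _) → Enumeration e I → 3 ℕ.≤ k → ∃ λ p → ∃ λ q → ∃ λ r → Distinct₃ p q r × p ∈ I × q ∈ I × r ∈ I
    go e en (ℕ.s≤s (ℕ.s≤s (ℕ.s≤s _))) = e zero , e (suc zero) , e (suc (suc zero))
      , distinct (λ h → contradiction (injective en h) λ ()) (λ h → contradiction (injective en h) λ ())
                 (λ h → contradiction (injective en h) λ ())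
      , member en zero , member en (suc zero) , member en (suc (suc zero))

  module _ (em : ∀ {P : Set} → Dec P) where

    subset : (Fin n → Set) → Subset n
    subset P = Vec.tabulate (λ x → does (em {P x}))

    ∈subset⁺ : ∀ {P : Fin n → Set} {x} → P x → x ∈ subset P
    ∈subset⁺ {P = P} {x} px = Vecₚ.lookup⇒[]= x (subset P)
      (≡.trans (Vecₚ.lookup∘tabulate _ x) (dec-true (em {P x}) px))

    ∈subset⁻ : ∀ {P : Fin n → Set} {x} → x ∈ subset P → P x
    ∈subset⁻ {P = P} {x} x∈ with em {P x} | ≡.trans (≡.sym (Vecₚ.lookup∘tabulate (λ x → does (em {P x})) x)) (Vecₚ.[]=⇒lookup x∈)
    ... | yes px | _ = px

module VectorMatroid (F : ClassicalField) where

  open LinearAlgebra F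
  open Enumerations

  private variable
    n m k : ℕ
    I J E : Subset n

  -- Independence on a subset speaks of coefficients on all of `Fin n` that vanish off `I`, linear
  -- algebra of coefficients along an enumeration. Writing the former in unit vectors at the points
  -- of `I` translates between the two.
  supported-combination : ∀ {e : Fin k → Fin n} → Enumeration e I → (c : Vect n) → (∀ x → x ∉ I → c x ≈ 0#) →
    c ≋ combination (c ∘ e) (δ ∘ e)
  supported-combination {I = I} {e = e} en c c-off x with x Subsetₚ.∈? I
  ... | no x∉I = trans (c-off x x∉I) (sym (sum-zero (λ i →
          trans (*-congˡ (δ-off (λ eq → x∉I (≡.subst (_∈ I) eq (member en i))))) (zeroʳ _))))
  ... | yes x∈I with onto en x∈I
  ...   | i , ≡.refl = sym (trans
          (sum-single _ i (λ j j≢i → trans (*-congˡ (δ-off (j≢i ∘ injective en))) (zeroʳ _)))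
          (trans (*-congˡ (δ-diagonal (e i))) (*-identityʳ _)))

  combination-δ∘ : ∀ {e : Fin k → Fin n} (c : Vect k) (v : Fin n → Vect m) →
    combination (combination c (δ ∘ e)) v ≋ combination c (v ∘ e)
  combination-δ∘ {e = e} c v j = trans (sym (combination-combination c (δ ∘ e) v j))
    (combination-cong {c = c} (λ _ → refl) (λ i l → sym (combination-δ v (e i) l)) j)

  independentOn⇒ : ∀ {e : Fin k → Fin n} {v : Fin n → Vect m} → Enumeration e I →
    LinearlyIndependentOn I v → LinearlyIndependent (v ∘ e)
  independentOn⇒ {e = e} {v} en ind c h i = trans (sym (trans
      (sum-single _ i (λ j j≢i → trans (*-congˡ (δ-off (j≢i ∘ injective en))) (zeroʳ _)))
      (trans (*-congˡ (δ-diagonal (e i))) (*-identityʳ _))))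
    (ind (combination c (δ ∘ e))
      (λ x x∉I → sum-zero (λ i → trans (*-congˡ (δ-off (λ eq → x∉I (≡.subst (_∈ _) eq (member en i))))) (zeroʳ _)))
      (λ j → trans (combination-δ∘ c v j) (h j)) (e i))

  ⇒independentOn : ∀ {e : Fin k → Fin n} {v : Fin n → Vect m} → Enumeration e I →
    LinearlyIndependent (v ∘ e) → LinearlyIndependentOn I v
  ⇒independentOn {e = e} {v} en ind c c-off h x = trans (c≋ x) (sum-zero (λ i → trans (*-congʳ (ce≋0 i)) (zeroˡ _)))
    where
    c≋ = supported-combination en c c-off
    ce≋0 : c ∘ e ≋ 𝟎
    ce≋0 = ind (c ∘ e) λ j → trans (sym (combination-δ∘ (c ∘ e) v j))
      (trans (combination-cong {f = v} (λ x → sym (c≋ x)) (λ _ _ → refl) j) (h j))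

  vectorMatroid : (E : Subset n) → (Fin n → Vect m) → Matroid E
  vectorMatroid {n} E v = record
    { Indep      = λ I → I ⊆ E × LinearlyIndependentOn I v
    ; indep⊆E    = proj₁
    ; ∅-indep    = (λ x∈ → ⊥-elim (Subsetₚ.∉⊥ x∈)) , λ c c-off h x → c-off x Subsetₚ.∉⊥
    ; hereditary = λ I⊆J (J⊆E , J-ind) → (λ x∈ → J⊆E (I⊆J x∈)) , λ c c-off → J-ind c (λ x x∉J → c-off x (x∉J ∘ I⊆J))
    ; exchange   = augment
    }
    where
    -- If no element of `J` could be added to `I`, every vector of `J` would lie in the span of the
    -- vectors of `I`, so the larger independent family would be spanned by the smaller one.
    augment : ∀ {I J} → I ⊆ E × LinearlyIndependentOn I v → J ⊆ E × LinearlyIndependentOn J v → ∣ I ∣ ℕ.< ∣ J ∣ →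
      ∃ λ x → x ∈ J × x ∉ I × (I ∪ ⁅ x ⁆) ⊆ E × LinearlyIndependentOn (I ∪ ⁅ x ⁆) v
    augment {I} {J} (I⊆E , I-ind) (J⊆E , J-ind) ∣I∣<∣J∣ with enumerate I | enumerate J
    ... | e , en | e′ , en′ = decidable-stable em λ none →
      ℕₚ.<⇒≱ ∣I∣<∣J∣ (independent≤spanning (v ∘ e′) (v ∘ e) (independentOn⇒ en′ J-ind) λ i →
        decidable-stable em λ ∉span →
        let x = e′ i
            x∉I : x ∉ I
            x∉I x∈I = let j , eq = onto en x∈I in
              ∉span (δ j , λ l → trans (reflexive (≡.cong (λ y → v y l) (≡.sym eq))) (combination-δ (v ∘ e) j l))
        in none (x , member en′ i , x∉I
          , (λ y∈ → [ I⊆E , (λ y∈x → J⊆E (≡.subst (_∈ J) (≡.sym (Subsetₚ.x∈⁅y⁆⇒x≡y x y∈x)) (member en′ i))) ]′ (Subsetₚ.x∈p∪q⁻ I ⁅ x ⁆ y∈))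
          , ⇒independentOn (∷-enumeration en x∉I) (λ c h →
              extend-independent (v ∘ e) (v x) (independentOn⇒ en I-ind) ∉span c h)))

-- Generic tangents of a conic

module LabelPairs where

  -- The labels of the two lines through a point; a point on fewer lines
  -- gets labels of its own.
  record Pair : Set where
    constructor _>_by_
    field
      hi lo : ℕ
      lo<hi : lo ℕ.< hi

  open Pair

  infix 4 _∈ₚ_ _≢ₚ_

  _∈ₚ_ : ℕ → Pair → Set
  λ′ ∈ₚ P = λ′ ≡ hi P ⊎ λ′ ≡ lo P

  _≢ₚ_ : Pair → Pair → Set
  P ≢ₚ Q = ¬ (hi P ≡ hi Q × lo P ≡ lo Q)

  NoCommon : Pair → Pair → Pair → Set
  NoCommon P Q R = ∀ {l} → l ∈ₚ P → l ∈ₚ Q → l ∈ₚ R → Data.Empty.⊥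

  other : ∀ {l} P → l ∈ₚ P → ℕ
  other P (inj₁ _) = lo P
  other P (inj₂ _) = hi P

  -- In the mixed cases the larger member of each pair would be the smaller member of the other,
  -- against the ordering inside the pairs.
  common-other⇒≡ : ∀ {l} P Q (l∈P : l ∈ₚ P) (l∈Q : l ∈ₚ Q) → other P l∈P ≡ other Q l∈Q → hi P ≡ hi Q × lo P ≡ lo Q
  common-other⇒≡ P Q (inj₁ ≡.refl) (inj₁ eq) o = eq , o
  common-other⇒≡ P Q (inj₂ ≡.refl) (inj₂ eq) o = o , eq
  common-other⇒≡ P Q (inj₁ ≡.refl) (inj₂ eq) o = ⊥-elim (ℕₚ.<-asym (lo<hi P) (≡.subst₂ ℕ._<_ (≡.sym eq) (≡.sym o) (lo<hi Q)))
  common-other⇒≡ P Q (inj₂ ≡.refl) (inj₁ eq) o = ⊥-elim (ℕₚ.<-asym (lo<hi P) (≡.subst₂ ℕ._<_ (≡.sym o) (≡.sym eq) (lo<hi Q)))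

  is-other : ∀ {l l′} P → l ≢ l′ → (l∈P : l ∈ₚ P) → l′ ∈ₚ P → l′ ≡ other P l∈P
  is-other P l≢l′ (inj₁ ≡.refl) (inj₁ eq) = ⊥-elim (l≢l′ (≡.sym eq))
  is-other P l≢l′ (inj₁ ≡.refl) (inj₂ eq) = eq
  is-other P l≢l′ (inj₂ ≡.refl) (inj₁ eq) = eq
  is-other P l≢l′ (inj₂ ≡.refl) (inj₂ eq) = ⊥-elim (l≢l′ (≡.sym eq))

  two-common⇒≡ : ∀ {l l′} P Q → l ≢ l′ → l ∈ₚ P → l ∈ₚ Q → l′ ∈ₚ P → l′ ∈ₚ Q → hi P ≡ hi Q × lo P ≡ lo Q
  two-common⇒≡ P Q l≢l′ l∈P l∈Q l′∈P l′∈Q = common-other⇒≡ P Q l∈P l∈Q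
    (≡.trans (≡.sym (is-other P l≢l′ l∈P l′∈P)) (is-other Q l≢l′ l∈Q l′∈Q))

module GenericConic (F : ClassicalField) where

  open LinearAlgebra F
  open LabelPairs
  open Pair
  open Solver using (solve; _:=_; _:+_; _:-_; _:*_; :-_)
  open import Relation.Binary.Reasoning.Setoid setoid

  *≈0⇒⊎ : ∀ {x y} → x * y ≈ 0# → x ≈ 0# ⊎ y ≈ 0#
  *≈0⇒⊎ {x} h with em {x ≈ 0#}
  ... | yes x≈0 = inj₁ x≈0
  ... | no x≉0  = inj₂ (*≈0⇒≈0 x≉0 h)

  -- The point of the plane in which the tangents to a fixed conic at
  -- the parameters a and b meet.
  conic : Carrier → Carrier → Vect 3
  conic a b zero             = 1#
  conic a b (suc zero)       = a + b
  conic a b (suc (suc zero)) = a * b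

  cross : Vect 3 → Vect 3 → Vect 3
  cross v w zero             = v (suc zero) * w (suc (suc zero)) - w (suc zero) * v (suc (suc zero))
  cross v w (suc zero)       = v (suc (suc zero)) * w zero - w (suc (suc zero)) * v zero
  cross v w (suc (suc zero)) = v zero * w (suc zero) - w zero * v (suc zero)

  det : (u v w : Vect 3) → Carrier
  det u v w = u · cross v w

  cross-cong : ∀ {v v′ w w′} → v ≋ v′ → w ≋ w′ → cross v w ≋ cross v′ w′
  cross-cong k l zero             = +-cong (*-cong (k _) (l _)) (-‿cong (*-cong (l _) (k _)))
  cross-cong k l (suc zero)       = +-cong (*-cong (k _) (l _)) (-‿cong (*-cong (l _) (k _)))
  cross-cong k l (suc (suc zero)) = +-cong (*-cong (k _) (l _)) (-‿cong (*-cong (l _) (k _)))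

  det-cong : ∀ {u v w u′ v′ w′} → u ≋ u′ → v ≋ v′ → w ≋ w′ → det u v w ≈ det u′ v′ w′
  det-cong h k l = ·-cong h (cross-cong k l)

  ·-expand : ∀ (u v : Vect 3) → u · v ≈
    u zero * v zero + (u (suc zero) * v (suc zero) + u (suc (suc zero)) * v (suc (suc zero)))
  ·-expand u v = +-congˡ (+-congˡ (+-identityʳ _))

  det-swap₁₂ : ∀ u v w → det v u w ≈ 0# → det u v w ≈ 0#
  det-swap₁₂ u v w h = begin
    det u v w    ≈⟨ ·-expand u (cross v w) ⟩
    _            ≈⟨ solve 9 (λ u₀ u₁ u₂ v₀ v₁ v₂ w₀ w₁ w₂ →
      u₀ :* (v₁ :* w₂ :- w₁ :* v₂) :+ (u₁ :* (v₂ :* w₀ :- w₂ :* v₀) :+ u₂ :* (v₀ :* w₁ :- w₀ :* v₁)) :=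
      :- (v₀ :* (u₁ :* w₂ :- w₁ :* u₂) :+ (v₁ :* (u₂ :* w₀ :- w₂ :* u₀) :+ v₂ :* (u₀ :* w₁ :- w₀ :* u₁)))) refl
      (u zero) (u (suc zero)) (u (suc (suc zero))) (v zero) (v (suc zero)) (v (suc (suc zero))) (w zero) (w (suc zero)) (w (suc (suc zero))) ⟩
    _            ≈⟨ -‿cong (·-expand v (cross u w)) ⟨
    - det v u w  ≈⟨ trans (-‿cong h) -0#≈0# ⟩
    0#           ∎

  det-swap₂₃ : ∀ u v w → det u w v ≈ 0# → det u v w ≈ 0#
  det-swap₂₃ u v w h = begin
    det u v w    ≈⟨ ·-cong {v = u} (λ _ → refl) anti ⟩
    u · (λ j → - 1# * cross w v j + 0#) ≈⟨ ·-step u (- 1#) (cross w v) 𝟎 ⟩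
    - 1# * det u w v + u · 𝟎            ≈⟨ +-cong (trans (*-congˡ h) (zeroʳ _)) (sum-zero {f = λ j → u j * 0#} (λ j → zeroʳ (u j))) ⟩
    0# + 0#                             ≈⟨ +-identityˡ 0# ⟩
    0#           ∎
    where
    flip : ∀ a b c d → a * b - c * d ≈ - 1# * (c * d - a * b) + 0#
    flip a b c d = sym (trans (+-identityʳ _) (trans (sym (-‿distribˡ-* 1# _)) (trans (-‿cong (*-identityˡ _))
      (solve 2 (λ x y → :- (y :- x) := x :- y) refl (a * b) (c * d)))))
    anti : cross v w ≋ (λ j → - 1# * cross w v j + 0#)
    anti zero             = flip _ _ _ _
    anti (suc zero)       = flip _ _ _ _
    anti (suc (suc zero)) = flip _ _ _ _

  cross-orthogonal : ∀ v w → v · cross v w ≈ 0# × w · cross v w ≈ 0#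
  cross-orthogonal v w =
      trans (·-expand v (cross v w)) (trans
        -- Constants of the solver denote images of rationals, so the zero on the right is written
        -- as a difference `v₀ - v₀`.
        (solve 6 (λ v₀ v₁ v₂ w₀ w₁ w₂ → v₀ :* (v₁ :* w₂ :- w₁ :* v₂) :+ (v₁ :* (v₂ :* w₀ :- w₂ :* v₀) :+ v₂ :* (v₀ :* w₁ :- w₀ :* v₁)) := v₀ :- v₀) refl
          (v zero) (v (suc zero)) (v (suc (suc zero))) (w zero) (w (suc zero)) (w (suc (suc zero)))) (x-x≈0 _))
    , trans (·-expand w (cross v w)) (trans
        (solve 6 (λ v₀ v₁ v₂ w₀ w₁ w₂ → w₀ :* (v₁ :* w₂ :- w₁ :* v₂) :+ (w₁ :* (v₂ :* w₀ :- w₂ :* v₀) :+ w₂ :* (v₀ :* w₁ :- w₀ :* v₁)) := v₀ :- v₀) refl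
          (v zero) (v (suc zero)) (v (suc (suc zero))) (w zero) (w (suc zero)) (w (suc (suc zero)))) (x-x≈0 _))

  det≉0⇒independent : ∀ (v : Fin 3 → Vect 3) → ¬ det (v zero) (v (suc zero)) (v (suc (suc zero))) ≈ 0# → LinearlyIndependent v
  det≉0⇒independent v d≉0 c h = λ where
      zero             → leading (c 0F) (c 1F) (c 2F) (v 0F) (v 1F) (v 2F) d≉0 eqn
      (suc zero)       → leading (c 1F) (c 0F) (c 2F) (v 1F) (v 0F) (v 2F) (d≉0 ∘ det-swap₁₂ (v 0F) (v 1F) (v 2F))
        (λ j → trans (solve 3 (λ x y z → y :+ (x :+ z) := x :+ (y :+ z)) refl (c 0F * v 0F j) (c 1F * v 1F j) (c 2F * v 2F j)) (eqn j))
      (suc (suc zero)) → leading (c 2F) (c 0F) (c 1F) (v 2F) (v 0F) (v 1F)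
        (d≉0 ∘ det-swap₂₃ (v 0F) (v 1F) (v 2F) ∘ det-swap₁₂ (v 0F) (v 2F) (v 1F))
        (λ j → trans (solve 3 (λ x y z → z :+ (x :+ y) := x :+ (y :+ z)) refl (c 0F * v 0F j) (c 1F * v 1F j) (c 2F * v 2F j)) (eqn j))
    where
    0F 1F 2F : Fin 3
    0F = zero
    1F = suc zero
    2F = suc (suc zero)
    eqn : ∀ j → c 0F * v 0F j + (c 1F * v 1F j + c 2F * v 2F j) ≈ 0#
    eqn j = trans (+-congˡ (+-congˡ (sym (+-identityʳ _)))) (h j)
    -- Cramer's rule: pairing the relation with `cross v w` kills the terms of `v` and `w` and
    -- leaves `a` times the determinant.
    leading : ∀ a b d u v w → ¬ det u v w ≈ 0# → (∀ j → a * u j + (b * v j + d * w j) ≈ 0#) → a ≈ 0#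
    leading a b d u v w det≉0 h = *≈0⇒≈0 det≉0 (begin
      det u v w * a
        ≈⟨ trans (*-comm _ _) (sym (+-identityʳ _)) ⟩
      a * det u v w + 0#
        ≈⟨ +-congˡ (trans (+-cong (trans (*-congˡ (proj₁ (cross-orthogonal v w))) (zeroʳ b)) (trans (*-congˡ (proj₂ (cross-orthogonal v w))) (zeroʳ d))) (+-identityˡ 0#)) ⟨
      a * (u · n) + (b * (v · n) + d * (w · n))
        ≈⟨ +-cong (*-congˡ (·-comm u n)) (+-cong (*-congˡ (·-comm v n)) (*-congˡ (·-comm w n))) ⟩
      a * (n · u) + (b * (n · v) + d * (n · w))
        ≈⟨ +-congˡ (+-congˡ (trans (+-congˡ (sum-zero {f = λ j → n j * 0#} (λ j → zeroʳ (n j)))) (+-identityʳ _))) ⟨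
      a * (n · u) + (b * (n · v) + (d * (n · w) + n · 𝟎))
        ≈⟨ +-congˡ (trans (+-congˡ (sym (·-step n d w 𝟎))) (sym (·-step n b v (λ j → d * w j + 0#)))) ⟩
      a * (n · u) + n · (λ j → b * v j + (d * w j + 0#))
        ≈⟨ ·-step n a u (λ j → b * v j + (d * w j + 0#)) ⟨
      n · (λ j → a * u j + (b * v j + (d * w j + 0#)))
        ≈⟨ sum-zero (λ j → trans (*-congˡ (trans (+-congˡ (+-congˡ (+-identityʳ _))) (h j))) (zeroʳ (n j))) ⟩
      0# ∎)
      where n = cross v w

  conicₚ : (ℕ → Carrier) → Pair → Vect 3
  conicₚ s P = conic (s (hi P)) (s (lo P))

  InjectiveBelow : ℕ → (ℕ → Carrier) → Set
  InjectiveBelow N s = ∀ {i j} → i ℕ.< N → j ℕ.< N → s i ≈ s j → i ≡ j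

  -- Parameters are chosen one at a time, which explains the sorting by `hi`: a new largest label
  -- `N` can only be the `hi` of a pair, and the pairs containing it form an initial segment of P,
  -- Q, R.
  record GenericBelow (N : ℕ) (s : ℕ → Carrier) : Set where
    field
      injective : InjectiveBelow N s
      sorted    : ∀ P Q R → hi P ℕ.< N → hi Q ℕ.≤ hi P → hi R ℕ.≤ hi Q → P ≢ₚ Q → Q ≢ₚ R →
                  NoCommon P Q R → ¬ det (conicₚ s P) (conicₚ s Q) (conicₚ s R) ≈ 0#

  open GenericBelow

  -- As the first point moves along the tangent with parameter `c`, its determinant with `v` and `w`
  -- is a polynomial of degree one in the moving parameter. These are its coefficients when `v` and
  -- `w` have first coordinate 1.
  slope offset : Carrier → Vect 3 → Vect 3 → Carrier
  slope c v w = c * (w (suc zero) - v (suc zero)) - (w (suc (suc zero)) - v (suc (suc zero)))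
  offset c v w = (v (suc zero) * w (suc (suc zero)) - w (suc zero) * v (suc (suc zero)))
    - c * (w (suc (suc zero)) - v (suc (suc zero)))

  det-conic : ∀ t c a b a′ b′ → det (conic t c) (conic a b) (conic a′ b′) ≈
    t * slope c (conic a b) (conic a′ b′) + offset c (conic a b) (conic a′ b′)
  det-conic t c a b a′ b′ = trans (·-expand (conic t c) (cross (conic a b) (conic a′ b′))) (trans
    -- The coordinate `1#` enters as a variable `e`. Every term is linear in it, so it can be pulled
    -- out in front and dropped afterwards.
    (solve 7 (λ e t c a b a′ b′ →
      e :* ((a :+ b) :* (a′ :* b′) :- (a′ :+ b′) :* (a :* b)) :+ ((t :+ c) :* (a :* b :* e :- a′ :* b′ :* e) :+ t :* c :* (e :* (a′ :+ b′) :- e :* (a :+ b))) :=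
      e :* (t :* (c :* (a′ :+ b′ :- (a :+ b)) :- (a′ :* b′ :- a :* b)) :+
        (((a :+ b) :* (a′ :* b′) :- (a′ :+ b′) :* (a :* b)) :- c :* (a′ :* b′ :- a :* b)))) refl 1# t c a b a′ b′)
    (*-identityˡ _))

  det-conic-common : ∀ t c d a b → det (conic t c) (conic t d) (conic a b) ≈ (d - c) * ((t - a) * (t - b))
  det-conic-common t c d a b = trans (det-conic t c t d a b)
    (solve 5 (λ t c d a b →
      t :* (c :* (a :+ b :- (t :+ d)) :- (a :* b :- t :* d)) :+
        (((t :+ d) :* (a :* b) :- (a :+ b) :* (t :* d)) :- c :* (a :* b :- t :* d)) :=
      (d :- c) :* ((t :- a) :* (t :- b))) refl t c d a b)

  offset-identity : ∀ c a b a′ b′ → ((a′ + b′) - (a + b)) * ((c - a) * (c - b)) ≈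
    (c - (a + b)) * slope c (conic a b) (conic a′ b′) - offset c (conic a b) (conic a′ b′)
  offset-identity = solve 5 (λ c a b a′ b′ → ((a′ :+ b′) :- (a :+ b)) :* ((c :- a) :* (c :- b)) :=
    (c :- (a :+ b)) :* (c :* (a′ :+ b′ :- (a :+ b)) :- (a′ :* b′ :- a :* b)) :-
      (((a :+ b) :* (a′ :* b′) :- (a′ :+ b′) :* (a :* b)) :- c :* (a′ :* b′ :- a :* b))) refl

  slope-identity : ∀ x c a b a′ b′ → (x - a′) * (x - b′) ≈
    ((x - a) * (x - b) + (c - x) * ((a′ + b′) - (a + b))) - slope c (conic a b) (conic a′ b′)
  slope-identity = solve 6 (λ x c a b a′ b′ → (x :- a′) :* (x :- b′) :=
    ((x :- a) :* (x :- b) :+ (c :- x) :* ((a′ :+ b′) :- (a :+ b))) :-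
      (c :* (a′ :+ b′ :- (a :+ b)) :- (a′ :* b′ :- a :* b))) refl

  substitute≈0 : ∀ {x} p q r d → x ≈ (p + q * r) - d → p ≈ 0# → r ≈ 0# → d ≈ 0# → x ≈ 0#
  substitute≈0 p q r d x≈ p≈0 r≈0 d≈0 = trans x≈ (trans
    (+-cong (+-cong p≈0 (trans (*-congˡ r≈0) (zeroʳ q))) (-‿cong d≈0))
    (trans (+-congʳ (+-identityˡ 0#)) (x-x≈0 0#)))

  -- Geometrically, if both coefficients vanish, all points of the tangent `c` are dependent with
  -- the two given ones; these then coincide or both lie on this tangent. The alternative appears as
  -- a product: the difference of the sums times (c - a)(c - b) is a combination of `slope` and
  -- `offset`.
  slope-offset≈0 : ∀ c a b a′ b′ → slope c (conic a b) (conic a′ b′) ≈ 0# → offset c (conic a b) (conic a′ b′) ≈ 0# →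
    (a′ + b′) - (a + b) ≈ 0# ⊎ ((c - a) * (c - b) ≈ 0# × (c - a′) * (c - b′) ≈ 0#)
  slope-offset≈0 c a b a′ b′ h k = Data.Sum.map₂
    (λ root → root , trans (slope-identity c c a b a′ b′) (trans
      (+-cong (trans (+-cong root (trans (*-congʳ (x-x≈0 c)) (zeroˡ _))) (+-identityˡ 0#)) (-‿cong h)) (x-x≈0 0#)))
    (*≈0⇒⊎ {(a′ + b′) - (a + b)} {(c - a) * (c - b)}
      (substitute≈0 0# (c - (a + b)) (slope c (conic a b) (conic a′ b′)) (offset c (conic a b) (conic a′ b′))
        (trans (offset-identity c a b a′ b′) (+-congʳ (sym (+-identityˡ _)))) refl h k))

  -- Equal sums and vanishing slope make the products equal too. The monic quadratics with roots a,
  -- b and a′, b′ are then the same, so each root of one is a root of the other.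
  slope-sum≈0 : ∀ x c a b a′ b′ → (x - a) * (x - b) ≈ 0# → slope c (conic a b) (conic a′ b′) ≈ 0# → (a′ + b′) - (a + b) ≈ 0# →
    (x - a′) * (x - b′) ≈ 0#
  slope-sum≈0 x c a b a′ b′ root h k = substitute≈0 ((x - a) * (x - b)) (c - x) ((a′ + b′) - (a + b))
    (slope c (conic a b) (conic a′ b′)) (slope-identity x c a b a′ b′) root k h

  module _ {N s} (good : GenericBelow N s) where

    root⇒∈ₚ : ∀ {l} P → hi P ℕ.< N → l ℕ.< N → (s l - s (hi P)) * (s l - s (lo P)) ≈ 0# → l ∈ₚ P
    root⇒∈ₚ P hi<N l<N h = Data.Sum.map
      (injective good l<N hi<N ∘ -≈0⇒≈) (injective good l<N (ℕₚ.<-trans (lo<hi P) hi<N) ∘ -≈0⇒≈) (*≈0⇒⊎ h)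

    transfer : ∀ l Q R → l ℕ.< N → hi Q ℕ.< N → hi R ℕ.≤ hi Q →
      slope (s l) (conicₚ s Q) (conicₚ s R) ≈ 0# → (s (hi R) + s (lo R)) - (s (hi Q) + s (lo Q)) ≈ 0# →
      ∀ {l′} → l′ ℕ.< N → (s l′ - s (hi Q)) * (s l′ - s (lo Q)) ≈ 0# → l′ ∈ₚ R
    transfer l Q R l<N hiQ<N hiR≤hiQ h sums {l′} l′<N root = root⇒∈ₚ R (ℕₚ.≤-<-trans hiR≤hiQ hiQ<N) l′<N
      (slope-sum≈0 (s l′) (s l) (s (hi Q)) (s (lo Q)) (s (hi R)) (s (lo R)) root h sums)

    slope-offset≉0 : ∀ l Q R → l ℕ.< N → hi Q ℕ.< N → hi R ℕ.≤ hi Q → Q ≢ₚ R → ¬ (l ∈ₚ Q × l ∈ₚ R) →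
      ¬ (slope (s l) (conicₚ s Q) (conicₚ s R) ≈ 0# × offset (s l) (conicₚ s Q) (conicₚ s R) ≈ 0#)
    slope-offset≉0 l Q R l<N hiQ<N hiR≤hiQ Q≢R notBoth (h , k) =
      [ (λ sums → Q≢R (hi≡ sums , lo≡ sums))
      , (λ (rootQ , rootR) → notBoth (root⇒∈ₚ Q hiQ<N l<N rootQ , root⇒∈ₚ R (ℕₚ.≤-<-trans hiR≤hiQ hiQ<N) l<N rootR))
      ]′ (slope-offset≈0 (s l) (s (hi Q)) (s (lo Q)) (s (hi R)) (s (lo R)) h k)
      where
      module _ (sums : (s (hi R) + s (lo R)) - (s (hi Q) + s (lo Q)) ≈ 0#) where
        hi≡ : hi Q ≡ hi R
        hi≡ = [ (λ eq → eq)
              , (λ eq → ⊥-elim (ℕₚ.<-irrefl ≡.refl (ℕₚ.<-≤-trans (lo<hi R) (ℕₚ.≤-trans hiR≤hiQ (ℕₚ.≤-reflexive eq)))))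
              ]′ (transfer l Q R l<N hiQ<N hiR≤hiQ h sums hiQ<N
                   (trans (*-congʳ (x-x≈0 (s (hi Q)))) (zeroˡ (s (hi Q) - s (lo Q)))))
        lo≡ : lo Q ≡ lo R
        lo≡ = [ (λ eq → ⊥-elim (ℕₚ.<-irrefl (≡.trans eq (≡.sym hi≡)) (lo<hi Q)))
              , (λ eq → eq)
              ]′ (transfer l Q R l<N hiQ<N hiR≤hiQ h sums (ℕₚ.<-trans (lo<hi Q) hiQ<N)
                   (trans (*-congˡ (x-x≈0 (s (lo Q)))) (zeroʳ (s (lo Q) - s (hi Q)))))

  eventually-∀< : ∀ {P : ℕ → Carrier → Set} N → (∀ k → k ℕ.< N → Eventually (P k)) → Eventually (λ t → ∀ k → k ℕ.< N → P k t)
  eventually-∀< {P} N h with eventually-∀ {P = λ i → P (Fin.toℕ i)} (λ i → h (Fin.toℕ i) (Finₚ.toℕ<n i))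
  ... | M , g = M , λ k le l l<N → ≡.subst (λ l → P l (fromℕ k)) (Finₚ.toℕ-fromℕ< l<N) (g k le (Fin.fromℕ< l<N))

  update : ℕ → Carrier → (ℕ → Carrier) → ℕ → Carrier
  update N t s k with k ℕ.≟ N
  ... | yes _ = t
  ... | no _  = s k

  update-new : ∀ N t s → update N t s N ≡ t
  update-new N t s with N ℕ.≟ N
  ... | yes _  = ≡.refl
  ... | no N≢N = ⊥-elim (N≢N ≡.refl)

  update-old : ∀ N t s {k} → k ℕ.< N → update N t s k ≡ s k
  update-old N t s {k} k<N with k ℕ.≟ N
  ... | yes ≡.refl = ⊥-elim (ℕₚ.<-irrefl ≡.refl k<N)
  ... | no _       = ≡.refl

  split≤ : ∀ {i N} → i ℕ.≤ N → i ≡ N ⊎ i ℕ.< N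
  split≤ i≤N = Data.Sum.swap (ℕₚ.m≤n⇒m<n∨m≡n i≤N)

  -- The requirements on a new parameter `t`. Each excludes finitely many values: an old parameter,
  -- or the root of a determinant that is a nonzero polynomial of degree at most one in `t`.
  Fresh Regular : ℕ → (ℕ → Carrier) → Carrier → Set
  Fresh N s t = ∀ k → k ℕ.< N → ¬ t ≈ s k
  Regular N s t = ∀ l → l ℕ.< N → ∀ a → a ℕ.< N → ∀ b → b ℕ.< N → ∀ a′ → a′ ℕ.< N → ∀ b′ → b′ ℕ.< N →
    let v = conic (s a) (s b) ; w = conic (s a′) (s b′) in
    ¬ (slope (s l) v w ≈ 0# × offset (s l) v w ≈ 0#) → ¬ t * slope (s l) v w + offset (s l) v w ≈ 0#

  eventually-fresh-regular : ∀ N s → Eventually (λ t → Fresh N s t × Regular N s t)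
  eventually-fresh-regular N s = eventually-×
    (eventually-∀< N (λ k _ → eventually-≉ (s k)))
    (eventually-∀< N λ l _ → eventually-∀< N λ a _ → eventually-∀< N λ b _ → eventually-∀< N λ a′ _ → eventually-∀< N λ b′ _ →
      eventually-⇒ (eventually-linear (slope (s l) (conic (s a) (s b)) (conic (s a′) (s b′)))
                                      (offset (s l) (conic (s a) (s b)) (conic (s a′) (s b′)))))

  module Extension {N s} (good : GenericBelow N s) (t : Carrier) (fresh : Fresh N s t) (regular : Regular N s t) where

    s′ : ℕ → Carrier
    s′ = update N t s

    old : ∀ {k} → k ℕ.< N → s′ k ≡ s k
    old = update-old N t s

    new : s′ N ≡ t
    new = update-new N t s

    conicₚ-new : ∀ P → hi P ≡ N → conic t (s (lo P)) ≋ conicₚ s′ P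
    conicₚ-new P ≡.refl j = reflexive (≡.cong₂ (λ a b → conic a b j) (≡.sym new) (≡.sym (old (lo<hi P))))

    conicₚ-old : ∀ P → hi P ℕ.< N → conicₚ s P ≋ conicₚ s′ P
    conicₚ-old P hi<N j = reflexive (≡.cong₂ (λ a b → conic a b j) (≡.sym (old hi<N)) (≡.sym (old (ℕₚ.<-trans (lo<hi P) hi<N))))

    t≉old : ∀ {k} → k ℕ.< N → ¬ s′ N ≈ s′ k
    t≉old {k} k<N h = fresh k k<N (trans (reflexive (≡.sym new)) (trans h (reflexive (old k<N))))

    injective′ : InjectiveBelow (suc N) s′
    injective′ {i} {j} i≤N j≤N h = [ (λ i≡N → [ (λ j≡N → ≡.trans i≡N (≡.sym j≡N))
          , (λ j<N → ⊥-elim (t≉old j<N (trans (reflexive (≡.cong s′ (≡.sym i≡N))) h))) ]′ (split≤ (ℕ.s≤s⁻¹ j≤N)))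
      , (λ i<N → [ (λ j≡N → ⊥-elim (t≉old i<N (trans (reflexive (≡.cong s′ (≡.sym j≡N))) (sym h))))
          , (λ j<N → injective good i<N j<N (trans (reflexive (≡.sym (old i<N))) (trans h (reflexive (old j<N))))) ]′ (split≤ (ℕ.s≤s⁻¹ j≤N)))
      ]′ (split≤ (ℕ.s≤s⁻¹ i≤N))

    module _ (P Q R : Pair) (Q≤P : hi Q ℕ.≤ hi P) (R≤Q : hi R ℕ.≤ hi Q) (P≢Q : P ≢ₚ Q) (Q≢R : Q ≢ₚ R) (none : NoCommon P Q R)
             (d≈0 : det (conicₚ s′ P) (conicₚ s′ Q) (conicₚ s′ R) ≈ 0#) where

      none-new : hi P ℕ.< N → Data.Empty.⊥
      none-new P<N = sorted good P Q R P<N Q≤P R≤Q P≢Q Q≢R none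
          (trans (det-cong (conicₚ-old P P<N) (conicₚ-old Q Q<N) (conicₚ-old R R<N)) d≈0)
        where
        Q<N = ℕₚ.≤-<-trans Q≤P P<N
        R<N = ℕₚ.≤-<-trans R≤Q Q<N

      -- The determinant is affine in the new parameter. Its coefficients do not both vanish,
      -- because Q and R are different and do not both contain `lo P`, which would be common to all
      -- three pairs.
      one-new : hi P ≡ N → hi Q ℕ.< N → Data.Empty.⊥
      one-new P≡N Q<N = regular (lo P) P<N (hi Q) Q<N (lo Q) (ℕₚ.<-trans (lo<hi Q) Q<N) (hi R) R<N (lo R) (ℕₚ.<-trans (lo<hi R) R<N)
          (slope-offset≉0 good (lo P) Q R P<N Q<N R≤Q Q≢R (λ (l∈Q , l∈R) → none (inj₂ ≡.refl) l∈Q l∈R))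
          (trans (sym (det-conic t (s (lo P)) (s (hi Q)) (s (lo Q)) (s (hi R)) (s (lo R))))
            (trans (det-cong (conicₚ-new P P≡N) (conicₚ-old Q Q<N) (conicₚ-old R R<N)) d≈0))
        where
        P<N = ℕₚ.<-≤-trans (lo<hi P) (ℕₚ.≤-reflexive P≡N)
        R<N = ℕₚ.≤-<-trans R≤Q Q<N

      -- With two points on the new tangent the determinant factors. The factors vanish only if the
      -- two points coincide or the new parameter equals one of R.
      two-new : hi P ≡ N → hi Q ≡ N → hi R ℕ.< N → Data.Empty.⊥
      two-new P≡N Q≡N R<N = *≉0 {s (lo Q) - s (lo P)} {(t - s (hi R)) * (t - s (lo R))} lo≉
          (*≉0 {t - s (hi R)} {t - s (lo R)} (λ h → fresh (hi R) R<N (-≈0⇒≈ h)) (λ h → fresh (lo R) (ℕₚ.<-trans (lo<hi R) R<N) (-≈0⇒≈ h)))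
          (trans (sym (det-conic-common t (s (lo P)) (s (lo Q)) (s (hi R)) (s (lo R))))
            (trans (det-cong (conicₚ-new P P≡N) (conicₚ-new Q Q≡N) (conicₚ-old R R<N)) d≈0))
        where
        lo≉ : ¬ s (lo Q) - s (lo P) ≈ 0#
        lo≉ eq = P≢Q (≡.trans P≡N (≡.sym Q≡N) , ≡.sym (injective good
          (ℕₚ.<-≤-trans (lo<hi Q) (ℕₚ.≤-reflexive Q≡N)) (ℕₚ.<-≤-trans (lo<hi P) (ℕₚ.≤-reflexive P≡N)) (-≈0⇒≈ eq)))

      -- The sorting leaves four cases, according to the number of pairs that contain the new label.
      -- If all three do, it is a common label.
      absurd : hi P ℕ.< suc N → Data.Empty.⊥
      absurd P≤N = [ (λ P≡N → [ (λ Q≡N → [ (λ R≡N → none (inj₁ (≡.sym P≡N)) (inj₁ (≡.sym Q≡N)) (inj₁ (≡.sym R≡N)))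
                                           , two-new P≡N Q≡N ]′ (split≤ (ℕₚ.≤-trans R≤Q (ℕₚ.≤-reflexive Q≡N))))
                              , one-new P≡N ]′ (split≤ (ℕₚ.≤-trans Q≤P (ℕₚ.≤-reflexive P≡N))))
                   , none-new ]′ (split≤ (ℕ.s≤s⁻¹ P≤N))

  extend-generic : ∀ {N s} → GenericBelow N s → ∃ (GenericBelow (suc N))
  extend-generic {N} {s} good = let t , fresh , regular = eventually-witness (eventually-fresh-regular N s) in
    update N t s , record
      { injective = Extension.injective′ good t fresh regular
      ; sorted    = λ P Q R P≤N Q≤P R≤Q P≢Q Q≢R none d≈0 →
          Extension.absurd good t fresh regular P Q R Q≤P R≤Q P≢Q Q≢R none d≈0 P≤N
      }

  generic : ∀ N → ∃ (GenericBelow N)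
  generic zero    = (λ _ → 0#) , record { injective = λ () ; sorted = λ _ _ _ () }
  generic (suc N) = extend-generic (proj₂ (generic N))

  symₚ : ∀ {i j k l : ℕ} → i ≡ j × k ≡ l → j ≡ i × l ≡ k
  symₚ (h , k) = ≡.sym h , ≡.sym k

  module _ {N s} (good : GenericBelow N s) where

    private
      c = conicₚ s

    generic-det : ∀ P Q R → hi P ℕ.< N → hi Q ℕ.< N → hi R ℕ.< N → P ≢ₚ Q → P ≢ₚ R → Q ≢ₚ R →
      NoCommon P Q R → ¬ det (conicₚ s P) (conicₚ s Q) (conicₚ s R) ≈ 0#
    generic-det P Q R P< Q< R< P≢Q P≢R Q≢R none with ℕₚ.≤-total (hi Q) (hi P) | ℕₚ.≤-total (hi R) (hi Q) | ℕₚ.≤-total (hi R) (hi P)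
    ... | inj₁ Q≤P | inj₁ R≤Q | _ = sorted good P Q R P< Q≤P R≤Q P≢Q Q≢R none
    ... | inj₁ Q≤P | inj₂ Q≤R | inj₁ R≤P =
      sorted good P R Q P< R≤P Q≤R P≢R (Q≢R ∘ symₚ) (λ p r q → none p q r) ∘ det-swap₂₃ (c P) (c R) (c Q)
    ... | inj₁ Q≤P | inj₂ Q≤R | inj₂ P≤R =
      sorted good R P Q R< P≤R Q≤P (P≢R ∘ symₚ) P≢Q (λ r p q → none p q r) ∘ det-swap₁₂ (c R) (c P) (c Q) ∘ det-swap₂₃ (c P) (c R) (c Q)
    ... | inj₂ P≤Q | inj₂ Q≤R | _ =
      sorted good R Q P R< Q≤R P≤Q (Q≢R ∘ symₚ) (P≢Q ∘ symₚ) (λ r q p → none p q r) ∘ det-swap₁₂ (c R) (c Q) (c P) ∘ det-swap₂₃ (c Q) (c R) (c P) ∘ det-swap₁₂ (c Q) (c P) (c R)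
    ... | inj₂ P≤Q | inj₁ R≤Q | inj₁ R≤P =
      sorted good Q P R Q< P≤Q R≤P (P≢Q ∘ symₚ) P≢R (λ q p r → none p q r) ∘ det-swap₁₂ (c Q) (c P) (c R)
    ... | inj₂ P≤Q | inj₁ R≤Q | inj₂ P≤R =
      sorted good Q R P Q< R≤Q P≤R Q≢R (P≢R ∘ symₚ) (λ q r p → none p q r) ∘ det-swap₂₃ (c Q) (c R) (c P) ∘ det-swap₁₂ (c Q) (c P) (c R)

-- Matroids of labelled points

module MatroidLines (em : ∀ {P : Set} → Dec P) {n} {E : Subset n} (M : Matroid E) where

  open Enumerations

  line-dependent : ∀ {ℓ p q r} → Line (configuration M) ℓ → Distinct₃ p q r → p ∈ ℓ → q ∈ ℓ → r ∈ ℓ → ¬ Indep M (triple p q r)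
  line-dependent (_ , (_ , ≤2) , _) d p∈ q∈ r∈ ind =
    ℕₚ.<-irrefl ≡.refl (ℕₚ.≤-trans (ℕₚ.≤-reflexive (≡.sym (∣triple∣≡3 d))) (≤2 ind (triple⊆ p∈ q∈ r∈)))

  -- The line is the closure of `p` and `q`. Its rank is two because exchange would otherwise
  -- enlarge the pair by a point of the closure, and it is closed because any further point forms an
  -- independent triple with `p` and `q`.
  dependent-line : Simple M → ∀ {p q r} → Distinct₃ p q r → p ∈ E → q ∈ E → r ∈ E → ¬ Indep M (triple p q r) →
    ∃ λ ℓ → Line (configuration M) ℓ × p ∈ ℓ × q ∈ ℓ × r ∈ ℓ
  dependent-line simple {p} {q} {r} d p∈E q∈E r∈E dep =
    ℓ , ((ℓ⊆E , closed) , (((pair p q , pq-ind , pair⊆ p∈ℓ q∈ℓ , ∣pair∣≡2 p≢q)) , ≤2) , 3≤∣∣ d p∈ℓ q∈ℓ r∈ℓ) , p∈ℓ , q∈ℓ , r∈ℓ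
    where
    open Distinct₃ d
    OnLine : Fin n → Set
    OnLine x = x ∈ E × (x ≡ p ⊎ x ≡ q ⊎ ¬ Indep M (triple p q x))
    ℓ = subset em OnLine
    ⁻ : ∀ {x} → x ∈ ℓ → OnLine x
    ⁻ = ∈subset⁻ em {P = OnLine}
    ⁺ : ∀ {x} → OnLine x → x ∈ ℓ
    ⁺ = ∈subset⁺ em {P = OnLine}
    ℓ⊆E : ℓ ⊆ E
    ℓ⊆E x∈ = proj₁ (⁻ x∈)
    p∈ℓ = ⁺ (p∈E , inj₁ ≡.refl)
    q∈ℓ = ⁺ (q∈E , inj₂ (inj₁ ≡.refl))
    r∈ℓ = ⁺ (r∈E , inj₂ (inj₂ dep))
    pq-ind : Indep M (pair p q)
    pq-ind = simple (pair⊆ p∈E q∈E) (∣pair∣≤2 {p = p} {q = q})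
    ≤2 : ∀ {J} → Indep M J → J ⊆ ℓ → ∣ J ∣ ℕ.≤ 2
    ≤2 {J} J-ind J⊆ℓ with ∣ J ∣ ℕ.≤? 2
    ... | yes le = le
    ... | no ≰2 with exchange M pq-ind J-ind (ℕₚ.≤-trans (ℕₚ.≤-reflexive (≡.cong suc (∣pair∣≡2 p≢q))) (ℕₚ.≰⇒> ≰2))
    ...   | x , x∈J , x∉pq , ind with proj₂ (⁻ (J⊆ℓ x∈J))
    ...     | inj₁ ≡.refl        = ⊥-elim (x∉pq (p∈pair {q = q}))
    ...     | inj₂ (inj₁ ≡.refl) = ⊥-elim (x∉pq (q∈pair {p = p}))
    ...     | inj₂ (inj₂ dep′)   = ⊥-elim (dep′ ind)
    closed : ∀ {x} → x ∈ E → x ∉ ℓ → ∀ {i j} → Rank M ℓ i → Rank M (ℓ ∪ ⁅ x ⁆) j → i ℕ.< j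
    closed {x} x∈E x∉ℓ ((I , I-ind , I⊆ℓ , ≡.refl) , _) (_ , ≤j) = ℕₚ.≤-trans (ℕ.s≤s (≤2 I-ind I⊆ℓ))
      (ℕₚ.≤-trans (ℕₚ.≤-reflexive (≡.sym (∣triple∣≡3 pqx))) (≤j pqx-ind
        (triple⊆ (Subsetₚ.p⊆p∪q ⁅ x ⁆ p∈ℓ) (Subsetₚ.p⊆p∪q ⁅ x ⁆ q∈ℓ) (Subsetₚ.q⊆p∪q ℓ ⁅ x ⁆ (Subsetₚ.x∈⁅x⁆ x)))))
      where
      pqx = distinct p≢q (λ { ≡.refl → x∉ℓ p∈ℓ }) (λ { ≡.refl → x∉ℓ q∈ℓ })
      pqx-ind : Indep M (triple p q x)
      pqx-ind = decidable-stable em (λ dep′ → x∉ℓ (⁺ (x∈E , inj₂ (inj₂ dep′))))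

module Pencils (em : ∀ {P : Set} → Dec P) {n} {E : Subset n} (L : Matroid E) (label : Fin n → LabelPairs.Pair) where

  open Enumerations
  open LabelPairs

  CommonLabel : Fin n → Fin n → Fin n → Set
  CommonLabel p q r = ∃ λ l → l ∈ₚ label p × l ∈ₚ label q × l ∈ₚ label r

  record LabelsLines : Set where
    field
      simple-labels    : ∀ {p q} → p ∈ E → q ∈ E → p ≢ q → label p ≢ₚ label q
      dependent⇒common : ∀ {p q r} → Distinct₃ p q r → p ∈ E → q ∈ E → r ∈ E → ¬ Indep L (triple p q r) → CommonLabel p q r
      common⇒dependent : ∀ {p q r} → Distinct₃ p q r → p ∈ E → q ∈ E → r ∈ E → CommonLabel p q r → ¬ Indep L (triple p q r)

  module _ (labels : LabelsLines) where
    open LabelsLines labels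

    pencil-≤2 : ∀ {J l} → (∀ {x} → x ∈ J → l ∈ₚ label x) → Indep L J → ∣ J ∣ ℕ.≤ 2
    pencil-≤2 {J} l∈ J-ind = decidable-stable (∣ J ∣ ℕ.≤? 2) λ ≰2 →
      let p , q , r , d , p∈ , q∈ , r∈ = three (ℕₚ.≰⇒> ≰2)
          J⊆E = indep⊆E L J-ind
      in common⇒dependent d (J⊆E p∈) (J⊆E q∈) (J⊆E r∈) (_ , l∈ p∈ , l∈ q∈ , l∈ r∈) (hereditary L (triple⊆ p∈ q∈ r∈) J-ind)

    -- Two points of the line share only one label, since different points carry different pairs;
    -- every third point must therefore share that same label. Conversely, a point with this label
    -- could be added without raising the rank, so flatness puts it on the line.
    line-label : ∀ {ℓ p} → Line (configuration L) ℓ → p ∈ ℓ →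
      ∃ λ l → l ∈ₚ label p × (∀ {x} → x ∈ ℓ → l ∈ₚ label x) × (∀ {x} → x ∈ E → l ∈ₚ label x → x ∈ ℓ)
    line-label {ℓ} {p} line@((ℓ⊆E , flat) , rank-two@((I , I-ind , I⊆ℓ , ∣I∣≡2) , _) , 3≤) p∈ =
      choose₁ (third 3≤ p p)
      where
      open MatroidLines em L using (line-dependent)
      module _ (q : Fin n) (q∈ : q ∈ ℓ) (p≢q : p ≢ q) where
        common : ∀ {x} → x ∈ ℓ → p ≢ x → q ≢ x → CommonLabel p q x
        common x∈ p≢x q≢x = let d = distinct p≢q p≢x q≢x in
          dependent⇒common d (ℓ⊆E p∈) (ℓ⊆E q∈) (ℓ⊆E x∈) (line-dependent line d p∈ q∈ x∈)
        module _ (l : ℕ) (l∈p : l ∈ₚ label p) (l∈q : l ∈ₚ label q) where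
          same : ∀ {x} → CommonLabel p q x → l ∈ₚ label x
          same {x} (l′ , l′∈p , l′∈q , l′∈x) with l ℕ.≟ l′
          ... | yes ≡.refl = l′∈x
          ... | no l≢l′ = ⊥-elim (simple-labels (ℓ⊆E p∈) (ℓ⊆E q∈) p≢q (two-common⇒≡ (label p) (label q) l≢l′ l∈p l∈q l′∈p l′∈q))
          has-label : ∀ {x} → x ∈ ℓ → l ∈ₚ label x
          has-label {x} x∈ with p Finₚ.≟ x | q Finₚ.≟ x
          ... | yes ≡.refl | _          = l∈p
          ... | no _       | yes ≡.refl = l∈q
          ... | no p≢x     | no q≢x     = same (common x∈ p≢x q≢x)
          result : ∃ λ l → l ∈ₚ label p × (∀ {x} → x ∈ ℓ → l ∈ₚ label x) × (∀ {x} → x ∈ E → l ∈ₚ label x → x ∈ ℓ)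
          result = l , l∈p , has-label , λ {x} x∈E l∈x → decidable-stable (x Subsetₚ.∈? ℓ) λ x∉ℓ →
            ℕₚ.<-irrefl ≡.refl (flat x∈E x∉ℓ rank-two
              ( (I , I-ind , (λ y∈ → Subsetₚ.p⊆p∪q ⁅ x ⁆ (I⊆ℓ y∈)) , ∣I∣≡2)
              , λ J-ind J⊆ → pencil-≤2 (λ y∈ → [ has-label , (λ y∈x → ≡.subst (λ y → l ∈ₚ label y) (≡.sym (Subsetₚ.x∈⁅y⁆⇒x≡y x y∈x)) l∈x) ]′
                  (Subsetₚ.x∈p∪q⁻ ℓ ⁅ x ⁆ (J⊆ y∈))) J-ind))
      choose₁ : (∃ λ q → q ∈ ℓ × q ≢ p × q ≢ p) → _
      choose₁ (q , q∈ , q≢p , _) = choose₂ (third 3≤ p q)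
        where
        choose₂ : (∃ λ r → r ∈ ℓ × r ≢ p × r ≢ q) → _
        choose₂ (r , r∈ , r≢p , r≢q) =
          let l , l∈p , l∈q , _ = common q q∈ (q≢p ∘ ≡.sym) r∈ (r≢p ∘ ≡.sym) (r≢q ∘ ≡.sym) in
          result q q∈ (q≢p ∘ ≡.sym) l l∈p l∈q

    pencil-noTriplets : AtMostTwoLinesPerPoint (configuration L)
    pencil-noTriplets {p} {ℓ₁} {ℓ₂} {ℓ₃} line₁ line₂ line₃ ℓ₁≢ℓ₂ ℓ₁≢ℓ₃ ℓ₂≢ℓ₃ (p∈₁ , p∈₂ , p∈₃)
      = go (line-label line₁ p∈₁) (line-label line₂ p∈₂) (line-label line₃ p∈₃)
      where
      LabelOf : Subset n → Set
      LabelOf ℓ = ∃ λ l → l ∈ₚ label p × (∀ {x} → x ∈ ℓ → l ∈ₚ label x) × (∀ {x} → x ∈ E → l ∈ₚ label x → x ∈ ℓ)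
      go : LabelOf ℓ₁ → LabelOf ℓ₂ → LabelOf ℓ₃ → Data.Empty.⊥
      go (l₁ , l₁∈p , to₁ , from₁) (l₂ , l₂∈p , to₂ , from₂) (l₃ , l₃∈p , to₃ , from₃) = pigeonhole l₁∈p l₂∈p l₃∈p
       where
       same : ∀ {ℓ ℓ′ l l′} → Line (configuration L) ℓ → Line (configuration L) ℓ′ →
         (∀ {x} → x ∈ ℓ → l ∈ₚ label x) → (∀ {x} → x ∈ E → l ∈ₚ label x → x ∈ ℓ) →
         (∀ {x} → x ∈ ℓ′ → l′ ∈ₚ label x) → (∀ {x} → x ∈ E → l′ ∈ₚ label x → x ∈ ℓ′) → l ≡ l′ → ℓ ≡ ℓ′
       same line line′ to from to′ from′ ≡.refl = Subsetₚ.⊆-antisym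
         (λ x∈ → from′ (proj₁ (proj₁ line) x∈) (to x∈)) (λ x∈ → from (proj₁ (proj₁ line′) x∈) (to′ x∈))
       ₁₂ = λ eq → ℓ₁≢ℓ₂ (same line₁ line₂ to₁ from₁ to₂ from₂ eq)
       ₁₃ = λ eq → ℓ₁≢ℓ₃ (same line₁ line₃ to₁ from₁ to₃ from₃ eq)
       ₂₃ = λ eq → ℓ₂≢ℓ₃ (same line₂ line₃ to₂ from₂ to₃ from₃ eq)
       pigeonhole : l₁ ∈ₚ label p → l₂ ∈ₚ label p → l₃ ∈ₚ label p → Data.Empty.⊥
       pigeonhole (inj₁ a) (inj₁ b) _        = ₁₂ (≡.trans a (≡.sym b))
       pigeonhole (inj₂ a) (inj₂ b) _        = ₁₂ (≡.trans a (≡.sym b))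
       pigeonhole (inj₁ a) (inj₂ b) (inj₁ c) = ₁₃ (≡.trans a (≡.sym c))
       pigeonhole (inj₁ a) (inj₂ b) (inj₂ c) = ₂₃ (≡.trans b (≡.sym c))
       pigeonhole (inj₂ a) (inj₁ b) (inj₁ c) = ₂₃ (≡.trans b (≡.sym c))
       pigeonhole (inj₂ a) (inj₁ b) (inj₂ c) = ₁₃ (≡.trans a (≡.sym c))

    -- Only sets of size three have to be compared: smaller ones are independent in `M` by
    -- simplicity, and larger ones exceed the rank of `L`.
    ≼-by-lines : ∀ {M : Matroid E} → Simple M → (∀ {J} → Indep L J → ∣ J ∣ ℕ.≤ 3) →
      (∀ {p q r} → Distinct₃ p q r → p ∈ E → q ∈ E → r ∈ E → ¬ Indep M (triple p q r) → CommonLabel p q r) → M ≼ L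
    ≼-by-lines {M} simple ≤3 common {D} (D⊆E , dep) = D⊆E , λ D-ind → dep (simple D⊆E
      (ℕ.s≤s⁻¹ (ℕₚ.≤∧≢⇒< (≤3 D-ind) λ ∣D∣≡3 →
        let p , q , r , d , D≡ = ∣∣≡3⇒triple ∣D∣≡3
            ∈E = λ {x} (x∈ : x ∈ triple p q r) → D⊆E (≡.subst (x ∈_) (≡.sym D≡) x∈)
            p∈ = ∈E (p∈triple {q = q} {r = r})
            q∈ = ∈E (q∈triple {p = p} {r = r})
            r∈ = ∈E (r∈triple {p = p} {q = q})
        in common⇒dependent d p∈ q∈ r∈ (common d p∈ q∈ r∈ (≡.subst (λ D → ¬ Indep M D) D≡ dep)) (≡.subst (Indep L) D≡ D-ind))))

module LabelledMatroid (F : ClassicalField) {n} (E : Subset n) where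

  open LinearAlgebra F
  open GenericConic F
  open LabelPairs
  open VectorMatroid F
  open Enumerations
  open Pair
  open GenericBelow
  open Solver using (solve; _:=_; _:+_; _:-_; _:*_; :-_)

  label-bound : ∀ {m} (f : Fin m → Pair) → ∃ λ N → ∀ p → hi (f p) ℕ.< N
  label-bound {zero}  f = 0 , λ ()
  label-bound {suc m} f = let N , h = label-bound (f ∘ suc) in suc (hi (f zero)) ℕ.⊔ N
    , λ { zero → ℕₚ.m≤m⊔n _ N ; (suc p) → ℕₚ.≤-trans (h p) (ℕₚ.m≤n⊔m (suc (hi (f zero))) N) }

  module _ (label : Fin n → Pair)
           (simple-labels : ∀ {p q} → p ∈ E → q ∈ E → p ≢ q → label p ≢ₚ label q)
           {N parameters} (bound : ∀ p → hi (label p) ℕ.< N) (good : GenericBelow (2 ℕ.+ N) parameters) where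

    label< : ∀ p → hi (label p) ℕ.< 2 ℕ.+ N
    label< p = ℕₚ.≤-trans (bound p) (ℕₚ.m≤n+m N 2)

    vector : Fin n → Vect 3
    vector p = conicₚ parameters (label p)

    -- The parameters are generic for two labels more than the points use. The two spare labels name
    -- a point on none of the tangents in use, and it completes any two points to a triple with
    -- nonzero determinant; this is how pairs are seen to be independent.
    fresh : Pair
    fresh = suc N > N by ℕₚ.n<1+n N

    fresh∉ : ∀ {l} p → l ∈ₚ fresh → ¬ l ∈ₚ label p
    fresh∉ {l} p l∈f l∈p = ℕₚ.<⇒≱ (l< l∈p) (N≤ l∈f)
      where
      N≤ : l ∈ₚ fresh → N ℕ.≤ l
      N≤ (inj₁ ≡.refl) = ℕₚ.n≤1+n N
      N≤ (inj₂ ≡.refl) = ℕₚ.≤-refl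
      l< : l ∈ₚ label p → l ℕ.< N
      l< (inj₁ ≡.refl) = bound p
      l< (inj₂ ≡.refl) = ℕₚ.<-trans (lo<hi (label p)) (bound p)

    triple-independent : ∀ {p q r} → Distinct₃ p q r → p ∈ E → q ∈ E → r ∈ E → NoCommon (label p) (label q) (label r) →
      LinearlyIndependentOn (triple p q r) vector
    triple-independent {p} {q} {r} d p∈ q∈ r∈ none = ⇒independentOn (enumerate-triple d)
      (det≉0⇒independent (vector ∘ (r ∷ q ∷ λ _ → p))
        (generic-det good (label r) (label q) (label p) (label< r) (label< q) (label< p)
          (simple-labels r∈ q∈ (q≢r ∘ ≡.sym)) (simple-labels r∈ p∈ (p≢r ∘ ≡.sym)) (simple-labels q∈ p∈ (p≢q ∘ ≡.sym))
          (λ l∈r l∈q l∈p → none l∈p l∈q l∈r)))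
      where open Distinct₃ d

    pair-independent : ∀ (e : Fin 2 → Fin n) → (∀ i → e i ∈ E) → e zero ≢ e (suc zero) → LinearlyIndependent (vector ∘ e)
    pair-independent e e∈ e₀≢e₁ c h i = det≉0⇒independent vs d≉0 (0# ∷ c)
        (λ j → trans (+-congʳ (zeroˡ (vs zero j))) (trans (+-identityˡ _) (h j))) (suc i)
      where
      vs : Fin 3 → Vect 3
      vs = conicₚ parameters fresh ∷ (vector ∘ e)
      P Q : Pair
      P = label (e zero)
      Q = label (e (suc zero))
      d≉0 : ¬ det (vs zero) (vs (suc zero)) (vs (suc (suc zero))) ≈ 0#
      d≉0 = generic-det good fresh P Q ℕₚ.≤-refl (label< (e zero)) (label< (e (suc zero)))
        (λ (eq , _) → fresh∉ (e zero) (inj₁ ≡.refl) (inj₁ eq))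
        (λ (eq , _) → fresh∉ (e (suc zero)) (inj₁ ≡.refl) (inj₁ eq))
        (simple-labels (e∈ zero) (e∈ (suc zero)) e₀≢e₁)
        (λ l∈f l∈P _ → fresh∉ (e zero) l∈f l∈P)

    conic-other : ∀ {l} P (l∈P : l ∈ₚ P) → conicₚ parameters P ≋ conic (parameters l) (parameters (other P l∈P))
    conic-other P (inj₁ ≡.refl) i                = refl
    conic-other P (inj₂ ≡.refl) zero             = refl
    conic-other P (inj₂ ≡.refl) (suc zero)       = +-comm _ _
    conic-other P (inj₂ ≡.refl) (suc (suc zero)) = *-comm _ _

    -- Along a tangent, `conic s` is affine in its second argument. Any three values of an affine
    -- function satisfy the relation with coefficients b - c, c - a, a - b.
    pencil-relation : ∀ s a b c i → (b - c) * conic s a i + ((c - a) * conic s b i + ((a - b) * conic s c i + 0#)) ≈ 0#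
    pencil-relation s a b c zero = trans (+-congˡ (+-congˡ (+-identityʳ _))) (trans
      (solve 4 (λ e a b c → (b :- c) :* e :+ ((c :- a) :* e :+ (a :- b) :* e) := a :- a) refl 1# a b c) (x-x≈0 a))
    pencil-relation s a b c (suc zero) = trans (+-congˡ (+-congˡ (+-identityʳ _))) (trans
      (solve 4 (λ s a b c → (b :- c) :* (s :+ a) :+ ((c :- a) :* (s :+ b) :+ (a :- b) :* (s :+ c)) := a :- a) refl s a b c) (x-x≈0 a))
    pencil-relation s a b c (suc (suc zero)) = trans (+-congˡ (+-congˡ (+-identityʳ _))) (trans
      (solve 4 (λ s a b c → (b :- c) :* (s :* a) :+ ((c :- a) :* (s :* b) :+ (a :- b) :* (s :* c)) := a :- a) refl s a b c) (x-x≈0 a))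

    triple-dependent : ∀ {p q r l} → Distinct₃ p q r → p ∈ E → q ∈ E → r ∈ E →
      l ∈ₚ label p → l ∈ₚ label q → l ∈ₚ label r → ¬ LinearlyIndependentOn (triple p q r) vector
    triple-dependent {p} {q} {r} {l} d p∈ q∈ r∈ l∈p l∈q l∈r ind =
      -- Independence would force the coefficient b - c of the relation to vanish, so `q` and `p`
      -- would share their second label too and carry the same pair.
      simple-labels q∈ p∈ (p≢q ∘ ≡.sym) (common-other⇒≡ (label q) (label p) l∈q l∈p (injective good
        (other< q l∈q) (other< p l∈p) (-≈0⇒≈ (independentOn⇒ (enumerate-triple d) ind coefficients relation zero))))
      where
      open Distinct₃ d
      other< : ∀ p (l∈p : l ∈ₚ label p) → other (label p) l∈p ℕ.< 2 ℕ.+ N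
      other< p (inj₁ _) = ℕₚ.<-trans (lo<hi (label p)) (label< p)
      other< p (inj₂ _) = label< p
      a b c : Carrier
      a = parameters (other (label r) l∈r)
      b = parameters (other (label q) l∈q)
      c = parameters (other (label p) l∈p)
      coefficients : Vect 3
      coefficients = (b - c) ∷ (c - a) ∷ λ _ → a - b
      relation : combination coefficients (vector ∘ (r ∷ q ∷ λ _ → p)) ≋ 𝟎
      relation j = trans (+-cong (*-congˡ (conic-other (label r) l∈r j)) (+-cong (*-congˡ (conic-other (label q) l∈q j))
        (+-congʳ (*-congˡ (conic-other (label p) l∈p j))))) (pencil-relation (parameters l) a b c j)

    labelledMatroid : Matroid E
    labelledMatroid = vectorMatroid E vector

    private
      L = labelledMatroid

    labelled-simple : Simple L
    labelled-simple {A} A⊆E ∣A∣≤2 = A⊆E , ⇒independentOn en (by-size ∣A∣≤2 e (A⊆E ∘ member en) (injective′ en))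
      where
      e = proj₁ (enumerate A)
      en = proj₂ (enumerate A)
      injective′ : ∀ {k} {e : Fin k → Fin n} → Enumeration e A → ∀ {i j} → e i ≡ e j → i ≡ j
      injective′ en = Enumeration.injective en
      by-size : ∀ {k} → k ℕ.≤ 2 → (e : Fin k → Fin n) → (∀ i → e i ∈ E) → (∀ {i j} → e i ≡ e j → i ≡ j) →
        LinearlyIndependent (vector ∘ e)
      by-size {zero} _ e e∈ e-inj c h ()
      by-size {suc zero} _ e e∈ e-inj c h zero = trans (sym (trans (+-identityʳ _) (*-identityʳ (c zero)))) (h zero)
      by-size {suc (suc zero)} _ e e∈ e-inj = pair-independent e e∈ (λ eq → contradiction (e-inj eq) λ ())
      by-size {suc (suc (suc k))} (ℕ.s≤s (ℕ.s≤s ()))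

    labelled-≤3 : ∀ {J} → Indep L J → ∣ J ∣ ℕ.≤ 3
    labelled-≤3 {J} (_ , ind) = independent⇒≤ (vector ∘ proj₁ (enumerate J)) (independentOn⇒ (proj₂ (enumerate J)) ind)

    labelled-lines : Pencils.LabelsLines em L label
    labelled-lines = record
      { simple-labels    = simple-labels
      ; dependent⇒common = λ d p∈ q∈ r∈ dep → decidable-stable em λ none →
          dep (triple⊆ p∈ q∈ r∈ , triple-independent d p∈ q∈ r∈ (λ l∈p l∈q l∈r → none (_ , l∈p , l∈q , l∈r)))
      ; common⇒dependent = λ d p∈ q∈ r∈ (l , l∈p , l∈q , l∈r) (_ , ind) → triple-dependent d p∈ q∈ r∈ l∈p l∈q l∈r ind
      }

    labelled-admissible : ∀ {p q r} → Distinct₃ p q r → p ∈ E → q ∈ E → r ∈ E → NoCommon (label p) (label q) (label r) → Admissible L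
    labelled-admissible {p} {q} {r} d p∈ q∈ r∈ none = record
      { simple     = labelled-simple
      ; rank-three = (triple p q r , (triple⊆ p∈ q∈ r∈ , triple-independent d p∈ q∈ r∈ none) , triple⊆ p∈ q∈ r∈ , ∣triple∣≡3 d)
                   , λ J-ind _ → labelled-≤3 J-ind
      ; realisable = vector , λ {I} I⊆E → mk⇔ proj₂ (λ ind → (λ {x} → I⊆E {x}) , ind)
      ; noTriplets = Pencils.pencil-noTriplets em L label labelled-lines
      }

  -- A labelling that identifies more labels than the lines of M do
  -- yields an admissible matroid strictly above M.
  maximal⇒dependent : ∀ {M : Matroid E} → Maximal M → (label : Fin n → Pair) →
    (∀ {p q} → p ∈ E → q ∈ E → p ≢ q → label p ≢ₚ label q) →
    (∀ {p q r} → Distinct₃ p q r → p ∈ E → q ∈ E → r ∈ E → ¬ Indep M (triple p q r) →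
      ∃ λ l → l ∈ₚ label p × l ∈ₚ label q × l ∈ₚ label r) →
    ∀ {p q r} → Distinct₃ p q r → p ∈ E → q ∈ E → r ∈ E → NoCommon (label p) (label q) (label r) →
    ∀ {p q r l} → Distinct₃ p q r → p ∈ E → q ∈ E → r ∈ E → l ∈ₚ label p → l ∈ₚ label q → l ∈ₚ label r → ¬ Indep M (triple p q r)
  maximal⇒dependent {M} (admissible , maximal) label simple-labels common d₀ p₀∈ q₀∈ r₀∈ none d p∈ q∈ r∈ l∈p l∈q l∈r =
    go (generic (2 ℕ.+ N))
    where
    N = proj₁ (label-bound label)
    bound = proj₂ (label-bound label)
    go : ∃ (GenericBelow (2 ℕ.+ N)) → ¬ Indep M (triple _ _ _)
    go (_ , good) = proj₂ (maximal L (labelled-admissible label simple-labels bound good d₀ p₀∈ q₀∈ r₀∈ none)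
        (Pencils.≼-by-lines em L label lines {M} (Admissible.simple admissible) (labelled-≤3 label simple-labels bound good) common)
        (triple⊆ p∈ q∈ r∈ , Pencils.LabelsLines.common⇒dependent lines d p∈ q∈ r∈ (_ , l∈p , l∈q , l∈r)))
      where
      L = labelledMatroid label simple-labels bound good
      lines = labelled-lines label simple-labels bound good

-- Consequences of maximality

module SubsetCodes where

  double : ℕ → ℕ
  double n = n ℕ.+ n

  double-injective : ∀ m n → double m ≡ double n → m ≡ n
  double-injective zero    zero    _  = ≡.refl
  double-injective (suc m) (suc n) eq = ≡.cong suc (double-injective m n (ℕₚ.suc-injective
    (≡.trans (≡.sym (ℕₚ.+-suc m m)) (≡.trans (ℕₚ.suc-injective eq) (ℕₚ.+-suc n n)))))

  even≢odd : ∀ m n → double m ≢ suc (double n)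
  even≢odd (suc m) zero    eq = contradiction (≡.trans (≡.sym (ℕₚ.+-suc m m)) (ℕₚ.suc-injective eq)) λ ()
  even≢odd (suc m) (suc n) eq = even≢odd m n (ℕₚ.suc-injective
    (≡.trans (≡.sym (ℕₚ.+-suc m m)) (≡.trans (ℕₚ.suc-injective eq) (≡.cong suc (ℕₚ.+-suc n n)))))

  -- Lines serve as labels, and the labels of a pair have to be ordered. A subset is therefore read
  -- as a binary number, which lies below `codes n`, that is, below the n-th power of 2.
  code : ∀ {n} → Subset n → ℕ
  code Vec.[]              = 0
  code (outside Vec.∷ s) = double (code s)
  code (inside Vec.∷ s)  = suc (double (code s))

  code-injective : ∀ {n} (s t : Subset n) → code s ≡ code t → s ≡ t
  code-injective Vec.[] Vec.[] _ = ≡.refl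
  code-injective (outside Vec.∷ s) (outside Vec.∷ t) eq = ≡.cong (outside Vec.∷_) (code-injective s t (double-injective _ _ eq))
  code-injective (inside Vec.∷ s)  (inside Vec.∷ t)  eq = ≡.cong (inside Vec.∷_) (code-injective s t (double-injective _ _ (ℕₚ.suc-injective eq)))
  code-injective (outside Vec.∷ s) (inside Vec.∷ t)  eq = ⊥-elim (even≢odd (code s) (code t) eq)
  code-injective (inside Vec.∷ s)  (outside Vec.∷ t) eq = ⊥-elim (even≢odd (code t) (code s) (≡.sym eq))

  codes : ℕ → ℕ
  codes zero    = 1
  codes (suc n) = double (codes n)

  code< : ∀ {n} (s : Subset n) → code s ℕ.< codes n
  code< Vec.[]              = ℕ.s≤s ℕ.z≤n
  code< (outside Vec.∷ s) = ℕₚ.+-mono-< (code< s) (code< s)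
  code< {suc n} (inside Vec.∷ s)  = ≡.subst (ℕ._≤ double (codes n)) (≡.cong suc (ℕₚ.+-suc (code s) (code s))) (ℕₚ.+-mono-≤ (code< s) (code< s))

module CompleteLabels (em : ∀ {P : Set} → Dec P) where

  open LabelPairs
  open Pair

  -- At most two labels satisfy `H`. Missing ones are supplied by `f` and its successor, which
  -- exceed all labels of `H` and so keep the pair ordered.
  complete : ∀ (H : ℕ → Set) → (∀ {a b c} → H a → H b → H c → a ≡ b ⊎ a ≡ c ⊎ b ≡ c) → ∀ f → (∀ {l} → H l → l ℕ.< f) →
    ∃ λ P → (∀ {l} → H l → l ∈ₚ P) × (∀ {l} → l ∈ₚ P → H l ⊎ l ≡ f ⊎ l ≡ suc f)
  complete H two f H<f with em {∃ H}
  ... | no none = suc f > f by ℕₚ.n<1+n f , (λ h → ⊥-elim (none (_ , h))) , λ { (inj₁ eq) → inj₂ (inj₂ eq) ; (inj₂ eq) → inj₂ (inj₁ eq) }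
  ... | yes (a , Ha) with em {∃ λ b → H b × a ≢ b}
  ...   | no none = f > a by H<f Ha
        , (λ {l} h → inj₂ (≡.sym (decidable-stable (a ℕ.≟ l) λ a≢l → none (l , h , a≢l))))
        , λ { (inj₁ eq) → inj₂ (inj₁ eq) ; (inj₂ ≡.refl) → inj₁ Ha }
  ...   | yes (b , Hb , a≢b) with ℕₚ.<-cmp a b
  ...     | tri≈ _ a≡b _ = ⊥-elim (a≢b a≡b)
  ...     | tri< a<b _ _ = b > a by a<b
          , (λ h → [ (λ a≡b → ⊥-elim (a≢b a≡b)) , [ (λ a≡l → inj₂ (≡.sym a≡l)) , (λ b≡l → inj₁ (≡.sym b≡l)) ]′ ]′ (two Ha Hb h))
          , λ { (inj₁ ≡.refl) → inj₁ Hb ; (inj₂ ≡.refl) → inj₁ Ha }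
  ...     | tri> _ _ b<a = a > b by b<a
          , (λ h → [ (λ a≡b → ⊥-elim (a≢b a≡b)) , [ (λ a≡l → inj₁ (≡.sym a≡l)) , (λ b≡l → inj₂ (≡.sym b≡l)) ]′ ]′ (two Ha Hb h))
          , λ { (inj₁ ≡.refl) → inj₁ Ha ; (inj₂ ≡.refl) → inj₁ Hb }

module MaximalComponent (F : ClassicalField) {n} (C : Configuration (⊤ {n})) (C-linear : Linear C) (K : Subset n) (M : Matroid K)
  (M-maximal : Geometry.Maximal (LinearAlgebra.rawRing F) M) (K≐M : subconfiguration C K ≐ configuration M) where

  open ClassicalField F using (em)
  open Enumerations
  open LabelPairs
  open Pair
  open SubsetCodes
  open MatroidLines em M

  KLine : Subset n → Set
  KLine = Line (subconfiguration C K)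

  Collinear : Fin n → Fin n → Fin n → Set
  Collinear p q r = ∃ λ ℓ → KLine ℓ × p ∈ ℓ × q ∈ ℓ × r ∈ ℓ

  private
    admissible = proj₁ M-maximal
    module A = Geometry.Admissible admissible

  KLine⇒3≤ : ∀ {ℓ} → KLine ℓ → 3 ℕ.≤ ∣ ℓ ∣
  KLine⇒3≤ {ℓ} line = proj₂ (proj₂ (Equivalence.to (K≐M ℓ) line))

  collinear⇒dependent : ∀ {p q r} → Distinct₃ p q r → Collinear p q r → ¬ Indep M (triple p q r)
  collinear⇒dependent d (ℓ , line , p∈ , q∈ , r∈) = line-dependent (Equivalence.to (K≐M ℓ) line) d p∈ q∈ r∈

  dependent⇒collinear : ∀ {p q r} → Distinct₃ p q r → p ∈ K → q ∈ K → r ∈ K → ¬ Indep M (triple p q r) → Collinear p q r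
  dependent⇒collinear d p∈ q∈ r∈ dep = let ℓ , line , ∈s = dependent-line A.simple d p∈ q∈ r∈ dep in
    ℓ , Equivalence.from (K≐M ℓ) line , ∈s

  unique : ∀ {p q ℓ ℓ′} → p ≢ q → KLine ℓ → KLine ℓ′ → p ∈ ℓ → q ∈ ℓ → p ∈ ℓ′ → q ∈ ℓ′ → ℓ ≡ ℓ′
  unique p≢q (line , _) (line′ , _) = Linear.unique-line C-linear p≢q line line′

  atMostTwo : ∀ {p ℓ₁ ℓ₂ ℓ₃} → KLine ℓ₁ → KLine ℓ₂ → KLine ℓ₃ → p ∈ ℓ₁ → p ∈ ℓ₂ → p ∈ ℓ₃ → ℓ₁ ≡ ℓ₂ ⊎ ℓ₁ ≡ ℓ₃ ⊎ ℓ₂ ≡ ℓ₃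
  atMostTwo {p} {ℓ₁} {ℓ₂} {ℓ₃} l₁ l₂ l₃ p∈₁ p∈₂ p∈₃ = decidable-stable em λ none → A.noTriplets
    (Equivalence.to (K≐M ℓ₁) l₁) (Equivalence.to (K≐M ℓ₂) l₂) (Equivalence.to (K≐M ℓ₃) l₃)
    (none ∘ inj₁) (none ∘ inj₂ ∘ inj₁) (none ∘ inj₂ ∘ inj₂) (p∈₁ , p∈₂ , p∈₃)

  noncollinear-triple : ∃ λ p → ∃ λ q → ∃ λ r → Distinct₃ p q r × p ∈ K × q ∈ K × r ∈ K × ¬ Collinear p q r
  noncollinear-triple = go (proj₁ A.rank-three)
    where
    go : (∃ λ I → Indep M I × I ⊆ K × ∣ I ∣ ≡ 3) → _
    go (I , I-ind , I⊆K , ∣I∣≡3) = go′ (∣∣≡3⇒triple ∣I∣≡3)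
      where
      go′ : (∃ λ p → ∃ λ q → ∃ λ r → Distinct₃ p q r × I ≡ triple p q r) → _
      go′ (p , q , r , d , ≡.refl) = p , q , r , d , I⊆K (p∈triple {q = q} {r}) , I⊆K (q∈triple {p = p} {r = r}) , I⊆K (r∈triple {p = p} {q})
        , λ col → collinear⇒dependent d col I-ind

  -- A redistribution of the points over abstract lines that keeps every line of the component
  -- within one of them. The subset `a` in `On p a` is merely a name: it need not be the set of
  -- points on the abstract line.
  record LineSystem (On : Fin n → Subset n → Set) : Set where
    field
      two-labels : ∀ {p a b c} → On p a → On p b → On p c → a ≡ b ⊎ a ≡ c ⊎ b ≡ c
      one-common : ∀ {p q a b} → p ≢ q → On p a → On q a → On p b → On q b → a ≡ b
      extends    : ∀ {ℓ} → KLine ℓ → ∃ λ a → ∀ {p} → p ∈ ℓ → On p a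

  module _ {On : Fin n → Subset n → Set} (system : LineSystem On)
           {p₀ q₀ r₀ : Fin n} (d₀ : Distinct₃ p₀ q₀ r₀) (p₀∈ : p₀ ∈ K) (q₀∈ : q₀ ∈ K) (r₀∈ : r₀ ∈ K)
           (no-label : ∀ {a} → On p₀ a → On q₀ a → On r₀ a → Data.Empty.⊥) where

    open LineSystem system

    private
      H : Fin n → ℕ → Set
      H p l = ∃ λ a → code a ≡ l × On p a

      -- The number `free p` and its successor are two labels reserved for `p`. They lie above all
      -- codes of subsets, and the doubling keeps those of different points apart.
      free : Fin n → ℕ
      free p = codes n ℕ.+ double (toℕ p)

      H<free : ∀ {p q l} → H p l → l ℕ.< free q
      H<free (a , ≡.refl , _) = ℕₚ.≤-trans (code< a) (ℕₚ.m≤m+n _ _)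

      IsFree : Fin n → ℕ → Set
      IsFree p l = l ≡ free p ⊎ l ≡ suc (free p)

      free-unique : ∀ {p q l} → IsFree p l → IsFree q l → p ≡ q
      free-unique (inj₁ ≡.refl) (inj₁ eq) = Finₚ.toℕ-injective (double-injective _ _ (ℕₚ.+-cancelˡ-≡ (codes n) _ _ eq))
      free-unique (inj₂ ≡.refl) (inj₂ eq) = Finₚ.toℕ-injective (double-injective _ _ (ℕₚ.+-cancelˡ-≡ (codes n) _ _ (ℕₚ.suc-injective eq)))
      free-unique {p} {q} (inj₁ ≡.refl) (inj₂ eq) = ⊥-elim (even≢odd (toℕ p) (toℕ q)
        (ℕₚ.+-cancelˡ-≡ (codes n) _ _ (≡.trans eq (≡.sym (ℕₚ.+-suc (codes n) _)))))
      free-unique {p} {q} (inj₂ ≡.refl) (inj₁ eq) = ⊥-elim (even≢odd (toℕ q) (toℕ p)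
        (ℕₚ.+-cancelˡ-≡ (codes n) _ _ (≡.trans (≡.sym eq) (≡.sym (ℕₚ.+-suc (codes n) _)))))

      H-not-free : ∀ {p q l} → H p l → ¬ IsFree q l
      H-not-free {p} {q} h (inj₁ ≡.refl) = ℕₚ.<-irrefl ≡.refl (H<free {p} {q} h)
      H-not-free {p} {q} h (inj₂ ≡.refl) = ℕₚ.<-asym (H<free {p} {q} h) (ℕₚ.n<1+n _)

      Completion : Fin n → Set
      Completion p = ∃ λ P → (∀ {l} → H p l → l ∈ₚ P) × (∀ {l} → l ∈ₚ P → H p l ⊎ IsFree p l)

      completion : ∀ p → Completion p
      completion p = CompleteLabels.complete em (H p)
        (λ { (a , ≡.refl , ha) (b , ≡.refl , hb) (c , ≡.refl , hc) →
          Data.Sum.map (≡.cong code) (Data.Sum.map (≡.cong code) (≡.cong code)) (two-labels ha hb hc) })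
        (free p) (H<free {p} {p})

      module Labelled (completion : ∀ p → Completion p) where

        label : Fin n → Pair
        label p = proj₁ (completion p)

        shared⇒H : ∀ {p q l} → p ≢ q → l ∈ₚ label p → l ∈ₚ label q → H p l × H q l
        shared⇒H {p} {q} p≢q l∈p l∈q = go (proj₂ (proj₂ (completion p)) l∈p) (proj₂ (proj₂ (completion q)) l∈q)
          where
          go : ∀ {l} → H p l ⊎ IsFree p l → H q l ⊎ IsFree q l → H p l × H q l
          go (inj₁ h) (inj₁ h′) = h , h′
          go {l} (inj₂ f) (inj₂ f′) = ⊥-elim (p≢q (free-unique {p} {q} f f′))
          go {l} (inj₁ h) (inj₂ f′) = ⊥-elim (H-not-free {p} {q} h f′)
          go {l} (inj₂ f) (inj₁ h′) = ⊥-elim (H-not-free {q} {p} h′ f)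

        one-common′ : ∀ {p q l l′} → p ≢ q → H p l × H q l → H p l′ × H q l′ → l ≡ l′
        one-common′ p≢q ((a , ≡.refl , pa) , (a′ , eq , qa)) ((b , ≡.refl , pb) , (b′ , eq′ , qb))
          with code-injective a′ a eq | code-injective b′ b eq′
        ... | ≡.refl | ≡.refl = ≡.cong code (one-common p≢q pa qa pb qb)

        simple-labels : ∀ {p q} → p ∈ K → q ∈ K → p ≢ q → label p ≢ₚ label q
        simple-labels {p} {q} _ _ p≢q (hi≡ , lo≡) = ℕₚ.<-irrefl
          (one-common′ p≢q (shared⇒H p≢q (inj₂ ≡.refl) (inj₂ lo≡)) (shared⇒H p≢q (inj₁ ≡.refl) (inj₁ hi≡)))
          (lo<hi (label p))

        common : ∀ {p q r} → Distinct₃ p q r → p ∈ K → q ∈ K → r ∈ K → ¬ Indep M (triple p q r) →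
          ∃ λ l → l ∈ₚ label p × l ∈ₚ label q × l ∈ₚ label r
        common {p} {q} {r} d p∈ q∈ r∈ dep =
          let ℓ , line , p∈ℓ , q∈ℓ , r∈ℓ = dependent⇒collinear d p∈ q∈ r∈ dep
              a , on = extends line
              covers = λ x {l} → proj₁ (proj₂ (completion x)) {l}
          in code a , covers p (a , ≡.refl , on p∈ℓ) , covers q (a , ≡.refl , on q∈ℓ) , covers r (a , ≡.refl , on r∈ℓ)

        none : NoCommon (label p₀) (label q₀) (label r₀)
        none l∈p l∈q l∈r = go (shared⇒H (Distinct₃.p≢q d₀) l∈p l∈q) (proj₂ (shared⇒H (Distinct₃.p≢r d₀) l∈p l∈r))
          where
          go : ∀ {l} → H p₀ l × H q₀ l → H r₀ l → Data.Empty.⊥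
          go ((a , ≡.refl , pa) , (b , eq , qb)) (c , eq′ , rc) with code-injective b a eq | code-injective c a eq′
          ... | ≡.refl | ≡.refl = no-label pa qb rc

    -- The labelling by the names of abstract lines gives an admissible matroid above `M`; the
    -- triple p₀, q₀, r₀ keeps its rank at three. By maximality it has no dependencies that `M`
    -- lacks.
    maximality : ∀ {p q r a} → Distinct₃ p q r → p ∈ K → q ∈ K → r ∈ K → On p a → On q a → On r a → Collinear p q r
    maximality {p} {q} {r} {a} d p∈ q∈ r∈ pa qa ra = go completion
      where
      go : (∀ p → Completion p) → Collinear p q r
      go completion = dependent⇒collinear d p∈ q∈ r∈
        (LabelledMatroid.maximal⇒dependent F K {M} M-maximal label simple-labels common d₀ p₀∈ q₀∈ r₀∈ none d p∈ q∈ r∈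
          (covers p (a , ≡.refl , pa)) (covers q (a , ≡.refl , qa)) (covers r (a , ≡.refl , ra)))
        where
        open Labelled completion
        covers = λ x {l} → proj₁ (proj₂ (completion x)) {l}

-- Generating all lines of a component

module GeneratedLines (F : ClassicalField) {n} (C : Configuration (⊤ {n})) (C-linear : Linear C) (K : Subset n) (M : Matroid K)
  (M-maximal : Geometry.Maximal (LinearAlgebra.rawRing F) M) (K≐M : subconfiguration C K ≐ configuration M) where

  open ClassicalField F using (em)
  open Enumerations
  open SubsetCodes
  open MaximalComponent F C C-linear K M M-maximal K≐M public

  point-off : ∀ {ℓ ℓ′} → KLine ℓ → KLine ℓ′ → ℓ ≢ ℓ′ → ∃ λ p → p ∈ ℓ × p ∉ ℓ′
  point-off {ℓ} {ℓ′} line line′ ℓ≢ℓ′ = decidable-stable em λ none →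
    let p , q , _ , d , p∈ , q∈ , _ = three (KLine⇒3≤ line)
        all∈ : ∀ {x} → x ∈ ℓ → x ∈ ℓ′
        all∈ {x} x∈ = decidable-stable (x Subsetₚ.∈? ℓ′) λ x∉ → none (x , x∈ , x∉)
    in ℓ≢ℓ′ (unique (Distinct₃.p≢q d) line line′ p∈ q∈ (all∈ p∈) (all∈ q∈))

  data Built (u v : Subset n) : List (Subset n) → Set where
    base : Built u v (v ∷ᴸ u ∷ᴸ []ᴸ)
    step : ∀ {L w q₁ q₂ y₁ y₂} → Built u v L → KLine w → ¬ w ∈ᴸ L → q₁ ≢ q₂ → q₁ ∈ w → q₂ ∈ w →
           y₁ ∈ᴸ L → q₁ ∈ y₁ → y₂ ∈ᴸ L → q₂ ∈ y₂ → Built u v (w ∷ᴸ L)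

  Extendable : List (Subset n) → Set
  Extendable L = ∃ λ w → KLine w × ¬ w ∈ᴸ L × ∃ λ q₁ → ∃ λ q₂ → q₁ ≢ q₂ × q₁ ∈ w × q₂ ∈ w ×
    (∃ λ y₁ → y₁ ∈ᴸ L × q₁ ∈ y₁) × (∃ λ y₂ → y₂ ∈ᴸ L × q₂ ∈ y₂)

  module _ {u v : Subset n} (u-line : KLine u) (v-line : KLine v) (u≢v : u ≢ v) where

    ∈-Built⇒KLine : ∀ {L y} → Built u v L → y ∈ᴸ L → KLine y
    ∈-Built⇒KLine base (here ≡.refl)         = v-line
    ∈-Built⇒KLine base (there (here ≡.refl)) = u-line
    ∈-Built⇒KLine (step _ line _ _ _ _ _ _ _ _) (here ≡.refl) = line
    ∈-Built⇒KLine (step built _ _ _ _ _ _ _ _ _) (there y∈)   = ∈-Built⇒KLine built y∈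

    u∈Built : ∀ {L} → Built u v L → u ∈ᴸ L
    u∈Built base = there (here ≡.refl)
    u∈Built (step built _ _ _ _ _ _ _ _ _) = there (u∈Built built)

    v∈Built : ∀ {L} → Built u v L → v ∈ᴸ L
    v∈Built base = here ≡.refl
    v∈Built (step built _ _ _ _ _ _ _ _ _) = there (v∈Built built)

    Built-distinct : ∀ {L} → Built u v L → ∀ {i j} → lookup L i ≡ lookup L j → i ≡ j
    Built-distinct base {zero}     {zero}     _  = ≡.refl
    Built-distinct base {zero}     {suc zero} eq = ⊥-elim (u≢v (≡.sym eq))
    Built-distinct base {suc zero} {zero}     eq = ⊥-elim (u≢v eq)
    Built-distinct base {suc zero} {suc zero} _  = ≡.refl
    Built-distinct (step _ _ _ _ _ _ _ _ _ _) {zero} {zero} _ = ≡.refl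
    Built-distinct (step {L = L} _ _ w∉ _ _ _ _ _ _ _) {zero} {suc j} eq = ⊥-elim (w∉ (≡.subst (_∈ᴸ L) (≡.sym eq) (∈-lookup j)))
    Built-distinct (step {L = L} _ _ w∉ _ _ _ _ _ _ _) {suc i} {zero} eq = ⊥-elim (w∉ (≡.subst (_∈ᴸ L) eq (∈-lookup i)))
    Built-distinct (step built _ _ _ _ _ _ _ _ _) {suc i} {suc j} eq = ≡.cong suc (Built-distinct built eq)

    Built-length : ∀ {L} → Built u v L → length L ℕ.≤ codes n
    Built-length {L} built = Finₚ.injective⇒≤ {f = λ i → Fin.fromℕ< (code< (lookup L i))} λ {i} {j} eq →
      Built-distinct built (code-injective (lookup L i) (lookup L j)
        (≡.trans (≡.sym (Finₚ.toℕ-fromℕ< (code< (lookup L i)))) (≡.trans (≡.cong Fin.toℕ eq) (Finₚ.toℕ-fromℕ< (code< (lookup L j))))))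

    -- A built list consists of different subsets of `Fin n`, so its length is at most `codes n` and
    -- the extension stops.
    saturated : ∃ λ L → Built u v L × ¬ Extendable L
    saturated = go (codes n) base (ℕₚ.m≤m+n _ _)
      where
      go : ∀ fuel {L} → Built u v L → codes n ℕ.≤ fuel ℕ.+ length L → ∃ λ L → Built u v L × ¬ Extendable L
      go fuel {L} built enough with em {Extendable L}
      ... | no ¬ext = L , built , ¬ext
      ... | yes (w , line , w∉ , q₁ , q₂ , q₁≢q₂ , q₁∈ , q₂∈ , (y₁ , y₁∈ , q₁∈y₁) , (y₂ , y₂∈ , q₂∈y₂)) with fuel
      ...   | zero = ⊥-elim (ℕₚ.<⇒≱ (Built-length (step built line w∉ q₁≢q₂ q₁∈ q₂∈ y₁∈ q₁∈y₁ y₂∈ q₂∈y₂)) enough)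
      ...   | suc f = go f (step built line w∉ q₁≢q₂ q₁∈ q₂∈ y₁∈ q₁∈y₁ y₂∈ q₂∈y₂)
                        (ℕₚ.≤-trans enough (ℕₚ.≤-reflexive (≡.sym (ℕₚ.+-suc f (length L)))))

    -- Otherwise all lines of L could be merged into one without
    -- touching the other lines, against maximality.
    saturated⇒all : ∀ {L} → Built u v L → ¬ Extendable L → ∀ {w} → KLine w → w ∈ᴸ L
    saturated⇒all {L} built ¬ext {w} w-line = decidable-stable em λ w∉ → contradict w∉
      where
      OnL : Fin n → Set
      OnL p = ∃ λ y → y ∈ᴸ L × p ∈ y
      Own : Fin n → Subset n → Set
      Own p a = ¬ a ∈ᴸ L × KLine a × p ∈ a
      On : Fin n → Subset n → Set
      On p a = (a ≡ u × OnL p) ⊎ Own p a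
      u∈ = u∈Built built
      v∈ = v∈Built built
      two-own : ∀ {p b c} → OnL p → Own p b → Own p c → b ≡ c
      two-own (y , y∈ , p∈y) (b∉ , b-line , p∈b) (c∉ , c-line , p∈c) =
        [ (λ { ≡.refl → ⊥-elim (b∉ y∈) }) , [ (λ { ≡.refl → ⊥-elim (c∉ y∈) }) , (λ eq → eq) ]′ ]′
          (atMostTwo (∈-Built⇒KLine built y∈) b-line c-line p∈y p∈b p∈c)
      two : ∀ {p a b c} → On p a → On p b → On p c → a ≡ b ⊎ a ≡ c ⊎ b ≡ c
      two (inj₁ (≡.refl , _)) (inj₁ (≡.refl , _)) _ = inj₁ ≡.refl
      two (inj₁ (≡.refl , _)) (inj₂ _) (inj₁ (≡.refl , _)) = inj₂ (inj₁ ≡.refl)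
      two (inj₁ (_ , on)) (inj₂ b) (inj₂ c) = inj₂ (inj₂ (two-own on b c))
      two (inj₂ _) (inj₁ (≡.refl , _)) (inj₁ (≡.refl , _)) = inj₂ (inj₂ ≡.refl)
      two (inj₂ a) (inj₁ (_ , on)) (inj₂ c) = inj₂ (inj₁ (two-own on a c))
      two (inj₂ a) (inj₂ b) (inj₁ (_ , on)) = inj₁ (two-own on a b)
      two (inj₂ (_ , a-line , p∈a)) (inj₂ (_ , b-line , p∈b)) (inj₂ (_ , c-line , p∈c)) = atMostTwo a-line b-line c-line p∈a p∈b p∈c
      -- Since `L` cannot be extended, a line outside it meets the union of its lines in at most one
      -- point. This is what keeps two points from sharing two lines after the merging.
      one-junction : ∀ {p q b} → p ≢ q → OnL p → OnL q → Own p b → Own q b → Data.Empty.⊥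
      one-junction p≢q p-on q-on (b∉ , b-line , p∈b) (_ , _ , q∈b) = ¬ext (_ , b-line , b∉ , _ , _ , p≢q , p∈b , q∈b , p-on , q-on)
      one : ∀ {p q a b} → p ≢ q → On p a → On q a → On p b → On q b → a ≡ b
      one p≢q (inj₁ (≡.refl , _)) _ (inj₁ (≡.refl , _)) _ = ≡.refl
      one p≢q _ (inj₁ (≡.refl , _)) _ (inj₁ (≡.refl , _)) = ≡.refl
      one p≢q (inj₁ (≡.refl , _)) (inj₂ (u∉ , _)) _ _ = ⊥-elim (u∉ u∈)
      one p≢q (inj₂ (u∉ , _)) (inj₁ (≡.refl , _)) _ _ = ⊥-elim (u∉ u∈)
      one p≢q _ _ (inj₁ (≡.refl , _)) (inj₂ (u∉ , _)) = ⊥-elim (u∉ u∈)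
      one p≢q _ _ (inj₂ (u∉ , _)) (inj₁ (≡.refl , _)) = ⊥-elim (u∉ u∈)
      one p≢q (inj₁ (_ , p-on)) (inj₁ (_ , q-on)) (inj₂ pb) (inj₂ qb) = ⊥-elim (one-junction p≢q p-on q-on pb qb)
      one p≢q (inj₂ pa) (inj₂ qa) (inj₁ (_ , p-on)) (inj₁ (_ , q-on)) = ⊥-elim (one-junction p≢q p-on q-on pa qa)
      one p≢q (inj₂ (_ , a-line , p∈a)) (inj₂ (_ , _ , q∈a)) (inj₂ (_ , b-line , p∈b)) (inj₂ (_ , _ , q∈b)) =
        unique p≢q a-line b-line p∈a q∈a p∈b q∈b
      system : LineSystem On
      system = record
        { two-labels = two
        ; one-common = one
        ; extends    = λ {ℓ} line → extends line
        }
        where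
        extends : ∀ {ℓ} → KLine ℓ → ∃ λ a → ∀ {p} → p ∈ ℓ → On p a
        extends {ℓ} line with em {ℓ ∈ᴸ L}
        ... | yes ℓ∈ = u , λ p∈ → inj₁ (≡.refl , ℓ , ℓ∈ , p∈)
        ... | no ℓ∉  = ℓ , λ p∈ → inj₂ (ℓ∉ , line , p∈)
      -- After the merging, two points of `u` and a point of `v` off `u` share the abstract line
      -- named `u`. Maximality would make them collinear before the merging.
      merged-collinear : ∀ {p q r} → Distinct₃ p q r → p ∈ K → q ∈ K → r ∈ K →
        (∀ {a} → On p a → On q a → On r a → Data.Empty.⊥) → Data.Empty.⊥
      merged-collinear d p∈ q∈ r∈ none =
        let p , q , _ , d′ , p∈u , q∈u , _ = three (KLine⇒3≤ u-line)
            r , r∈v , r∉u = point-off v-line u-line (u≢v ∘ ≡.sym)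
            on : ∀ {x} → x ∈ u → On x u
            on x∈ = inj₁ (≡.refl , u , u∈ , x∈)
            u⊆K = proj₂ u-line
            ℓ , line , p∈ℓ , q∈ℓ , r∈ℓ = maximality system d p∈ q∈ r∈ none
              (distinct (Distinct₃.p≢q d′) (∈∉⇒≢ p∈u r∉u) (∈∉⇒≢ q∈u r∉u))
              (u⊆K p∈u) (u⊆K q∈u) (proj₂ v-line r∈v) (on p∈u) (on q∈u) (inj₁ (≡.refl , v , v∈ , r∈v))
        in r∉u (≡.subst (r ∈_) (unique (Distinct₃.p≢q d′) line u-line p∈ℓ q∈ℓ p∈u q∈u) r∈ℓ)
      -- The merged system still has a non-collinear triple: two points of `w` away from its
      -- junction with `L`, and a point of `u` off `w`.
      contradict : ¬ w ∈ᴸ L → Data.Empty.⊥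
      contradict w∉ = go (third (KLine⇒3≤ w-line) j j)
        where
        junction : ∃ λ j → j ∈ w × (∀ {x} → x ∈ w → x ≢ j → ¬ OnL x)
        junction with em {∃ λ j → j ∈ w × OnL j}
        ... | yes (j , j∈ , j-on) = j , j∈ , λ x∈ x≢j x-on → ¬ext (w , w-line , w∉ , _ , _ , x≢j , x∈ , j∈ , x-on , j-on)
        ... | no none = let p , _ , _ , _ , p∈ , _ = three (KLine⇒3≤ w-line) in p , p∈ , λ x∈ _ x-on → none (_ , x∈ , x-on)
        j = proj₁ junction
        off = proj₂ (proj₂ junction)
        go : (∃ λ p → p ∈ w × p ≢ j × p ≢ j) → Data.Empty.⊥
        go (p , p∈ , p≢j , _) = go′ (third (KLine⇒3≤ w-line) j p) (point-off u-line w-line (λ { ≡.refl → w∉ u∈ }))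
          where
          go′ : (∃ λ q → q ∈ w × q ≢ j × q ≢ p) → (∃ λ r → r ∈ u × r ∉ w) → Data.Empty.⊥
          go′ (q , q∈ , q≢j , q≢p) (r , r∈u , r∉w) = merged-collinear
              (distinct (q≢p ∘ ≡.sym) (λ { ≡.refl → r∉w p∈ }) (λ { ≡.refl → r∉w q∈ }))
              (proj₂ w-line p∈) (proj₂ w-line q∈) (proj₂ u-line r∈u) none
            where
            none : ∀ {a} → On p a → On q a → On r a → Data.Empty.⊥
            none (inj₁ (_ , p-on)) _ _ = off p∈ p≢j p-on
            none _ (inj₁ (_ , q-on)) _ = off q∈ q≢j q-on
            none (inj₂ (u∉ , _)) (inj₂ _) (inj₁ (≡.refl , _)) = u∉ u∈
            none (inj₂ (_ , a-line , p∈a)) (inj₂ (_ , _ , q∈a)) (inj₂ (_ , _ , r∈a)) =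
              r∉w (≡.subst (r ∈_) (unique (q≢p ∘ ≡.sym) a-line w-line p∈a q∈a p∈ q∈) r∈a)

    -- The predicate `S` confines the induction to some of the lines. It is used with all lines, and
    -- with all lines but the last one, where the property must not be carried across meetings with
    -- the last line.
    ClosedOn : (Subset n → Set) → (Subset n → Set) → Set
    ClosedOn S T = ∀ {w y₁ y₂ q₁ q₂} → KLine w → S w → y₁ ≢ w → S y₁ → T y₁ → y₂ ≢ w → S y₂ → T y₂ → q₁ ≢ q₂ →
      q₁ ∈ w → q₂ ∈ w → q₁ ∈ y₁ → q₂ ∈ y₂ → T w

    Built-induction : ∀ {S T L} → Built u v L → (∀ {y} → y ∈ᴸ L → S y) → T u → T v → ClosedOn S T → ∀ {y} → y ∈ᴸ L → T y
    Built-induction base S Tu Tv closed (here ≡.refl) = Tv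
    Built-induction base S Tu Tv closed (there (here ≡.refl)) = Tu
    Built-induction (step built _ _ _ _ _ _ _ _ _) S Tu Tv closed (there y∈) = Built-induction built (S ∘ there) Tu Tv closed y∈
    Built-induction (step built line w∉ q₁≢q₂ q₁∈ q₂∈ y₁∈ q₁∈y₁ y₂∈ q₂∈y₂) S Tu Tv closed (here ≡.refl) =
      closed line (S (here ≡.refl)) (λ { ≡.refl → w∉ y₁∈ }) (S (there y₁∈)) (IH y₁∈) (λ { ≡.refl → w∉ y₂∈ }) (S (there y₂∈)) (IH y₂∈)
        q₁≢q₂ q₁∈ q₂∈ q₁∈y₁ q₂∈y₂
      where
      IH : ∀ {y} → y ∈ᴸ _ → _
      IH = Built-induction built (S ∘ there) Tu Tv closed

    generated : ∀ {T} → T u → T v → ClosedOn KLine T → ∀ {w} → KLine w → T w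
    generated {T} Tu Tv closed {w} line = go saturated
      where
      go : (∃ λ L → Built u v L × ¬ Extendable L) → T w
      go (L , built , ¬ext) = Built-induction built (∈-Built⇒KLine built) Tu Tv closed (saturated⇒all built ¬ext line)

    -- Because `w` was added at the end, the construction of the remaining lines never refers to it.
    -- `generated-off` records this: they are generated from `u` and `v` among themselves.
    record LastLine : Set₁ where
      field
        w              : Subset n
        w-line         : KLine w
        {q₁ q₂}        : Fin n
        {y₁ y₂}        : Subset n
        q₁≢q₂          : q₁ ≢ q₂
        q₁∈w           : q₁ ∈ w
        q₂∈w           : q₂ ∈ w
        y₁-line        : KLine y₁
        y₂-line        : KLine y₂
        y₁≢w           : y₁ ≢ w
        y₂≢w           : y₂ ≢ w
        q₁∈y₁          : q₁ ∈ y₁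
        q₂∈y₂          : q₂ ∈ y₂
        u≢w            : u ≢ w
        v≢w            : v ≢ w
        generated-off  : ∀ {T} → T u → T v → ClosedOn (λ y → KLine y × y ≢ w) T → ∀ {y} → KLine y → y ≢ w → T y

    lastLine : ∀ {t} → KLine t → t ≢ u → t ≢ v → LastLine
    lastLine {t} t-line t≢u t≢v = go (saturated)
      where
      go : (∃ λ L → Built u v L × ¬ Extendable L) → LastLine
      -- The given third line excludes the initial list, so there is a last step to be analysed.
      go (_ , base , ¬ext) = ⊥-elim (absurd (saturated⇒all base ¬ext t-line))
        where
        absurd : t ∈ᴸ (v ∷ᴸ u ∷ᴸ []ᴸ) → Data.Empty.⊥
        absurd (here eq)         = t≢v eq
        absurd (there (here eq)) = t≢u eq
      go (_ , built@(step {L = L} {w = w} built′ line w∉ q₁≢q₂ q₁∈ q₂∈ y₁∈ q₁∈y₁ y₂∈ q₂∈y₂) , ¬ext) = record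
        { w-line        = line
        ; q₁≢q₂         = q₁≢q₂
        ; q₁∈w          = q₁∈
        ; q₂∈w          = q₂∈
        ; y₁-line       = ∈-Built⇒KLine built′ y₁∈
        ; y₂-line       = ∈-Built⇒KLine built′ y₂∈
        ; y₁≢w          = λ { ≡.refl → w∉ y₁∈ }
        ; y₂≢w          = λ { ≡.refl → w∉ y₂∈ }
        ; q₁∈y₁         = q₁∈y₁
        ; q₂∈y₂         = q₂∈y₂
        ; u≢w           = λ { ≡.refl → w∉ (u∈Built built′) }
        ; v≢w           = λ { ≡.refl → w∉ (v∈Built built′) }
        ; generated-off = λ Tu Tv closed y-line y≢w → Built-induction built′
            (λ y∈ → ∈-Built⇒KLine built′ y∈ , λ { ≡.refl → w∉ y∈ }) Tu Tv closed (rest y≢w (saturated⇒all built ¬ext y-line))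
        }
        where
        rest : ∀ {y} → y ≢ w → y ∈ᴸ (w ∷ᴸ L) → y ∈ᴸ L
        rest y≢w (here eq)  = ⊥-elim (y≢w eq)
        rest y≢w (there y∈) = y∈

-- Points in which the last line meets the other lines

module Junctions (F : ClassicalField) {n} (C : Configuration (⊤ {n})) (C-linear : Linear C) (K : Subset n) (M : Matroid K)
  (M-maximal : Geometry.Maximal (LinearAlgebra.rawRing F) M) (K≐M : subconfiguration C K ≐ configuration M) where

  open ClassicalField F using (em)
  open Enumerations
  open GeneratedLines F C C-linear K M M-maximal K≐M public

  ⊥-not-KLine : ¬ KLine ⊥
  ⊥-not-KLine line = contradiction (≡.subst (3 ℕ.≤_) (Subsetₚ.∣⊥∣≡0 n) (KLine⇒3≤ line)) λ ()

  -- The line `y` has at least three points and meets each of the other two lines in at most one. If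
  -- it misses `y′`, the point `q` stands in for the meeting point to be avoided.
  off-two : ∀ {y w y′ q} → KLine y → KLine w → KLine y′ → y ≢ w → y ≢ y′ → q ∈ y → q ∈ w → ∃ λ a → a ∈ y × a ∉ w × a ∉ y′
  off-two {y} {w} {y′} {q} y-line w-line y′-line y≢w y≢y′ q∈y q∈w = go meeting
    where
    meeting : ∃ λ c → ∀ {a} → a ∈ y → a ≢ c → a ∉ y′
    meeting with em {∃ λ c → c ∈ y × c ∈ y′}
    ... | yes (c , c∈y , c∈y′) = c , λ a∈y a≢c a∈y′ → y≢y′ (unique a≢c y-line y′-line a∈y c∈y a∈y′ c∈y′)
    ... | no none = q , λ a∈y _ a∈y′ → none (_ , a∈y , a∈y′)
    go : (∃ λ c → ∀ {a} → a ∈ y → a ≢ c → a ∉ y′) → ∃ λ a → a ∈ y × a ∉ w × a ∉ y′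
    go (c , off) = let a , a∈y , a≢q , a≢c = third (KLine⇒3≤ y-line) q c in
      a , a∈y , (λ a∈w → y≢w (unique a≢q y-line w-line a∈y q∈y a∈w q∈w)) , off a∈y a≢c

  module _ {w q₁ q₂} (w-line : KLine w) (q₁≢q₂ : q₁ ≢ q₂) (q₁∈w : q₁ ∈ w) (q₂∈w : q₂ ∈ w) where

    private
      FreeOn : Fin n → Set
      FreeOn q = ∀ {y} → KLine y → q ∈ y → y ≡ w

    -- Otherwise q could be moved onto y, against maximality.
    free⇒meets : ∀ {q y} → q ∈ w → q ≢ q₁ → q ≢ q₂ → FreeOn q → KLine y → y ≢ w → ∃ λ x → x ∈ w × x ∈ y
    free⇒meets {q₃} {y} q₃∈w q₃≢q₁ q₃≢q₂ q₃-free y-line y≢w = decidable-stable em λ disjoint → absurd (λ x∈w x∈y → disjoint (_ , x∈w , x∈y))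
      where
      module _ (disjoint : ∀ {x} → x ∈ w → x ∈ y → Data.Empty.⊥) where
        Extended : Fin n → Subset n → Set
        Extended p a = p ∈ a ⊎ (p ≡ q₃ × a ≡ y)
        On : Fin n → Subset n → Set
        On p a = KLine a × Extended p a
        w-or-y : ∀ {a} → On q₃ a → a ≡ w ⊎ a ≡ y
        w-or-y (a-line , inj₁ q₃∈a)   = inj₁ (q₃-free a-line q₃∈a)
        w-or-y (_ , inj₂ (_ , a≡y)) = inj₂ a≡y
        ordinary : ∀ {p a} → p ≢ q₃ → On p a → p ∈ a
        ordinary _ (_ , inj₁ p∈a) = p∈a
        ordinary p≢q₃ (_ , inj₂ (p≡q₃ , _)) = ⊥-elim (p≢q₃ p≡q₃)
        pigeonhole : ∀ {a b c} → a ≡ w ⊎ a ≡ y → b ≡ w ⊎ b ≡ y → c ≡ w ⊎ c ≡ y → a ≡ b ⊎ a ≡ c ⊎ b ≡ c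
        pigeonhole (inj₁ ≡.refl) (inj₁ ≡.refl) _ = inj₁ ≡.refl
        pigeonhole (inj₂ ≡.refl) (inj₂ ≡.refl) _ = inj₁ ≡.refl
        pigeonhole (inj₁ ≡.refl) (inj₂ _) (inj₁ ≡.refl) = inj₂ (inj₁ ≡.refl)
        pigeonhole (inj₂ ≡.refl) (inj₁ _) (inj₂ ≡.refl) = inj₂ (inj₁ ≡.refl)
        pigeonhole (inj₁ _) (inj₂ ≡.refl) (inj₂ ≡.refl) = inj₂ (inj₂ ≡.refl)
        pigeonhole (inj₂ _) (inj₁ ≡.refl) (inj₁ ≡.refl) = inj₂ (inj₂ ≡.refl)
        two : ∀ {p a b c} → On p a → On p b → On p c → a ≡ b ⊎ a ≡ c ⊎ b ≡ c
        two {p} a b c with p Finₚ.≟ q₃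
        ... | yes ≡.refl = pigeonhole (w-or-y a) (w-or-y b) (w-or-y c)
        ... | no p≢q₃    = atMostTwo (proj₁ a) (proj₁ b) (proj₁ c) (ordinary p≢q₃ a) (ordinary p≢q₃ b) (ordinary p≢q₃ c)
        -- After the move q₃ lies on both `w` and `y`, so a second point on both would violate
        -- uniqueness of lines. This is where the assumed disjointness enters.
        not-both : ∀ {q} → q ≢ q₃ → On q w → On q y → Data.Empty.⊥
        not-both q≢q₃ qw qy = disjoint (ordinary q≢q₃ qw) (ordinary q≢q₃ qy)
        same : ∀ {q a b} → q ≢ q₃ → a ≡ w ⊎ a ≡ y → b ≡ w ⊎ b ≡ y → On q a → On q b → a ≡ b
        same _ (inj₁ ≡.refl) (inj₁ ≡.refl) _ _ = ≡.refl
        same _ (inj₂ ≡.refl) (inj₂ ≡.refl) _ _ = ≡.refl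
        same q≢q₃ (inj₁ ≡.refl) (inj₂ ≡.refl) qa qb = ⊥-elim (not-both q≢q₃ qa qb)
        same q≢q₃ (inj₂ ≡.refl) (inj₁ ≡.refl) qa qb = ⊥-elim (not-both q≢q₃ qb qa)
        one : ∀ {p q a b} → p ≢ q → On p a → On q a → On p b → On q b → a ≡ b
        one {p} {q} p≢q pa qa pb qb with p Finₚ.≟ q₃ | q Finₚ.≟ q₃
        ... | yes ≡.refl | _ = same (p≢q ∘ ≡.sym) (w-or-y pa) (w-or-y pb) qa qb
        ... | no p≢q₃ | yes ≡.refl = same p≢q (w-or-y qa) (w-or-y qb) pa pb
        ... | no p≢q₃ | no q≢q₃ = unique p≢q (proj₁ pa) (proj₁ pb) (ordinary p≢q₃ pa) (ordinary q≢q₃ qa) (ordinary p≢q₃ pb) (ordinary q≢q₃ qb)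
        system : LineSystem On
        system = record { two-labels = two ; one-common = one ; extends = λ {ℓ} line → ℓ , λ p∈ → line , inj₁ p∈ }
        absurd : Data.Empty.⊥
        absurd = go (three (KLine⇒3≤ y-line))
          where
          go : (∃ λ r → ∃ λ s → ∃ λ t → Distinct₃ r s t × r ∈ y × s ∈ y × t ∈ y) → Data.Empty.⊥
          go (r , s , _ , rst , r∈y , s∈y , _) =
            let y≢ : ∀ {x z} → x ∈ w → z ∈ y → x ≢ z
                y≢ x∈w z∈y = ∈∉⇒≢ x∈w (λ z∈w → disjoint z∈w z∈y)
                none : ∀ {a} → On q₁ a → On q₂ a → On r a → Data.Empty.⊥
                none a₁ a₂ ar = disjoint (≡.subst (r ∈_)
                  (unique q₁≢q₂ (proj₁ a₁) w-line (ordinary (q₃≢q₁ ∘ ≡.sym) a₁) (ordinary (q₃≢q₂ ∘ ≡.sym) a₂) q₁∈w q₂∈w)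
                  (ordinary (y≢ q₃∈w r∈y ∘ ≡.sym) ar)) r∈y
                ℓ , line , q₃∈ℓ , r∈ℓ , s∈ℓ = maximality system (distinct q₁≢q₂ (y≢ q₁∈w r∈y) (y≢ q₂∈w r∈y))
                  (proj₂ w-line q₁∈w) (proj₂ w-line q₂∈w) (proj₂ y-line r∈y) none
                  (distinct (y≢ q₃∈w r∈y) (y≢ q₃∈w s∈y) (Distinct₃.p≢q rst))
                  (proj₂ w-line q₃∈w) (proj₂ y-line r∈y) (proj₂ y-line s∈y)
                  (y-line , inj₂ (≡.refl , ≡.refl)) (y-line , inj₁ r∈y) (y-line , inj₁ s∈y)
            in disjoint q₃∈w (≡.subst (q₃ ∈_) (unique (Distinct₃.p≢q rst) line y-line r∈ℓ s∈ℓ r∈y s∈y) q₃∈ℓ)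

    module _ {y₁ y₂} (y₁-line : KLine y₁) (y₂-line : KLine y₂) (y₁≢w : y₁ ≢ w) (y₂≢w : y₂ ≢ w) (q₁∈y₁ : q₁ ∈ y₁) (q₂∈y₂ : q₂ ∈ y₂) where

      y₁≢y₂ : y₁ ≢ y₂
      y₁≢y₂ ≡.refl = y₁≢w (unique q₁≢q₂ y₁-line w-line q₁∈y₁ q₂∈y₂ q₁∈w q₂∈w)

      -- Free points on the three lines could be made collinear, against
      -- maximality.
      three-lines-absurd : ∀ {q₃} → q₃ ∈ w → q₃ ≢ q₁ → q₃ ≢ q₂ → FreeOn q₃ →
        (∀ {y} → KLine y → y ≢ w → y ≡ y₁ ⊎ y ≡ y₂) → Data.Empty.⊥
      three-lines-absurd {q₃} q₃∈w q₃≢q₁ q₃≢q₂ q₃-free two-others =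
        go (off-two y₁-line w-line y₂-line y₁≢w y₁≢y₂ q₁∈y₁ q₁∈w)
           (off-two y₂-line w-line y₁-line y₂≢w (y₁≢y₂ ∘ ≡.sym) q₂∈y₂ q₂∈w)
        where
        go : (∃ λ a → a ∈ y₁ × a ∉ w × a ∉ y₂) → (∃ λ b → b ∈ y₂ × b ∉ w × b ∉ y₁) → Data.Empty.⊥
        go (a , a∈y₁ , a∉w , a∉y₂) (b , b∈y₂ , b∉w , b∉y₁) = absurd
          where
          a-free : ∀ {y} → KLine y → a ∈ y → y ≡ y₁
          a-free y-line a∈y = [ (λ eq → eq) , (λ { ≡.refl → ⊥-elim (a∉y₂ a∈y) }) ]′ (two-others y-line λ { ≡.refl → a∉w a∈y })
          b-free : ∀ {y} → KLine y → b ∈ y → y ≡ y₂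
          b-free y-line b∈y = [ (λ { ≡.refl → ⊥-elim (b∉y₁ b∈y) }) , (λ eq → eq) ]′ (two-others y-line λ { ≡.refl → b∉w b∈y })
          data Special : Fin n → Subset n → Set where
            is-a : Special a y₁
            is-b : Special b y₂
            is-q : Special q₃ w
          special-free : ∀ {p y z} → Special p y → KLine z → p ∈ z → z ≡ y
          special-free is-a = a-free
          special-free is-b = b-free
          special-free is-q = q₃-free
          special-injective : ∀ {p q y} → Special p y → Special q y → p ≡ q
          special-injective is-a is-a = ≡.refl
          special-injective is-b is-b = ≡.refl
          special-injective is-q is-q = ≡.refl
          special-injective is-a is-b = ⊥-elim (y₁≢y₂ ≡.refl)
          special-injective is-a is-q = ⊥-elim (y₁≢w ≡.refl)
          special-injective is-b is-a = ⊥-elim (y₁≢y₂ ≡.refl)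
          special-injective is-b is-q = ⊥-elim (y₂≢w ≡.refl)
          special-injective is-q is-a = ⊥-elim (y₁≢w ≡.refl)
          special-injective is-q is-b = ⊥-elim (y₂≢w ≡.refl)
          -- The additional line through `a`, `b` and q₃ is named `⊥`, which cannot clash with a
          -- line of the component since those have at least three points.
          On : Fin n → Subset n → Set
          On p α = (KLine α × p ∈ α) ⊎ (α ≡ ⊥ × ∃ (Special p))
          two : ∀ {p α β γ} → On p α → On p β → On p γ → α ≡ β ⊎ α ≡ γ ⊎ β ≡ γ
          two (inj₁ (α , p∈α)) (inj₁ (β , p∈β)) (inj₁ (γ , p∈γ)) = atMostTwo α β γ p∈α p∈β p∈γ
          two (inj₂ (≡.refl , _)) (inj₂ (≡.refl , _)) _ = inj₁ ≡.refl
          two (inj₂ (≡.refl , _)) (inj₁ _) (inj₂ (≡.refl , _)) = inj₂ (inj₁ ≡.refl)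
          two (inj₁ _) (inj₂ (≡.refl , _)) (inj₂ (≡.refl , _)) = inj₂ (inj₂ ≡.refl)
          two (inj₂ (_ , _ , s)) (inj₁ (β , p∈β)) (inj₁ (γ , p∈γ)) = inj₂ (inj₂ (≡.trans (special-free s β p∈β) (≡.sym (special-free s γ p∈γ))))
          two (inj₁ (α , p∈α)) (inj₂ (_ , _ , s)) (inj₁ (γ , p∈γ)) = inj₂ (inj₁ (≡.trans (special-free s α p∈α) (≡.sym (special-free s γ p∈γ))))
          two (inj₁ (α , p∈α)) (inj₁ (β , p∈β)) (inj₂ (_ , _ , s)) = inj₁ (≡.trans (special-free s α p∈α) (≡.sym (special-free s β p∈β)))
          mixed : ∀ {p q y y′ β} → p ≢ q → Special p y → Special q y′ → KLine β → p ∈ β → q ∈ β → Data.Empty.⊥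
          mixed p≢q s s′ β p∈β q∈β with special-free s β p∈β | special-free s′ β q∈β
          ... | ≡.refl | ≡.refl = p≢q (special-injective s s′)
          one : ∀ {p q α β} → p ≢ q → On p α → On q α → On p β → On q β → α ≡ β
          one p≢q (inj₁ (α , p∈α)) (inj₁ (_ , q∈α)) (inj₁ (β , p∈β)) (inj₁ (_ , q∈β)) = unique p≢q α β p∈α q∈α p∈β q∈β
          one p≢q (inj₂ (≡.refl , _)) _ (inj₂ (≡.refl , _)) _ = ≡.refl
          one p≢q _ (inj₂ (≡.refl , _)) _ (inj₂ (≡.refl , _)) = ≡.refl
          one p≢q (inj₁ (α , _)) (inj₂ (≡.refl , _)) _ _ = ⊥-elim (⊥-not-KLine α)
          one p≢q (inj₂ (≡.refl , _)) (inj₁ (α , _)) _ _ = ⊥-elim (⊥-not-KLine α)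
          one p≢q _ _ (inj₁ (β , _)) (inj₂ (≡.refl , _)) = ⊥-elim (⊥-not-KLine β)
          one p≢q _ _ (inj₂ (≡.refl , _)) (inj₁ (β , _)) = ⊥-elim (⊥-not-KLine β)
          one p≢q (inj₂ (_ , _ , s)) (inj₂ (_ , _ , s′)) (inj₁ (β , p∈β)) (inj₁ (_ , q∈β)) = ⊥-elim (mixed p≢q s s′ β p∈β q∈β)
          one p≢q (inj₁ (α , p∈α)) (inj₁ (_ , q∈α)) (inj₂ (_ , _ , s)) (inj₂ (_ , _ , s′)) = ⊥-elim (mixed p≢q s s′ α p∈α q∈α)
          system : LineSystem On
          system = record { two-labels = two ; one-common = one ; extends = λ {ℓ} line → ℓ , λ p∈ → inj₁ (line , p∈) }
          a≢q₁ : q₁ ≢ a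
          a≢q₁ = ∈∉⇒≢ q₁∈w a∉w
          not-special : ∀ {p y} → p ∈ w → p ≢ q₃ → ¬ Special p y
          not-special p∈w p≢q₃ is-a = a∉w p∈w
          not-special p∈w p≢q₃ is-b = b∉w p∈w
          not-special p∈w p≢q₃ is-q = p≢q₃ ≡.refl
          none : ∀ {α} → On q₁ α → On q₂ α → On a α → Data.Empty.⊥
          none (inj₂ (_ , _ , s)) _ _ = not-special q₁∈w (q₃≢q₁ ∘ ≡.sym) s
          none (inj₁ _) (inj₂ (_ , _ , s)) _ = not-special q₂∈w (q₃≢q₂ ∘ ≡.sym) s
          none (inj₁ (α , _)) (inj₁ _) (inj₂ (≡.refl , _)) = ⊥-not-KLine α
          none (inj₁ (α , q₁∈α)) (inj₁ (_ , q₂∈α)) (inj₁ (_ , a∈α)) = a∉w (≡.subst (a ∈_) (unique q₁≢q₂ α w-line q₁∈α q₂∈α q₁∈w q₂∈w) a∈α)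
          absurd : Data.Empty.⊥
          absurd = go′ (maximality system (distinct q₁≢q₂ a≢q₁ (∈∉⇒≢ q₂∈w a∉w))
              (proj₂ w-line q₁∈w) (proj₂ w-line q₂∈w) (proj₂ y₁-line a∈y₁) none
              (distinct (∈∉⇒≢ a∈y₁ b∉y₁) (∈∉⇒≢ q₃∈w a∉w ∘ ≡.sym) (∈∉⇒≢ q₃∈w b∉w ∘ ≡.sym))
              (proj₂ y₁-line a∈y₁) (proj₂ y₂-line b∈y₂) (proj₂ w-line q₃∈w)
              (inj₂ (≡.refl , _ , is-a)) (inj₂ (≡.refl , _ , is-b)) (inj₂ (≡.refl , _ , is-q)))
            where
            go′ : Collinear a b q₃ → Data.Empty.⊥
            go′ (ℓ , line , a∈ℓ , b∈ℓ , _) with a-free line a∈ℓ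
            ... | ≡.refl = b∉y₁ b∈ℓ

      ThirdJunction : Set
      ThirdJunction = ∃ λ q₃ → q₃ ∈ w × q₃ ≢ q₁ × q₃ ≢ q₂ × ∃ λ y₃ → KLine y₃ × y₃ ≢ w × q₃ ∈ y₃

      -- Otherwise all points of `w` except q₁ and q₂ are free. Then every other line meets `w`,
      -- necessarily at q₁ or q₂, and so is `y₁` or `y₂`; a component with only these three lines
      -- has been excluded.
      third-junction : ThirdJunction
      third-junction = decidable-stable em λ none → absurd none (third (KLine⇒3≤ w-line) q₁ q₂)
        where
        module _ (none : ¬ ThirdJunction) where
          free : ∀ {q} → q ∈ w → q ≢ q₁ → q ≢ q₂ → FreeOn q
          free {q} q∈w q≢q₁ q≢q₂ {y} y-line q∈y = decidable-stable em λ y≢w → none (q , q∈w , q≢q₁ , q≢q₂ , y , y-line , y≢w , q∈y)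
          through : ∀ {q y y′} → q ∈ w → KLine y′ → y′ ≢ w → q ∈ y′ → KLine y → y ≢ w → q ∈ y → y ≡ y′
          through q∈w y′-line y′≢w q∈y′ y-line y≢w q∈y = [ (λ eq → ⊥-elim (y≢w (≡.sym eq))) , [ (λ eq → ⊥-elim (y′≢w (≡.sym eq))) , (λ eq → eq) ]′ ]′
            (atMostTwo w-line y-line y′-line q∈w q∈y q∈y′)
          meets⇒ : ∀ {y} → KLine y → y ≢ w → (∃ λ x → x ∈ w × x ∈ y) → y ≡ y₁ ⊎ y ≡ y₂
          meets⇒ y-line y≢w (x , x∈w , x∈y) with x Finₚ.≟ q₁ | x Finₚ.≟ q₂
          ... | yes ≡.refl | _          = inj₁ (through q₁∈w y₁-line y₁≢w q₁∈y₁ y-line y≢w x∈y)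
          ... | no _       | yes ≡.refl = inj₂ (through q₂∈w y₂-line y₂≢w q₂∈y₂ y-line y≢w x∈y)
          ... | no x≢q₁    | no x≢q₂    = ⊥-elim (y≢w (free x∈w x≢q₁ x≢q₂ y-line x∈y))
          absurd : (∃ λ q₃ → q₃ ∈ w × q₃ ≢ q₁ × q₃ ≢ q₂) → Data.Empty.⊥
          absurd (q₃ , q₃∈w , q₃≢q₁ , q₃≢q₂) = three-lines-absurd q₃∈w q₃≢q₁ q₃≢q₂ q₃-free λ y-line y≢w →
              meets⇒ y-line y≢w (free⇒meets q₃∈w q₃≢q₁ q₃≢q₂ q₃-free y-line y≢w)
            where
            q₃-free : FreeOn q₃
            q₃-free = free q₃∈w q₃≢q₁ q₃≢q₂

-- Solutions as piecewise affine functions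

module AffineFunctions (F : ClassicalField) where

  open LinearAlgebra F
  open Enumerations
  open Solver using (solve; _:=_; _:+_; _:-_; _:*_; :-_)

  Injective : ∀ {n} → Vect n → Set
  Injective x = ∀ {i j} → x i ≈ x j → i ≡ j

  sum-three : ∀ {n} (f : Vect n) {i j k} → Distinct₃ i j k → (∀ l → l ≢ i → l ≢ j → l ≢ k → f l ≈ 0#) →
    sum f ≈ f i + (f j + f k)
  sum-three {n} f {i} {j} {k} d off = trans (sum-cong-≋ expand) (trans
      (∑-distrib-+ (λ l → f i * δ i l) (λ l → f j * δ j l + f k * δ k l))
      (+-cong (sum-δ (λ _ → f i) i) (trans (∑-distrib-+ (λ l → f j * δ j l) (λ l → f k * δ k l))
        (+-cong (sum-δ (λ _ → f j) j) (sum-δ (λ _ → f k) k)))))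
    where
    open Distinct₃ d
    diagonal : ∀ {l} → f l * δ l l ≈ f l
    diagonal {l} = trans (*-congˡ (δ-diagonal l)) (*-identityʳ (f l))
    zero-term : ∀ {a l} → a ≢ l → f a * δ a l ≈ 0#
    zero-term a≢l = trans (*-congˡ (δ-off a≢l)) (zeroʳ _)
    expand : ∀ l → f l ≈ f i * δ i l + (f j * δ j l + f k * δ k l)
    expand l = [ (λ { ≡.refl → sym (trans (+-cong diagonal (trans (+-cong (zero-term (p≢q ∘ ≡.sym)) (zero-term (p≢r ∘ ≡.sym))) (+-identityˡ 0#))) (+-identityʳ _)) })
      , (λ l≢i → [ (λ { ≡.refl → sym (trans (+-cong (zero-term p≢q) (trans (+-cong diagonal (zero-term (q≢r ∘ ≡.sym))) (+-identityʳ _))) (+-identityˡ _)) })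
        , (λ l≢j → [ (λ { ≡.refl → sym (trans (+-cong (zero-term p≢r) (trans (+-cong (zero-term q≢r) diagonal) (+-identityˡ _))) (+-identityˡ _)) })
          , (λ l≢k → trans (off l l≢i l≢j l≢k) (sym (trans (+-cong (zero-term (l≢i ∘ ≡.sym)) (trans (+-cong (zero-term (l≢j ∘ ≡.sym)) (zero-term (l≢k ∘ ≡.sym))) (+-identityˡ 0#))) (+-identityˡ 0#))))
          ]′ (toSum (l Finₚ.≟ k))) ]′ (toSum (l Finₚ.≟ j))) ]′ (toSum (l Finₚ.≟ i))

  affine-through-two : ∀ {a b a′ b′} s t → ¬ s ≈ t → a * s + b ≈ a′ * s + b′ → a * t + b ≈ a′ * t + b′ → a ≈ a′ × b ≈ b′
  affine-through-two {a} {b} {a′} {b′} s t s≉t hs ht = a≈ , -≈0⇒≈ (trans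
      (solve 5 (λ a b a′ b′ p → b :- b′ := ((a :* p :+ b) :- (a′ :* p :+ b′)) :- (a :- a′) :* p) refl a b a′ b′ s)
      (trans (+-cong (≈⇒-≈0 hs) (-‿cong (trans (*-congʳ (≈⇒-≈0 a≈)) (zeroˡ s)))) (x-x≈0 0#)))
    where
    a≈ : a ≈ a′
    a≈ = -≈0⇒≈ (*≈0⇒≈0 (s≉t ∘ -≈0⇒≈) (trans
      (solve 6 (λ a b a′ b′ p q → (p :- q) :* (a :- a′) := ((a :* p :+ b) :- (a′ :* p :+ b′)) :- ((a :* q :+ b) :- (a′ :* q :+ b′))) refl a b a′ b′ s t)
      (trans (+-cong (≈⇒-≈0 hs) (-‿cong (≈⇒-≈0 ht))) (x-x≈0 0#))))

  module _ {n} (x : Vect n) where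

    -- The determinant of the points (x i , 1 , z i), (x j , 1 , z j), (x k , 1 , z k), up to sign.
    area : Vect n → Fin n → Fin n → Fin n → Carrier
    area z i j k = (x j - x k) * z i + (- (x i - x k) * z j + (x i - x j) * z k)

    area-swap₁₂ : ∀ z i j k → area z j i k ≈ 0# → area z i j k ≈ 0#
    area-swap₁₂ z i j k h = trans (solve 6 (λ a b c u v w →
      (b :- c) :* u :+ (:- (a :- c) :* v :+ (a :- b) :* w) := :- ((a :- c) :* v :+ (:- (b :- c) :* u :+ (b :- a) :* w)))
      refl (x i) (x j) (x k) (z i) (z j) (z k)) (trans (-‿cong h) -0#≈0#)

    area-swap₂₃ : ∀ z i j k → area z i k j ≈ 0# → area z i j k ≈ 0#
    area-swap₂₃ z i j k h = trans (solve 6 (λ a b c u v w →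
      (b :- c) :* u :+ (:- (a :- c) :* v :+ (a :- b) :* w) := :- ((c :- b) :* u :+ (:- (a :- b) :* w :+ (a :- c) :* v)))
      refl (x i) (x j) (x k) (z i) (z j) (z k)) (trans (-‿cong h) -0#≈0#)

    area-linear : ∀ i j k a v w → area (λ l → a * v l + w l) i j k ≈ a * area v i j k + area w i j k
    area-linear i j k a v w = solve 10 (λ p q r a u₁ u₂ u₃ w₁ w₂ w₃ →
      (q :- r) :* (a :* u₁ :+ w₁) :+ (:- (p :- r) :* (a :* u₂ :+ w₂) :+ (p :- q) :* (a :* u₃ :+ w₃)) :=
      a :* ((q :- r) :* u₁ :+ (:- (p :- r) :* u₂ :+ (p :- q) :* u₃)) :+ ((q :- r) :* w₁ :+ (:- (p :- r) :* w₂ :+ (p :- q) :* w₃)))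
      refl (x i) (x j) (x k) a (v i) (v j) (v k) (w i) (w j) (w k)

    AffineAt : Vect n → Carrier → Carrier → Fin n → Set
    AffineAt z a b i = z i ≈ a * x i + b

    Affine : Vect n → Subset n → Carrier → Carrier → Set
    Affine z S a b = ∀ {i} → i ∈ S → AffineAt z a b i

    -- Affine functions of `x` have area zero, so by linearity `z` may be replaced by its deviation
    -- from `a x + b`. Vanishing deviations at two points then isolate the third.
    area-affine : ∀ z a b i j k → area z i j k ≈
      (x i - x j) * (z k - (a * x k + b)) + ((x j - x k) * (z i - (a * x i + b)) + - (x i - x k) * (z j - (a * x j + b)))
    area-affine z a b i j k = solve 8 (λ p q r a b u v w →
      (q :- r) :* u :+ (:- (p :- r) :* v :+ (p :- q) :* w) :=
      (p :- q) :* (w :- (a :* r :+ b)) :+ ((q :- r) :* (u :- (a :* p :+ b)) :+ :- (p :- r) :* (v :- (a :* q :+ b))))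
      refl (x i) (x j) (x k) a b (z i) (z j) (z k)

    private
      vanish : ∀ {c u v} → u ≈ v → c * (u - v) ≈ 0#
      vanish {c} h = trans (*-congˡ (≈⇒-≈0 h)) (zeroʳ c)

    affine⇒area≈0 : ∀ {z a b i j k} → AffineAt z a b i → AffineAt z a b j → AffineAt z a b k → area z i j k ≈ 0#
    affine⇒area≈0 {z} {a} {b} {i} {j} {k} hi hj hk = trans (area-affine z a b i j k)
      (trans (+-cong (vanish hk) (trans (+-cong (vanish hi) (vanish hj)) (+-identityˡ 0#))) (+-identityˡ 0#))

    module _ (x-injective : Injective x) where

      x-≉0 : ∀ {i j} → i ≢ j → ¬ x i - x j ≈ 0#
      x-≉0 i≢j h = i≢j (x-injective (-≈0⇒≈ h))

      area≈0⇒affine : ∀ {z a b i j k} → i ≢ j → AffineAt z a b i → AffineAt z a b j → area z i j k ≈ 0# → AffineAt z a b k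
      area≈0⇒affine {z} {a} {b} {i} {j} {k} i≢j hi hj h = -≈0⇒≈ (*≈0⇒≈0 (x-≉0 i≢j) (trans
        (sym (trans (area-affine z a b i j k) (trans (+-congˡ (trans (+-cong (vanish hi) (vanish hj)) (+-identityˡ 0#))) (+-identityʳ _)))) h))

      interpolate : ∀ z {i j} → i ≢ j → ∃ λ a → ∃ λ b → AffineAt z a b i × AffineAt z a b j
      interpolate z {i} {j} i≢j = let u , xu≈1 = inverse (x i - x j) (x-≉0 i≢j) ; a = (z i - z j) * u in
        a , z i - a * x i
        , solve 3 (λ a p s → s := a :* p :+ (s :- a :* p)) refl a (x i) (z i)
        , trans (sym (trans (+-congˡ (-‿cong (trans (*-congˡ xu≈1) (*-identityʳ _)))) (solve 2 (λ s t → s :- (s :- t) := t) refl (z i) (z j))))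
            (solve 5 (λ p q s t u → s :- (s :- t) :* ((p :- q) :* u) := ((s :- t) :* u) :* q :+ (s :- ((s :- t) :* u) :* p)) refl (x i) (x j) (z i) (z j) u)

      affine-unique : ∀ {a b a′ b′ i j} → i ≢ j → a * x i + b ≈ a′ * x i + b′ → a * x j + b ≈ a′ * x j + b′ → a ≈ a′ × b ≈ b′
      affine-unique {i = i} {j} i≢j = affine-through-two (x i) (x j) (λ h → i≢j (x-injective h))

      affine-cong : ∀ {z S a b a′ b′} → a ≈ a′ → b ≈ b′ → Affine z S a b → Affine z S a′ b′
      affine-cong a≈ b≈ h i∈ = trans (h i∈) (+-cong (*-congʳ a≈) b≈)

      affine-determined : ∀ {z S a b a′ b′ i j} → i ≢ j → i ∈ S → j ∈ S → Affine z S a b → AffineAt z a′ b′ i → AffineAt z a′ b′ j →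
        a ≈ a′ × b ≈ b′
      affine-determined i≢j i∈ j∈ h hi hj = affine-unique i≢j (trans (sym (h i∈)) hi) (trans (sym (h j∈)) hj)

  module _ {n} (C : Configuration (⊤ {n})) (x : Vect n) where

    open CollinearTriple

    row : ∀ (t : CollinearTriple C) z → Λ C x t · z ≈ area x z (i₁ t) (i₂ t) (i₃ t)
    row t z = trans (sum-three (λ l → Λ C x t l * z l) d off)
        (+-cong (*-congʳ at₁) (+-cong (*-congʳ at₂) (*-congʳ at₃)))
      where
      d : Distinct₃ (i₁ t) (i₂ t) (i₃ t)
      d = distinct (Finₚ.<⇒≢ (i₁<i₂ t)) (Finₚ.<⇒≢ (Finₚ.<-trans (i₁<i₂ t) (i₂<i₃ t))) (Finₚ.<⇒≢ (i₂<i₃ t))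
      open Distinct₃ d
      off : ∀ l → l ≢ i₁ t → l ≢ i₂ t → l ≢ i₃ t → Λ C x t l * z l ≈ 0#
      off l l≢₁ l≢₂ l≢₃ = trans (*-congʳ entry) (zeroˡ (z l))
        where
        entry : Λ C x t l ≈ 0#
        entry with l Finₚ.≟ i₁ t | l Finₚ.≟ i₂ t | l Finₚ.≟ i₃ t
        ... | yes eq | _      | _      = ⊥-elim (l≢₁ eq)
        ... | no _   | yes eq | _      = ⊥-elim (l≢₂ eq)
        ... | no _   | no _   | yes eq = ⊥-elim (l≢₃ eq)
        ... | no _   | no _   | no _   = refl
      at₁ : Λ C x t (i₁ t) ≈ x (i₂ t) - x (i₃ t)
      at₁ with i₁ t Finₚ.≟ i₁ t | i₁ t Finₚ.≟ i₂ t | i₁ t Finₚ.≟ i₃ t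
      ... | yes _  | _ | _ = refl
      ... | no neq | _ | _ = ⊥-elim (neq ≡.refl)
      at₂ : Λ C x t (i₂ t) ≈ - (x (i₁ t) - x (i₃ t))
      at₂ with i₂ t Finₚ.≟ i₁ t | i₂ t Finₚ.≟ i₂ t | i₂ t Finₚ.≟ i₃ t
      ... | yes eq | _      | _ = ⊥-elim (p≢q (≡.sym eq))
      ... | no _   | yes _  | _ = refl
      ... | no _   | no neq | _ = ⊥-elim (neq ≡.refl)
      at₃ : Λ C x t (i₃ t) ≈ x (i₁ t) - x (i₂ t)
      at₃ with i₃ t Finₚ.≟ i₁ t | i₃ t Finₚ.≟ i₂ t | i₃ t Finₚ.≟ i₃ t
      ... | yes eq | _      | _      = ⊥-elim (p≢r (≡.sym eq))
      ... | no _   | yes eq | _      = ⊥-elim (q≢r (≡.sym eq))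
      ... | no _   | no _   | yes _  = refl
      ... | no _   | no _   | no neq = ⊥-elim (neq ≡.refl)

    solution-subspace : Subspace (Solution C x)
    solution-subspace = orthogonal-subspace (Λ C x)

    affineLines⇒solution : ∀ {z} → (∀ {ℓ} → Line C ℓ → ∃ λ a → ∃ λ b → Affine x z ℓ a b) → Solution C x z
    affineLines⇒solution {z} h t = let a , b , aff = h (line t) in
      trans (row t z) (affine⇒area≈0 x {z} {a} {b} (aff (i₁∈ℓ t)) (aff (i₂∈ℓ t)) (aff (i₃∈ℓ t)))

    -- The matrix has rows only for increasing triples. Transpositions preserve the vanishing of the
    -- area and reach every order.
    solution⇒area≈0 : ∀ {z ℓ i j k} → Solution C x z → Line C ℓ → Distinct₃ i j k → i ∈ ℓ → j ∈ ℓ → k ∈ ℓ → area x z i j k ≈ 0#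
    solution⇒area≈0 {z} {ℓ} {i} {j} {k} sol line d i∈ j∈ k∈ = go (Finₚ.<-cmp i j) (Finₚ.<-cmp j k) (Finₚ.<-cmp i k)
      where
      open Distinct₃ d
      sorted : ∀ {a b c} → a ∈ ℓ → b ∈ ℓ → c ∈ ℓ → a Fin.< b → b Fin.< c → area x z a b c ≈ 0#
      sorted a∈ b∈ c∈ a<b b<c = let t = record { i₁<i₂ = a<b ; i₂<i₃ = b<c ; line = line ; i₁∈ℓ = a∈ ; i₂∈ℓ = b∈ ; i₃∈ℓ = c∈ } in
        trans (sym (row t z)) (sol t)
      go : _ → _ → _ → area x z i j k ≈ 0#
      go (tri≈ _ eq _) _ _ = ⊥-elim (p≢q eq)
      go _ (tri≈ _ eq _) _ = ⊥-elim (q≢r eq)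
      go _ _ (tri≈ _ eq _) = ⊥-elim (p≢r eq)
      go (tri< i<j _ _) (tri< j<k _ _) _ = sorted i∈ j∈ k∈ i<j j<k
      go (tri< i<j _ _) (tri> _ _ k<j) (tri< i<k _ _) = area-swap₂₃ x z i j k (sorted i∈ k∈ j∈ i<k k<j)
      go (tri< i<j _ _) (tri> _ _ k<j) (tri> _ _ k<i) = area-swap₂₃ x z i j k (area-swap₁₂ x z i k j (sorted k∈ i∈ j∈ k<i i<j))
      go (tri> _ _ j<i) (tri> _ _ k<j) _ = area-swap₁₂ x z i j k (area-swap₂₃ x z j i k (area-swap₁₂ x z j k i (sorted k∈ j∈ i∈ k<j j<i)))
      go (tri> _ _ j<i) (tri< j<k _ _) (tri< i<k _ _) = area-swap₁₂ x z i j k (sorted j∈ i∈ k∈ j<i i<k)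
      go (tri> _ _ j<i) (tri< j<k _ _) (tri> _ _ k<i) = area-swap₁₂ x z i j k (area-swap₂₃ x z j i k (sorted j∈ k∈ i∈ j<k k<i))

    solution⇒affineLines : Injective x → ∀ {z ℓ} → Solution C x z → Line C ℓ → 3 ℕ.≤ ∣ ℓ ∣ → ∃ λ a → ∃ λ b → Affine x z ℓ a b
    solution⇒affineLines x-inj {z} {ℓ} sol line 3≤ = go (three 3≤)
      where
      go : (∃ λ p → ∃ λ q → ∃ λ r → Distinct₃ p q r × p ∈ ℓ × q ∈ ℓ × r ∈ ℓ) → ∃ λ a → ∃ λ b → Affine x z ℓ a b
      go (p , q , _ , d , p∈ , q∈ , _) = a , b , affine
        where
        p≢q = Distinct₃.p≢q d
        interpolation = interpolate x x-inj z p≢q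
        a = proj₁ interpolation
        b = proj₁ (proj₂ interpolation)
        at-p = proj₁ (proj₂ (proj₂ interpolation))
        at-q = proj₂ (proj₂ (proj₂ interpolation))
        affine : Affine x z ℓ a b
        affine {i} i∈ = [ (λ { ≡.refl → at-p }) , (λ i≢p → [ (λ { ≡.refl → at-q })
            , (λ i≢q → area≈0⇒affine x x-inj {z} {a} {b} p≢q at-p at-q
                (solution⇒area≈0 {z} sol line (distinct p≢q (i≢p ∘ ≡.sym) (i≢q ∘ ≡.sym)) p∈ q∈ i∈)) ]′ (toSum (i Finₚ.≟ q))) ]′ (toSum (i Finₚ.≟ p))

-- Solutions on one component and perturbation of a position

module ComponentSolutions (F : ClassicalField) {n} (C : Configuration (⊤ {n})) (C-linear : Linear C) (K : Subset n) (M : Matroid K)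
  (M-maximal : Geometry.Maximal (LinearAlgebra.rawRing F) M) (K≐M : subconfiguration C K ≐ configuration M) where

  open LinearAlgebra F
  open Enumerations
  open AffineFunctions F
  open Junctions F C C-linear K M M-maximal K≐M public

  Solves : Vect n → Vect n → Set
  Solves x z = ∀ {ℓ} → KLine ℓ → ∃ λ a → ∃ λ b → Affine x z ℓ a b

  AffineOn : Vect n → Vect n → Subset n → Set
  AffineOn x z ℓ = ∃ λ a → ∃ λ b → Affine x z ℓ a b

  module _ {x : Vect n} (x-injective : Injective x) {z : Vect n} (solves : Solves x z) where

    merge : ∀ {u v a b} → KLine u → KLine v → u ≢ v → Affine x z u a b → Affine x z v a b → ∀ {w} → KLine w → Affine x z w a b
    merge {u} {v} {a} {b} u-line v-line u≢v on-u on-v = generated u-line v-line u≢v {T = λ w → Affine x z w a b} on-u on-v closed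
      where
      closed : ClosedOn u-line v-line u≢v KLine (λ w → Affine x z w a b)
      closed {w} {y₁} {y₂} {q₁} {q₂} w-line _ _ _ on-y₁ _ _ on-y₂ q₁≢q₂ q₁∈w q₂∈w q₁∈y₁ q₂∈y₂ = go (solves w-line)
        where
        go : AffineOn x z w → Affine x z w a b
        go (a′ , b′ , on-w) = let a≈ , b≈ = affine-determined x x-injective {z} {w} q₁≢q₂ q₁∈w q₂∈w on-w (on-y₁ q₁∈y₁) (on-y₂ q₂∈y₂) in
          affine-cong x x-injective {z} {w} a≈ b≈ on-w

  injection : Vect n
  injection i = fromℕ (toℕ i)

  injection-injective : Injective injection
  injection-injective h = Finₚ.toℕ-injective (fromℕ-injective h)

  module ThirdLine {u v o} (u-line : KLine u) (v-line : KLine v) (u≢v : u ≢ v) (o∈u : o ∈ u) (o∈v : o ∈ v) where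

    -- Up to scaling and adding an affine function, a solution that is
    -- not affine on K.
    record Normalised (x z : Vect n) : Set where
      field
        solves : Solves x z
        on-u   : Affine x z u 0# 0#
        on-v   : Affine x z v 1# (- x o)

    open Normalised

    not-affine : ∀ {x z a b} → Injective x → Normalised x z → ¬ (Affine x z u a b × Affine x z v a b)
    not-affine {x} {z} {a} {b} x-inj norm (aff-u , aff-v) = go (three (KLine⇒3≤ u-line)) (three (KLine⇒3≤ v-line))
      where
      go : (∃ λ p → ∃ λ q → ∃ λ r → Distinct₃ p q r × p ∈ u × q ∈ u × r ∈ u) →
           (∃ λ p → ∃ λ q → ∃ λ r → Distinct₃ p q r × p ∈ v × q ∈ v × r ∈ v) → Data.Empty.⊥
      go (p , q , _ , d , p∈ , q∈ , _) (p′ , q′ , _ , d′ , p′∈ , q′∈ , _) =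
        0≉1 (trans (proj₁ (affine-determined x x-inj {z} {u} (Distinct₃.p≢q d) p∈ q∈ (on-u norm) (aff-u p∈) (aff-u q∈)))
             (sym (proj₁ (affine-determined x x-inj {z} {v} (Distinct₃.p≢q d′) p′∈ q′∈ (on-v norm) (aff-v p′∈) (aff-v q′∈)))))

    module _ (normalised : ∀ x → Injective x → ∃ (Normalised x)) where

      module Perturbed (last : LastLine u-line v-line u≢v) where
        open LastLine last

        module _ {q₃ y₃} (q₃∈w : q₃ ∈ w) (q₃≢q₁ : q₃ ≢ q₁) (q₃≢q₂ : q₃ ≢ q₂) (y₃-line : KLine y₃) (y₃≢w : y₃ ≢ w) (q₃∈y₃ : q₃ ∈ y₃)
                 {x x′ z z′ : Vect n} (x-inj : Injective x) (x′-inj : Injective x′)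
                 (x≡x′ : ∀ {i} → i ≢ q₃ → x′ i ≈ x i) (x≉x′ : ¬ x′ q₃ ≈ x q₃)
                 (norm : Normalised x z) (norm′ : Normalised x′ z′)
                 (w≢u : u ≢ w) (w≢v : v ≢ w) where

          -- The point q₃ already lies on `w` and has at most two lines, so two different lines
          -- other than `w` cannot meet there.
          off-q₃ : ∀ {y y′ q} → KLine y → KLine y′ → y ≢ y′ → y ≢ w → y′ ≢ w → q ∈ y → q ∈ y′ → q ≢ q₃
          off-q₃ y-line y′-line y≢y′ y≢w y′≢w q∈y q∈y′ ≡.refl =
            [ y≢y′ , [ y≢w , y′≢w ]′ ]′ (atMostTwo y-line y′-line w-line q∈y q∈y′ q₃∈w)

          Same : Subset n → Set
          Same y = ∃ λ a → ∃ λ b → Affine x z y a b × Affine x′ z′ y a b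

          -- The affine function on `w′` is determined by its values at two meeting points. Away
          -- from q₃ both positions have the same `x`, hence the same values there, hence the same
          -- coefficients.
          same-step : ∀ {w′ y₁ y₂ q₁ q₂} → KLine w′ → q₁ ≢ q₃ → q₂ ≢ q₃ → Same y₁ → Same y₂ → q₁ ≢ q₂ →
            q₁ ∈ w′ → q₂ ∈ w′ → q₁ ∈ y₁ → q₂ ∈ y₂ → Same w′
          same-step {w′} {y₁} {y₂} {q₁} {q₂} w′-line q₁≢q₃ q₂≢q₃ (a₁ , b₁ , h₁ , h₁′) (a₂ , b₂ , h₂ , h₂′) q₁≢q₂ q₁∈w′ q₂∈w′ q₁∈y₁ q₂∈y₂ =
            go (solves norm w′-line) (solves norm′ w′-line)
            where
            agree : ∀ {q a b a′ b′} → q ≢ q₃ → AffineAt x z a b q → AffineAt x′ z′ a b q → AffineAt x z a′ b′ q → AffineAt x′ z′ a′ b′ q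
            agree q≢q₃ h h′ k = trans h′ (trans (+-congʳ (*-congˡ (x≡x′ q≢q₃))) (trans (sym h) (trans k (+-congʳ (*-congˡ (sym (x≡x′ q≢q₃)))))))
            go : AffineOn x z w′ → AffineOn x′ z′ w′ → Same w′
            go (a , b , h) (a′ , b′ , h′) =
              let a≈ , b≈ = affine-determined x′ x′-inj {z′} {w′} q₁≢q₂ q₁∈w′ q₂∈w′ h′
                    (agree q₁≢q₃ (h₁ q₁∈y₁) (h₁′ q₁∈y₁) (h q₁∈w′)) (agree q₂≢q₃ (h₂ q₂∈y₂) (h₂′ q₂∈y₂) (h q₂∈w′))
              in a , b , h , affine-cong x′ x′-inj {z′} {w′} a≈ b≈ h′

          same-off : ∀ {y} → KLine y → y ≢ w → Same y
          same-off = generated-off {T = Same} (0# , 0# , on-u norm , on-u norm′)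
            (1# , - x o , on-v norm , affine-cong x′ x′-inj {z′} {v} refl (-‿cong (x≡x′ (off-q₃ u-line v-line u≢v w≢u w≢v o∈u o∈v))) (on-v norm′))
            λ {w′} {y₁} {y₂} w′-line (_ , w′≢w) y₁≢w′ (y₁-line , y₁≢w) T₁ y₂≢w′ (y₂-line , y₂≢w) T₂ q₁≢q₂ q₁∈w′ q₂∈w′ q₁∈y₁ q₂∈y₂ →
              same-step {w′} {y₁} {y₂} w′-line (off-q₃ y₁-line w′-line y₁≢w′ y₁≢w w′≢w q₁∈y₁ q₁∈w′) (off-q₃ y₂-line w′-line y₂≢w′ y₂≢w w′≢w q₂∈y₂ q₂∈w′)
                T₁ T₂ q₁≢q₂ q₁∈w′ q₂∈w′ q₁∈y₁ q₂∈y₂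

          same-w : Same w
          same-w = same-step {w} {y₁} {y₂} w-line (q₃≢q₁ ∘ ≡.sym) (q₃≢q₂ ∘ ≡.sym) (same-off y₁-line y₁≢w) (same-off y₂-line y₂≢w) q₁≢q₂ q₁∈w q₂∈w q₁∈y₁ q₂∈y₂

          -- x and x′ differ only at q₃, so z and z′ are given by the same affine
          -- functions off w, hence on w; those of w and y₃ agree at x q₃ and x′ q₃.
          perturbed-absurd : Data.Empty.⊥
          perturbed-absurd = go same-w (same-off y₃-line y₃≢w)
            where
            go : Same w → Same y₃ → Data.Empty.⊥
            go (a , b , h , h′) (c , d , k , k′) = not-affine {x} {z} x-inj norm (everywhere u-line , everywhere v-line)
              where
              at-x : a * x q₃ + b ≈ c * x q₃ + d
              at-x = trans (sym (h q₃∈w)) (k q₃∈y₃)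
              at-x′ : a * x′ q₃ + b ≈ c * x′ q₃ + d
              at-x′ = trans (sym (h′ q₃∈w)) (k′ q₃∈y₃)
              slopes : c ≈ a × d ≈ b
              slopes = affine-through-two (x q₃) (x′ q₃) (λ eq → x≉x′ (sym eq)) (sym at-x) (sym at-x′)
              everywhere : ∀ {ℓ} → KLine ℓ → Affine x z ℓ a b
              everywhere = merge x-inj {z} (solves norm) w-line y₃-line (y₃≢w ∘ ≡.sym) h (affine-cong x x-inj {z} {y₃} (proj₁ slopes) (proj₂ slopes) k)

      third-line-absurd : ∀ {t} → KLine t → t ≢ u → t ≢ v → Data.Empty.⊥
      third-line-absurd t-line t≢u t≢v = go (lastLine u-line v-line u≢v t-line t≢u t≢v)
        where
        go : LastLine u-line v-line u≢v → Data.Empty.⊥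
        go last = junction (third-junction w-line q₁≢q₂ q₁∈w q₂∈w y₁-line y₂-line y₁≢w y₂≢w q₁∈y₁ q₂∈y₂)
          where
          open LastLine last
          junction : ThirdJunction w-line q₁≢q₂ q₁∈w q₂∈w y₁-line y₂-line y₁≢w y₂≢w q₁∈y₁ q₂∈y₂ → Data.Empty.⊥
          junction (q₃ , q₃∈w , q₃≢q₁ , q₃≢q₂ , y₃ , y₃-line , y₃≢w , q₃∈y₃) =
            -- The new value at q₃ avoids all old ones: the perturbed position must remain injective
            -- and must really differ at q₃.
            fresh (eventually-witness (eventually-∀ (λ i → eventually-≉ (injection i))))
            where
            fresh : (∃ λ t → ∀ i → ¬ t ≈ injection i) → Data.Empty.⊥
            fresh (t , t-fresh) = finish (normalised injection injection-injective) (normalised x′ x′-inj)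
              where
              x′ : Vect n
              x′ i with i Finₚ.≟ q₃
              ... | yes _ = t
              ... | no _  = injection i
              x′-old : ∀ {i} → i ≢ q₃ → x′ i ≈ injection i
              x′-old {i} i≢q₃ with i Finₚ.≟ q₃
              ... | yes eq = ⊥-elim (i≢q₃ eq)
              ... | no _   = refl
              x′-new : x′ q₃ ≈ t
              x′-new with q₃ Finₚ.≟ q₃
              ... | yes _  = refl
              ... | no neq = ⊥-elim (neq ≡.refl)
              x′-inj : Injective x′
              x′-inj {i} {j} h = [ (λ { ≡.refl → [ (λ { ≡.refl → ≡.refl })
                    , (λ j≢ → ⊥-elim (t-fresh j (trans (sym x′-new) (trans h (x′-old j≢))))) ]′ (toSum (j Finₚ.≟ q₃)) })
                , (λ i≢ → [ (λ { ≡.refl → ⊥-elim (t-fresh i (trans (sym x′-new) (trans (sym h) (x′-old i≢)))) })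
                    , (λ j≢ → injection-injective (trans (sym (x′-old i≢)) (trans h (x′-old j≢)))) ]′ (toSum (j Finₚ.≟ q₃))) ]′ (toSum (i Finₚ.≟ q₃))
              finish : ∃ (Normalised injection) → ∃ (Normalised x′) → Data.Empty.⊥
              finish (z , norm) (z′ , norm′) = Perturbed.perturbed-absurd last q₃∈w q₃≢q₁ q₃≢q₂ y₃-line y₃≢w q₃∈y₃
                {injection} {x′} {z} {z′} injection-injective x′-inj x′-old (λ eq → t-fresh q₃ (trans (sym x′-new) eq)) norm norm′ u≢w v≢w

-- Connected components

module ComponentGraph (em : ∀ {P : Set} → Dec P) {n} (C : Configuration (⊤ {n})) where

  open Enumerations hiding (distinct)

  Connected : Fin n → Fin n → Set
  Connected = EqClosure (Adjacent C)

  step-line : ∀ {p q} → SymClosure (Adjacent C) p q → ∃ λ ℓ → Line C ℓ × p ∈ ℓ × q ∈ ℓ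
  step-line (fwd (_ , ℓ , line , p∈ , q∈ , _)) = ℓ , line , p∈ , q∈
  step-line (bwd (_ , ℓ , line , q∈ , p∈ , _)) = ℓ , line , p∈ , q∈

  -- Only consecutive points of a line are adjacent, so the segment from `p` to `q` is split at any
  -- point of the line in between. The `fuel` exceeds the distance of the indices.
  connected< : ∀ {ℓ} → Line C ℓ → ∀ fuel {p q} → toℕ q ℕ.< fuel ℕ.+ toℕ p → p Fin.< q → p ∈ ℓ → q ∈ ℓ → Connected p q
  connected< line zero q<p p<q _ _ = ⊥-elim (ℕₚ.<-asym q<p p<q)
  connected< {ℓ} line (suc fuel) {p} {q} bound p<q p∈ q∈ with em {∃ λ k → k ∈ ℓ × p Fin.< k × k Fin.< q}
  ... | no none = return (p<q , ℓ , line , p∈ , q∈ , λ k k∈ between → none (k , k∈ , between))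
  ... | yes (k , k∈ , p<k , k<q) = transitive (Adjacent C)
    (connected< line fuel (ℕₚ.<-≤-trans k<q (ℕ.s≤s⁻¹ bound)) p<k p∈ k∈)
    (connected< line fuel (ℕₚ.<-≤-trans bound (ℕₚ.≤-trans (ℕₚ.≤-reflexive (≡.sym (ℕₚ.+-suc fuel (toℕ p)))) (ℕₚ.+-monoʳ-≤ fuel p<k))) k<q k∈ q∈)

  line-connected : ∀ {ℓ p q} → Line C ℓ → p ∈ ℓ → q ∈ ℓ → Connected p q
  line-connected {p = p} {q} line p∈ q∈ with Finₚ.<-cmp p q
  ... | tri≈ _ ≡.refl _ = εˢ
  ... | tri< p<q _ _ = connected< line (suc (toℕ q)) (ℕₚ.m≤m+n (suc (toℕ q)) (toℕ p)) p<q p∈ q∈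
  ... | tri> _ _ q<p = symmetric (Adjacent C) (connected< line (suc (toℕ p)) (ℕₚ.m≤m+n (suc (toℕ p)) (toℕ q)) q<p q∈ p∈)

  line-through : ∀ {p q} → Connected p q → p ≢ q → ∃ λ ℓ → Line C ℓ × p ∈ ℓ
  line-through εˢ p≢p = ⊥-elim (p≢p ≡.refl)
  line-through (step ◅ _) _ = let ℓ , line , p∈ , _ = step-line step in ℓ , line , p∈

  -- The first edge of the path that leaves `u` has an endpoint off `u`. So the line carrying this
  -- edge differs from `u` and meets it at the other endpoint.
  leaving-line : ∀ {u p q} → Connected p q → p ∈ u → q ∉ u → ∃ λ o → ∃ λ v → Line C v × u ≢ v × o ∈ u × o ∈ v
  leaving-line εˢ p∈ p∉ = ⊥-elim (p∉ p∈)
  leaving-line {u} (_◅_ {j = x} step rest) p∈ q∉ with x Subsetₚ.∈? u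
  ... | yes x∈ = leaving-line rest x∈ q∉
  ... | no x∉ = let v , line , p∈v , x∈v = step-line step in
    _ , v , line , (λ { ≡.refl → x∉ x∈v }) , p∈ , p∈v

  module _ {ω} {comp : Fin ω → Subset n} (components : AreComponents C comp) where

    open AreComponents components

    ∈component⇒connected : ∀ {i p q} → p ∈ comp i → q ∈ comp i → Connected p q
    ∈component⇒connected {i} p∈ q∈ = let r , _ , char = isComponent i in
      transitive (Adjacent C) (symmetric (Adjacent C) (proj₂ (Equivalence.to (char _) p∈))) (proj₂ (Equivalence.to (char _) q∈))

    connected⇒∈component : ∀ {i p q} → p ∈ comp i → Connected p q → q ∈ comp i
    connected⇒∈component {i} p∈ pq = let r , _ , char = isComponent i in
      Equivalence.from (char _) (Subsetₚ.∈⊤ , transitive (Adjacent C) (proj₂ (Equivalence.to (char _) p∈)) pq)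

    component-unique : ∀ {i j p} → p ∈ comp i → p ∈ comp j → i ≡ j
    component-unique p∈i p∈j = distinct (Subsetₚ.⊆-antisym
      (λ q∈ → connected⇒∈component p∈j (∈component⇒connected p∈i q∈))
      (λ q∈ → connected⇒∈component p∈i (∈component⇒connected p∈j q∈)))

    component-of : ∀ p → ∃ λ i → p ∈ comp i
    component-of p = go (complete (p , Subsetₚ.∈⊤ , λ q → mk⇔ (λ q∈ → Subsetₚ.∈⊤ , ∈subset⁻ em {P = Connected p} q∈)
                                                             (λ (_ , pq) → ∈subset⁺ em {P = Connected p} pq)))
      where
      go : (∃ λ i → comp i ≡ subset em (Connected p)) → ∃ λ i → p ∈ comp i
      go (i , eq) = i , ≡.subst (p ∈_) (≡.sym eq) (∈subset⁺ em {P = Connected p} εˢ)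

    line⊆component : ∀ {ℓ i p} → Line C ℓ → p ∈ ℓ → p ∈ comp i → ℓ ⊆ comp i
    line⊆component line p∈ p∈i q∈ = connected⇒∈component p∈i (line-connected line p∈ q∈)

-- Solutions on the whole configuration

module GlobalSolutions (F : ClassicalField) {n ω} (C : Configuration (⊤ {n})) (C-linear : Linear C)
  (comp : Fin ω → Subset n) (components : AreComponents C comp)
  (matroids : ∀ i → Σ (Matroid (comp i)) λ M → Geometry.Maximal (LinearAlgebra.rawRing F) M × subconfiguration C (comp i) ≐ configuration M) where

  open LinearAlgebra F
  open Enumerations
  open AffineFunctions F
  open ComponentGraph em C
  open VectorMatroid F using (combination-δ∘)

  module Component (i : Fin ω) = ComponentSolutions F C C-linear (comp i) (proj₁ (matroids i)) (proj₁ (proj₂ (matroids i))) (proj₂ (proj₂ (matroids i)))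

  OnCommonLine : Fin n → Fin n → Fin n → Set
  OnCommonLine p q r = ∃ λ ℓ → Line C ℓ × p ∈ ℓ × q ∈ ℓ × r ∈ ℓ

  component-line : ∀ {ℓ i p} → Line C ℓ → p ∈ ℓ → p ∈ comp i → Component.KLine i ℓ
  component-line line p∈ p∈i = line , line⊆component components line p∈ p∈i

  line-component : ∀ {ℓ} → Line C ℓ → ∃ λ i → Component.KLine i ℓ
  line-component {ℓ} line = go (some-point (Linear.two-points C-linear line))
    where
    some-point : 2 ℕ.≤ ∣ ℓ ∣ → ∃ λ p → p ∈ ℓ
    some-point 2≤ = go′ (enumerate ℓ) 2≤
      where
      go′ : ∀ {k} → (∃ λ (e : Fin k → Fin n) → Enumeration e ℓ) → 2 ℕ.≤ k → ∃ λ p → p ∈ ℓ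
      go′ (e , en) (ℕ.s≤s _) = e zero , member en zero
    go : (∃ λ p → p ∈ ℓ) → ∃ λ i → Component.KLine i ℓ
    go (p , p∈) = let i , p∈i = component-of components p in i , component-line line p∈ p∈i

  -- Linearity only grants two points. The third comes from the component of the line, where lines
  -- are rank-two flats of size at least three.
  3≤line : ∀ {ℓ} → Line C ℓ → 3 ℕ.≤ ∣ ℓ ∣
  3≤line line = let i , kline = line-component line in Component.KLine⇒3≤ i kline

  -- A component has rank three and so more than one point; a path from `p` to another point starts
  -- along a line through `p`.
  covered : ∀ {i p} → p ∈ comp i → ∃ λ ℓ → Component.KLine i ℓ × p ∈ ℓ
  covered {i} {p} p∈ = go (Component.noncollinear-triple i)
    where
    other-point : (∃ λ q → q ∈ comp i × p ≢ q) → ∃ λ ℓ → Component.KLine i ℓ × p ∈ ℓ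
    other-point (q , q∈ , p≢q) = let ℓ , line , p∈ℓ = line-through (∈component⇒connected components p∈ q∈) p≢q in
      ℓ , component-line line p∈ℓ p∈ , p∈ℓ
    go : (∃ λ a → ∃ λ b → ∃ λ c → Distinct₃ a b c × a ∈ comp i × b ∈ comp i × c ∈ comp i × ¬ Component.Collinear i a b c) → _
    go (a , b , _ , d , a∈ , b∈ , _) with p Finₚ.≟ a
    ... | no p≢a     = other-point (a , a∈ , p≢a)
    ... | yes ≡.refl = other-point (b , b∈ , Distinct₃.p≢q d)

  record Crossing (i : Fin ω) : Set where
    field
      {u v}  : Subset n
      {o}    : Fin n
      u-line : Component.KLine i u
      v-line : Component.KLine i v
      u≢v    : u ≢ v
      o∈u    : o ∈ u
      o∈v    : o ∈ v

  -- A line through one point of a non-collinear triple misses another of its points. A path inside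
  -- the component to that point has to leave the line along a second one.
  crossing : ∀ i → Crossing i
  crossing i = go (Component.noncollinear-triple i)
    where
    go : (∃ λ a → ∃ λ b → ∃ λ c → Distinct₃ a b c × a ∈ comp i × b ∈ comp i × c ∈ comp i × ¬ Component.Collinear i a b c) → Crossing i
    go (a , b , c , d , a∈ , b∈ , c∈ , non) = go′ (covered a∈)
      where
      go′ : (∃ λ ℓ → Component.KLine i ℓ × a ∈ ℓ) → Crossing i
      go′ (u , u-line , a∈u) = leave point-off-u
        where
        point-off-u : ∃ λ q → q ∈ comp i × q ∉ u
        point-off-u with b Subsetₚ.∈? u | c Subsetₚ.∈? u
        ... | no b∉   | _       = b , b∈ , b∉
        ... | yes _   | no c∉   = c , c∈ , c∉
        ... | yes b∈u | yes c∈u = ⊥-elim (non (u , u-line , a∈u , b∈u , c∈u))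
        leave : (∃ λ q → q ∈ comp i × q ∉ u) → Crossing i
        leave (q , q∈ , q∉) = go″ (leaving-line (∈component⇒connected components a∈ q∈) a∈u q∉)
          where
          go″ : (∃ λ o → ∃ λ v → Line C v × u ≢ v × o ∈ u × o ∈ v) → Crossing i
          go″ (o , v , v-line , u≢v , o∈u , o∈v) = record
            { u-line = u-line ; v-line = component-line v-line o∈v (proj₂ u-line o∈u) ; u≢v = u≢v ; o∈u = o∈u ; o∈v = o∈v }

  solution⇒Solves : ∀ {x z} → Injective x → Solution C x z → ∀ i → Component.Solves i x z
  solution⇒Solves {x} {z} x-inj sol i line = solution⇒affineLines C x x-inj {z} sol (proj₁ line) (Component.KLine⇒3≤ i line)

  LargeSolutionSpace : Vect n → Set
  LargeSolutionSpace x = ∃ λ d → HasDimension (Solution C x) d × 3 ℕ.* ω ℕ.≤ d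

  independent-subfamily : ∀ {m k l} (b : Fin l → Vect m) (f : Fin k → Fin l) → (∀ {i j} → f i ≡ f j → i ≡ j) →
    LinearlyIndependent b → LinearlyIndependent (b ∘ f)
  independent-subfamily b f f-inj ind c h i = trans (sym (trans
      (sum-single (λ j → c j * δ (f j) (f i)) i (λ j j≢i → trans (*-congˡ (δ-off (j≢i ∘ f-inj))) (zeroʳ _)))
      (trans (*-congˡ (δ-diagonal (f i))) (*-identityʳ _))))
    (ind (combination c (δ ∘ f)) (λ j → trans (combination-δ∘ {e = f} c b j) (h j)) (f i))

  record Frame (i : Fin ω) : Set where
    field
      cross : Crossing i
      {p r} : Fin n
    open Crossing cross public
    field
      p∈u : p ∈ u
      p≢o : p ≢ o
      r∈v : r ∈ v
      r≢o : r ≢ o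

  frame : ∀ i → Frame i
  frame i = go (crossing i)
    where
    go : Crossing i → Frame i
    go cross = record { cross = cross
        ; p∈u = proj₁ (proj₂ third-u) ; p≢o = proj₁ (proj₂ (proj₂ third-u))
        ; r∈v = proj₁ (proj₂ third-v) ; r≢o = proj₁ (proj₂ (proj₂ third-v)) }
      where
      open Crossing cross
      third-u = third (Component.KLine⇒3≤ i u-line) o o
      third-v = third (Component.KLine⇒3≤ i v-line) o o

  module _ {x : Vect n} (x-inj : Injective x) where

    module _ {z : Vect n} (sol : Solution C x z) {i : Fin ω} where

      affine-by-two : ∀ {ℓ p q a b} → Component.KLine i ℓ → p ≢ q → p ∈ ℓ → q ∈ ℓ → AffineAt x z a b p → AffineAt x z a b q → Affine x z ℓ a b
      affine-by-two {ℓ} {p} {q} {a} {b} line p≢q p∈ q∈ hp hq = go (solution⇒Solves {x} {z} x-inj sol i line)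
        where
        go : (∃ λ a → ∃ λ b → Affine x z ℓ a b) → Affine x z ℓ a b
        go (a′ , b′ , h) = let a≈ , b≈ = affine-determined x x-inj {z} {ℓ} p≢q p∈ q∈ h hp hq in affine-cong x x-inj {z} {ℓ} a≈ b≈ h

      affine-on-component : ∀ {u v a b} → Component.KLine i u → Component.KLine i v → u ≢ v → Affine x z u a b → Affine x z v a b →
        Affine x z (comp i) a b
      affine-on-component {u} {v} {a} {b} u-line v-line u≢v hu hv {p} p∈ = go (covered p∈)
        where
        go : (∃ λ ℓ → Component.KLine i ℓ × p ∈ ℓ) → AffineAt x z a b p
        go (ℓ , line , p∈ℓ) = Component.merge i x-inj {z} (solution⇒Solves {x} {z} x-inj sol i) u-line v-line u≢v hu hv line p∈ℓ

    zero-at : ∀ {z i} → z i ≈ 0# → AffineAt x z 0# 0# i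
    zero-at {i = i} h = trans h (sym (trans (+-identityʳ _) (zeroˡ (x i))))

    module Evaluation (fr : ∀ i → Frame i) where

      module Fr i = Frame (fr i)

      point : Fin 3 → Fin ω → Fin n
      point zero             i = Fr.o i
      point (suc zero)       i = Fr.p i
      point (suc (suc zero)) i = Fr.r i

      evaluation : Fin (3 ℕ.* ω) → Fin n
      evaluation t = point (proj₁ (remQuot {3} ω t)) (proj₂ (remQuot {3} ω t))

      evaluation-combine : ∀ k i → evaluation (combine k i) ≡ point k i
      evaluation-combine k i = ≡.cong (λ (k , i) → point k i) (Finₚ.remQuot-combine {3} {ω} k i)

      vanishing : ∀ {z} → Solution C x z → (∀ t → z (evaluation t) ≈ 0#) → z ≋ 𝟎
      vanishing {z} sol h q = go (component-of components q)
        where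
        at : ∀ k i → AffineAt x z 0# 0# (point k i)
        at k i = zero-at {z} (trans (reflexive (≡.cong z (≡.sym (evaluation-combine k i)))) (h (combine k i)))
        go : (∃ λ i → q ∈ comp i) → z q ≈ 0#
        go (i , q∈) = trans (affine-on-component {z} sol (Fr.u-line i) (Fr.v-line i) (Fr.u≢v i)
            (affine-by-two {z} sol {i} (Fr.u-line i) (Fr.p≢o i) (Fr.p∈u i) (Fr.o∈u i) (at (suc zero) i) (at zero i))
            (affine-by-two {z} sol {i} (Fr.v-line i) (Fr.r≢o i) (Fr.r∈v i) (Fr.o∈v i) (at (suc (suc zero)) i) (at zero i)) q∈)
          (trans (+-identityʳ _) (zeroˡ (x q)))

      -- A solution is determined by its values at three points of each
      -- component, so these values are arbitrary if the solution space
      -- has dimension at least 3ω.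
      prescribed : LargeSolutionSpace x → ∀ y → ∃ λ z → Solution C x z × ∀ t → z (evaluation t) ≈ y t
      prescribed (d , (b , b∈ , b-ind , _) , 3ω≤d) y = go (square⇒spanning values values-independent y)
        where
        b′ : Fin (3 ℕ.* ω) → Vect n
        b′ t = b (inject≤ t 3ω≤d)
        values : Fin (3 ℕ.* ω) → Vect (3 ℕ.* ω)
        values t s = b′ t (evaluation s)
        b′∈ : ∀ c → Solution C x (combination c b′)
        b′∈ = combination∈ (solution-subspace C x) b′ (λ t → b∈ (inject≤ t 3ω≤d))
        values-independent : LinearlyIndependent values
        values-independent c h = independent-subfamily b (λ t → inject≤ t 3ω≤d) (Finₚ.inject≤-injective 3ω≤d 3ω≤d _ _) b-ind c
          (vanishing {combination c b′} (b′∈ c) h)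
        go : InSpan values y → ∃ λ z → Solution C x z × ∀ t → z (evaluation t) ≈ y t
        go (c , y≋) = combination c b′ , b′∈ c , λ t → sym (y≋ t)

      normalised-solution : LargeSolutionSpace x → ∀ i →
        ∃ (Component.ThirdLine.Normalised i (Fr.u-line i) (Fr.v-line i) (Fr.u≢v i) (Fr.o∈u i) (Fr.o∈v i) x)
      normalised-solution large i = go (prescribed large y)
        where
        -- These are the values at o, p and r of the function that is 0 on `u` and x - x o on `v`;
        -- both parts vanish at the crossing o.
        value : Fin 3 → Fin ω → Carrier
        value (suc (suc zero)) j = x (Fr.r j) - x (Fr.o j)
        value _                j = 0#
        y : Vect (3 ℕ.* ω)
        y t = value (proj₁ (remQuot {3} ω t)) (proj₂ (remQuot {3} ω t))
        go : (∃ λ z → Solution C x z × ∀ t → z (evaluation t) ≈ y t) → _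
        go (z , sol , h) = z , record
          { solves = solution⇒Solves {x} {z} x-inj sol i
          ; on-u   = affine-by-two {z} sol {i} (Fr.u-line i) (Fr.p≢o i) (Fr.p∈u i) (Fr.o∈u i) (zero-at {z} (at (suc zero))) (zero-at {z} (at zero))
          ; on-v   = affine-by-two {z} sol {i} (Fr.v-line i) (Fr.r≢o i) (Fr.r∈v i) (Fr.o∈v i)
              (trans (at (suc (suc zero))) (+-congʳ (sym (*-identityˡ _))))
              (trans (at zero) (sym (trans (+-congʳ (*-identityˡ _)) (x-x≈0 _))))
          }
          where
          at : ∀ k → z (point k i) ≈ value k i
          at k = trans (reflexive (≡.cong z (≡.sym (evaluation-combine k i))))
            (trans (h (combine k i)) (reflexive (≡.cong (λ (k , i) → value k i) (Finₚ.remQuot-combine {3} {ω} k i))))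

  TwoLines : (∀ i → Frame i) → Set
  TwoLines fr = ∀ i {t} → Component.KLine i t → t ≡ Frame.u (fr i) ⊎ t ≡ Frame.v (fr i)

  large⇒twoLines : (∀ x → Injective x → LargeSolutionSpace x) → ∀ fr → TwoLines fr
  large⇒twoLines large fr i {t} t-line = decidable-stable em λ neither →
    Component.ThirdLine.third-line-absurd i u-line v-line u≢v o∈u o∈v
      (λ x x-inj → Evaluation.normalised-solution x-inj fr (large x x-inj) i) t-line (neither ∘ inj₁) (neither ∘ inj₂)
    where open Frame (fr i)

  restrict : Subset n → Vect n → Vect n
  restrict S f p with p Subsetₚ.∈? S
  ... | yes _ = f p
  ... | no _  = 0#

  restrict-∈ : ∀ {S f p} → p ∈ S → restrict S f p ≈ f p
  restrict-∈ {S} {f} {p} p∈ with p Subsetₚ.∈? S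
  ... | yes _ = refl
  ... | no p∉ = ⊥-elim (p∉ p∈)

  restrict-∉ : ∀ {S f p} → p ∉ S → restrict S f p ≈ 0#
  restrict-∉ {S} {f} {p} p∉ with p Subsetₚ.∈? S
  ... | yes p∈ = ⊥-elim (p∉ p∈)
  ... | no _   = refl

  module GenericSolution (fr : ∀ i → Frame i) (two-lines : TwoLines fr) {x : Vect n} (x-inj : Injective x) where

    lone⇒area≉0 : ∀ {z a b c} → a ≢ b → z a ≈ 0# → z b ≈ 0# → ¬ z c ≈ 0# → ¬ area x z a b c ≈ 0#
    lone⇒area≉0 {z} {a} {b} {c} a≢b za zb zc h = zc (trans
      (area≈0⇒affine x x-inj {z} {0#} {0#} {a} {b} {c} a≢b (zero-at x-inj {z} za) (zero-at x-inj {z} zb) h)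
      (trans (+-identityʳ _) (zeroˡ (x c))))

    indicator : Fin ω → Vect n
    indicator i = restrict (comp i) (λ _ → 1#)

    indicator-solution : ∀ i → Solution C x (indicator i)
    indicator-solution i = affineLines⇒solution C x {indicator i} λ line → go (line-component line)
      where
      go : ∀ {ℓ} → (∃ λ j → Component.KLine j ℓ) → ∃ λ a → ∃ λ b → Affine x (indicator i) ℓ a b
      go (j , kline) = [ (λ { ≡.refl → 0# , 1# , λ {q} q∈ → trans (restrict-∈ (proj₂ kline q∈)) (sym (trans (+-congʳ (zeroˡ (x q))) (+-identityˡ 1#))) })
        , (λ i≢j → 0# , 0# , λ {q} q∈ → zero-at x-inj {indicator i} (restrict-∉ (λ q∈i → i≢j (component-unique components q∈i (proj₂ kline q∈))))) ]′ (toSum (i Finₚ.≟ j))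

    -- The function is cut off at the point `o`, where x - x o vanishes, so it also vanishes on any
    -- line that meets `ℓ` exactly there.
    bump : Subset n → Fin n → Vect n
    bump ℓ o = restrict ℓ (λ p → x p - x o)

    bump-other : ∀ {i ℓ ℓ′ o p} → Component.KLine i ℓ → Component.KLine i ℓ′ → ℓ ≢ ℓ′ → o ∈ ℓ → o ∈ ℓ′ → p ∈ ℓ → bump ℓ′ o p ≈ 0#
    bump-other {i} {ℓ} {ℓ′} {o} {p} line line′ ℓ≢ℓ′ o∈ℓ o∈ℓ′ p∈ℓ =
      [ (λ { ≡.refl → trans (restrict-∈ o∈ℓ′) (x-x≈0 (x o)) })
      , (λ p≢o → restrict-∉ (λ p∈ℓ′ → ℓ≢ℓ′ (Component.unique i p≢o line line′ p∈ℓ o∈ℓ p∈ℓ′ o∈ℓ′))) ]′ (toSum (p Finₚ.≟ o))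

    -- On a further line through another point of `ℓ′` the bump would be nonzero at that point alone
    -- and hence not affine. The assumption `only` rules such lines out.
    bump-solution : ∀ {i ℓ ℓ′ o} → Component.KLine i ℓ → Component.KLine i ℓ′ → ℓ ≢ ℓ′ → o ∈ ℓ → o ∈ ℓ′ →
      (∀ {t} → Component.KLine i t → t ≡ ℓ ⊎ t ≡ ℓ′) → Solution C x (bump ℓ′ o)
    bump-solution {i} {ℓ} {ℓ′} {o} line line′ ℓ≢ℓ′ o∈ℓ o∈ℓ′ only = affineLines⇒solution C x {bump ℓ′ o} λ t-line → go (line-component t-line)
      where
      go : ∀ {t} → (∃ λ j → Component.KLine j t) → ∃ λ a → ∃ λ b → Affine x (bump ℓ′ o) t a b
      go (j , kline) = [ (λ { ≡.refl → [ (λ { ≡.refl → 0# , 0# , λ q∈ → zero-at x-inj {bump ℓ′ o} (bump-other line line′ ℓ≢ℓ′ o∈ℓ o∈ℓ′ q∈) })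
                           , (λ { ≡.refl → 1# , - x o , λ q∈ → trans (restrict-∈ q∈) (+-congʳ (sym (*-identityˡ _))) }) ]′ (only kline) })
        , (λ i≢j → 0# , 0# , λ q∈ → zero-at x-inj {bump ℓ′ o} (restrict-∉ (λ q∈ℓ′ → i≢j (component-unique components (proj₂ line′ q∈ℓ′) (proj₂ kline q∈))))) ]′ (toSum (i Finₚ.≟ j))

    Separated : Fin n → Fin n → Fin n → Set
    Separated a b c = ∃ λ z → Solution C x z × ¬ area x z a b c ≈ 0#

    separated-swap₂₃ : ∀ {a b c} → Separated a b c → Separated a c b
    separated-swap₂₃ {a} {b} {c} (z , sol , h) = z , sol , h ∘ area-swap₂₃ x z a b c

    separated-swap₁₂ : ∀ {a b c} → Separated a b c → Separated b a c
    separated-swap₁₂ {a} {b} {c} (z , sol , h) = z , sol , h ∘ area-swap₁₂ x z a b c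

    lone-component : ∀ {a b c i j k} → a ≢ b → a ∈ comp i → b ∈ comp j → c ∈ comp k → i ≢ k → j ≢ k → Separated a b c
    lone-component {k = k} a≢b a∈ b∈ c∈ i≢k j≢k = indicator k , indicator-solution k , lone⇒area≉0 {indicator k} a≢b
      (restrict-∉ (λ a∈k → i≢k (component-unique components a∈ a∈k))) (restrict-∉ (λ b∈k → j≢k (component-unique components b∈ b∈k)))
      (λ h → 0≉1 (trans (sym h) (restrict-∈ c∈)))

    lone-on-line : ∀ {i ℓ ℓ′ o a b c} → Component.KLine i ℓ → Component.KLine i ℓ′ → ℓ ≢ ℓ′ → o ∈ ℓ → o ∈ ℓ′ →
      (∀ {t} → Component.KLine i t → t ≡ ℓ ⊎ t ≡ ℓ′) → a ≢ b → a ∈ ℓ → b ∈ ℓ → c ∈ ℓ′ → c ∉ ℓ → Separated a b c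
    lone-on-line {i} {ℓ} {ℓ′} {o} {a} {b} {c} line line′ ℓ≢ℓ′ o∈ℓ o∈ℓ′ only a≢b a∈ b∈ c∈ c∉ =
      bump ℓ′ o , bump-solution line line′ ℓ≢ℓ′ o∈ℓ o∈ℓ′ only , lone⇒area≉0 {bump ℓ′ o} a≢b
        (bump-other line line′ ℓ≢ℓ′ o∈ℓ o∈ℓ′ a∈) (bump-other line line′ ℓ≢ℓ′ o∈ℓ o∈ℓ′ b∈)
        (λ h → x-≉0 x x-inj (∈∉⇒≢ o∈ℓ c∉ ∘ ≡.sym) (trans (sym (restrict-∈ c∈)) h))

    separated-in-component : ∀ {i a b c} → Distinct₃ a b c → a ∈ comp i → b ∈ comp i → c ∈ comp i → ¬ OnCommonLine a b c → Separated a b c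
    separated-in-component {i} {a} {b} {c} d a∈ b∈ c∈ non = go (side a∈) (side b∈) (side c∈)
      where
      open Frame (fr i)
      open Distinct₃ d
      Side : Fin n → Set
      Side p = p ∈ u ⊎ p ∈ v
      side : ∀ {p} → p ∈ comp i → Side p
      side p∈ = go′ (covered p∈)
        where
        go′ : ∀ {p} → (∃ λ ℓ → Component.KLine i ℓ × p ∈ ℓ) → Side p
        go′ (ℓ , line , p∈ℓ) = Data.Sum.map (λ { ≡.refl → p∈ℓ }) (λ { ≡.refl → p∈ℓ }) (two-lines i line)
      on-u : ∀ {a b c} → a ≢ b → ¬ OnCommonLine a b c → a ∈ u → b ∈ u → c ∈ v → Separated a b c
      on-u a≢b non a∈ b∈ c∈ = lone-on-line u-line v-line u≢v o∈u o∈v (two-lines i) a≢b a∈ b∈ c∈ (λ c∈u → non (u , proj₁ u-line , a∈ , b∈ , c∈u))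
      on-v : ∀ {a b c} → a ≢ b → ¬ OnCommonLine a b c → a ∈ v → b ∈ v → c ∈ u → Separated a b c
      on-v a≢b non a∈ b∈ c∈ = lone-on-line v-line u-line (u≢v ∘ ≡.sym) o∈v o∈u (λ line → Data.Sum.swap (two-lines i line)) a≢b a∈ b∈ c∈
        (λ c∈v → non (v , proj₁ v-line , a∈ , b∈ , c∈v))
      non₁ : ¬ OnCommonLine a c b
      non₁ (ℓ , line , a∈ , c∈ , b∈) = non (ℓ , line , a∈ , b∈ , c∈)
      non₂ : ¬ OnCommonLine b c a
      non₂ (ℓ , line , b∈ , c∈ , a∈) = non (ℓ , line , a∈ , b∈ , c∈)
      go : Side a → Side b → Side c → Separated a b c
      go (inj₁ a) (inj₁ b) (inj₁ c) = ⊥-elim (non (u , proj₁ u-line , a , b , c))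
      go (inj₂ a) (inj₂ b) (inj₂ c) = ⊥-elim (non (v , proj₁ v-line , a , b , c))
      go (inj₁ a) (inj₁ b) (inj₂ c) = on-u p≢q non a b c
      go (inj₂ a) (inj₂ b) (inj₁ c) = on-v p≢q non a b c
      go (inj₁ a) (inj₂ b) (inj₁ c) = separated-swap₂₃ (on-u p≢r non₁ a c b)
      go (inj₂ a) (inj₁ b) (inj₂ c) = separated-swap₂₃ (on-v p≢r non₁ a c b)
      go (inj₂ a) (inj₁ b) (inj₁ c) = separated-swap₁₂ (separated-swap₂₃ (on-u q≢r non₂ b c a))
      go (inj₁ a) (inj₂ b) (inj₂ c) = separated-swap₁₂ (separated-swap₂₃ (on-v q≢r non₂ b c a))

    -- Either the three points share a component, or some component contains exactly one of them and
    -- its indicator separates the triple.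
    separated : ∀ {a b c} → Distinct₃ a b c → ¬ OnCommonLine a b c → Separated a b c
    separated {a} {b} {c} d non = go (component-of components a) (component-of components b) (component-of components c)
      where
      open Distinct₃ d
      go : (∃ λ i → a ∈ comp i) → (∃ λ i → b ∈ comp i) → (∃ λ i → c ∈ comp i) → Separated a b c
      go (i , a∈) (j , b∈) (k , c∈) =
        [ (λ { ≡.refl → [ (λ { ≡.refl → separated-in-component d a∈ b∈ c∈ non }) , (λ i≢k → lone-component p≢q a∈ b∈ c∈ i≢k i≢k) ]′ (toSum (i Finₚ.≟ k)) })
        , (λ i≢j → [ (λ { ≡.refl → separated-swap₂₃ (lone-component p≢r a∈ c∈ b∈ i≢j i≢j) })
            , (λ i≢k → separated-swap₁₂ (separated-swap₂₃ (lone-component q≢r b∈ c∈ a∈ (i≢j ∘ ≡.sym) (i≢k ∘ ≡.sym)))) ]′ (toSum (i Finₚ.≟ k))) ]′ (toSum (i Finₚ.≟ j))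

    generic-solution : ∃ λ z → Solution C x z × ∀ {a b c} → Distinct₃ a b c → ¬ OnCommonLine a b c → ¬ area x z a b c ≈ 0#
    generic-solution = go (common-nonzero (solution-subspace C x) φ linear H λ t (d , non) → separated d non)
      where
      decode : Fin (n ℕ.* (n ℕ.* n)) → Fin n × Fin n × Fin n
      decode t = proj₁ (remQuot {n} (n ℕ.* n) t) , remQuot {n} n (proj₂ (remQuot {n} (n ℕ.* n) t))
      encode : Fin n → Fin n → Fin n → Fin (n ℕ.* (n ℕ.* n))
      encode a b c = combine a (combine b c)
      decode-encode : ∀ a b c → decode (encode a b c) ≡ (a , b , c)
      decode-encode a b c = ≡.trans
        (≡.cong (λ (a , s) → a , remQuot {n} n s) (Finₚ.remQuot-combine {n} a (combine b c)))
        (≡.cong (a ,_) (Finₚ.remQuot-combine {n} b c))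
      φ′ : Fin n × Fin n × Fin n → Vect n → Carrier
      φ′ (a , b , c) z = area x z a b c
      H′ : Fin n × Fin n × Fin n → Set
      H′ (a , b , c) = Distinct₃ a b c × ¬ OnCommonLine a b c
      φ = φ′ ∘ decode
      H = H′ ∘ decode
      linear : ∀ t a v w → φ t (λ j → a * v j + w j) ≈ a * φ t v + φ t w
      linear t = area-linear x (proj₁ (decode t)) (proj₁ (proj₂ (decode t))) (proj₂ (proj₂ (decode t)))
      go : (∃ λ z → Solution C x z × ∀ t → H t → ¬ φ t z ≈ 0#) → _
      go (z , sol , h) = z , sol , λ {a} {b} {c} d non →
        ≡.subst (λ s → H′ s → ¬ φ′ s z ≈ 0#) (decode-encode a b c) (h (encode a b c)) (d , non)

-- Projections

module ProjectiveLift (F : ClassicalField) where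

  open LinearAlgebra F
  open Enumerations
  open AffineFunctions F
  open Solver using (solve; _:=_; _:+_; _:-_; _:*_; :-_)

  0F 1F 2F : Fin 3
  0F = zero
  1F = suc zero
  2F = suc (suc zero)

  scale : Carrier → Vect 3 → Vect 3
  scale a v j = a * v j

  ·-scale : ∀ g a (v : Vect 3) → g · scale a v ≈ a * (g · v)
  ·-scale g a v = trans (sum-cong-≋ (λ j → solve 3 (λ g a v → g :* (a :* v) := a :* (g :* v)) refl (g j) a (v j)))
    (sym (*-distribˡ-sum a (λ j → g j * v j)))

  represents-· : ∀ {v p} g → v represents p → g · coord p ≈ 0# → g · v ≈ 0#
  represents-· {v} {p} g (a , _ , v≋) h = trans (·-cong {v = g} (λ _ → refl) v≋) (trans (·-scale g a (coord p)) (trans (*-congˡ h) (zeroʳ a)))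

  ·-represents : ∀ {v p} g → v represents p → g · v ≈ 0# → g · coord p ≈ 0#
  ·-represents {v} {p} g (a , a≉0 , v≋) h = *≈0⇒≈0 a≉0 (trans (sym (·-scale g a (coord p))) (trans (·-cong {v = g} (λ _ → refl) (λ j → sym (v≋ j))) h))

  inverse≉0 : ∀ {a u} → a * u ≈ 1# → ¬ u ≈ 0#
  inverse≉0 {a} au≈1 u≈0 = 0≉1 (trans (sym (trans (*-congˡ u≈0) (zeroʳ a))) au≈1)

  represent-same⇒∼ : ∀ {v w p q} → v ≋ w → v represents p → w represents q → p ∼ q
  represent-same⇒∼ {v} {w} {p} {q} v≋w (a , a≉0 , v≋) (b , b≉0 , w≋) = go (inverse a a≉0)
    where
    go : (∃ λ u → a * u ≈ 1#) → p ∼ q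
    go (u , au≈1) = u * b , *≉0 (inverse≉0 au≈1) b≉0 , λ j → trans (sym (trans (*-congʳ au≈1) (*-identityˡ (coord p j))))
      (trans (solve 3 (λ a u p → (a :* u) :* p := u :* (a :* p)) refl a u (coord p j))
        (trans (*-congˡ (trans (sym (v≋ j)) (trans (v≋w j) (w≋ j)))) (sym (*-assoc u b (coord q j)))))

  module Basis (E : Fin 3 → Vect 3) (E-independent : LinearlyIndependent E) where

    combo : Carrier → Carrier → Carrier → Vect 3
    combo a b c j = a * E 0F j + (b * E 1F j + c * E 2F j)

    combo-injective : ∀ {a b c} → combo a b c ≋ 𝟎 → a ≈ 0# × b ≈ 0# × c ≈ 0#
    combo-injective {a} {b} {c} h = let z = E-independent (a ∷ b ∷ λ _ → c) (λ j → trans (+-congˡ (+-congˡ (+-identityʳ _))) (h j)) in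
      z 0F , z 1F , z 2F

    combo-cong : ∀ {a b c a′ b′ c′} → a ≈ a′ → b ≈ b′ → c ≈ c′ → combo a b c ≋ combo a′ b′ c′
    combo-cong ha hb hc j = +-cong (*-congʳ ha) (+-cong (*-congʳ hb) (*-congʳ hc))

    combo-scale : ∀ t a b c → scale t (combo a b c) ≋ combo (t * a) (t * b) (t * c)
    combo-scale t a b c j = solve 7 (λ t a b c p q r → t :* (a :* p :+ (b :* q :+ c :* r)) := (t :* a) :* p :+ ((t :* b) :* q :+ (t :* c) :* r))
      refl t a b c (E 0F j) (E 1F j) (E 2F j)

    combo-difference : ∀ a b c a′ b′ c′ → (λ j → combo a b c j - combo a′ b′ c′ j) ≋ combo (a - a′) (b - b′) (c - c′)
    combo-difference a b c a′ b′ c′ j = solve 9 (λ a b c a′ b′ c′ p q r →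
      (a :* p :+ (b :* q :+ c :* r)) :- (a′ :* p :+ (b′ :* q :+ c′ :* r)) := (a :- a′) :* p :+ ((b :- b′) :* q :+ (c :- c′) :* r))
      refl a b c a′ b′ c′ (E 0F j) (E 1F j) (E 2F j)

    combo-unique : ∀ {a b c a′ b′ c′} → combo a b c ≋ combo a′ b′ c′ → a ≈ a′ × b ≈ b′ × c ≈ c′
    combo-unique {a} {b} {c} {a′} {b′} {c′} h =
      let p , q , r = combo-injective (λ j → trans (sym (combo-difference a b c a′ b′ c′ j)) (≈⇒-≈0 (h j))) in -≈0⇒≈ p , -≈0⇒≈ q , -≈0⇒≈ r

    combo-spans : ∀ v → ∃ λ a → ∃ λ b → ∃ λ c → v ≋ combo a b c
    combo-spans v = go (square⇒spanning E E-independent v)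
      where
      go : InSpan E v → ∃ λ a → ∃ λ b → ∃ λ c → v ≋ combo a b c
      go (d , v≋) = d 0F , d 1F , d 2F , λ j → trans (v≋ j) (+-congˡ (+-congˡ (+-identityʳ _)))

    ·-combo : ∀ g a b c → g · combo a b c ≈ a * (g · E 0F) + (b * (g · E 1F) + c * (g · E 2F))
    ·-combo g a b c = trans (·-step g a (E 0F) (λ j → b * E 1F j + c * E 2F j)) (+-congˡ (trans (·-step g b (E 1F) (scale c (E 2F))) (+-congˡ (·-scale g c (E 2F)))))

    zero-form : ∀ g → g · E 0F ≈ 0# → g · E 1F ≈ 0# → g · E 2F ≈ 0# → g ≋ 𝟎
    zero-form g h₀ h₁ h₂ j = go (combo-spans (δ j))
      where
      go : (∃ λ a → ∃ λ b → ∃ λ c → δ j ≋ combo a b c) → g j ≈ 0#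
      go (a , b , c , δ≋) = trans (sym (·-δ g j)) (trans (·-cong {v = g} (λ _ → refl) δ≋) (trans (·-combo g a b c)
        (trans (+-cong (trans (*-congˡ h₀) (zeroʳ a)) (trans (+-cong (trans (*-congˡ h₁) (zeroʳ b)) (trans (*-congˡ h₂) (zeroʳ c))) (+-identityˡ 0#))) (+-identityˡ 0#))))

    form-with : ∀ a b c → ∃ λ g → g · E 0F ≈ a × g · E 1F ≈ b × g · E 2F ≈ c
    form-with a b c = go (independent⇒dual E E-independent (a ∷ b ∷ λ _ → c))
      where
      go : (∃ λ g → ∀ i → E i · g ≈ (a ∷ b ∷ λ _ → c) i) → ∃ λ g → g · E 0F ≈ a × g · E 1F ≈ b × g · E 2F ≈ c
      go (g , h) = g , trans (·-comm g (E 0F)) (h 0F) , trans (·-comm g (E 1F)) (h 1F) , trans (·-comm g (E 2F)) (h 2F)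

    line-through-lifts : ∀ {a b c} → (¬ a ≈ 0# ⊎ ¬ b ≈ 0# ⊎ ¬ c ≈ 0#) →
      ∃ λ (m : PLine) → ∀ s t w → s * a + (t * b + w * c) ≈ 0# → form m · combo s t w ≈ 0#
    line-through-lifts {a} {b} {c} nz = go (form-with a b c)
      where
      go : (∃ λ g → g · E 0F ≈ a × g · E 1F ≈ b × g · E 2F ≈ c) → _
      go (g , ga , gb , gc) = record { form = g ; nonzero = λ g≋0 →
            let vanish : ∀ v → g · v ≈ 0#
                vanish v = sum-zero (λ j → trans (*-congʳ (g≋0 j)) (zeroˡ (v j)))
            in [ (λ h → h (trans (sym ga) (vanish (E 0F)))) , [ (λ h → h (trans (sym gb) (vanish (E 1F)))) , (λ h → h (trans (sym gc) (vanish (E 2F)))) ]′ ]′ nz }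
        , λ s t w h → trans (·-combo g s t w) (trans (+-cong (*-congˡ ga) (+-cong (*-congˡ gb) (*-congˡ gc))) h)

    module _ {n} (x : Vect n) where

      base : Fin n → Vect 3
      base i = combo (x i) 1# 0#

      lift : Vect n → Fin n → Vect 3
      lift z i = combo (x i) 1# (z i)

      base≋ : ∀ i → base i ≋ (λ j → x i * E 0F j + E 1F j)
      base≋ i j = +-congˡ (trans (+-cong (*-identityˡ _) (zeroˡ _)) (+-identityʳ _))

      module _ (x-inj : Injective x) (z : Vect n) (Q : Fin n → Point) (Q-lifts : ∀ i → lift z i represents Q i) where

        lift-distinct : Distinct Q
        lift-distinct {i} {j} i≢j (a , a≉0 , Qi≋) = go (Q-lifts i) (Q-lifts j)
          where
          go : lift z i represents Q i → lift z j represents Q j → Data.Empty.⊥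
          go (b , b≉0 , h) (c , c≉0 , k) = i≢j (x-inj (trans (proj₁ coefficients)
              (trans (*-congʳ one) (*-identityˡ (x j)))))
            where
            u = proj₁ (inverse c c≉0)
            t = (b * a) * u
            proportional : lift z i ≋ combo (t * x j) (t * 1#) (t * z j)
            proportional l = trans (h l) (trans (*-congˡ (Qi≋ l)) (trans
              (sym (trans (*-congʳ (trans (*-congˡ (proj₂ (inverse c c≉0))) (*-identityʳ (b * a)))) (*-assoc b a (coord (Q j) l))))
              (trans (solve 5 (λ b a c u q → ((b :* a) :* (c :* u)) :* q := ((b :* a) :* u) :* (c :* q)) refl b a c u (coord (Q j) l))
                (trans (*-congˡ (sym (k l))) (combo-scale t (x j) 1# (z j) l)))))
            coefficients = combo-unique proportional
            one : t ≈ 1#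
            one = trans (sym (*-identityʳ t)) (sym (proj₁ (proj₂ coefficients)))

        -- In the basis `E` the line has an equation A x + B + C z = 0 satisfied by the three lifts.
        -- If C were zero, A x + B would vanish at two different values of `x` and the form would be
        -- zero; so z is affine in x along the triple.
        collinear⇒area≈0 : ∀ {i j k} → i ≢ j → Collinear₃ (Q i) (Q j) (Q k) → area x z i j k ≈ 0#
        collinear⇒area≈0 {i} {j} {k} i≢j (m , Qi , Qj , Qk) = *≈0⇒≈0 {g · E 2F} c≉0 (trans
            (sym (trans (area-linear x i j k (g · E 2F) z affine) (trans (+-congˡ (affine⇒area≈0 x {affine} refl refl refl)) (+-identityʳ _))))
            (affine⇒area≈0 x {λ l → (g · E 2F) * z l + affine l} {0#} {0#} (zero-at (relation i Qi)) (zero-at (relation j Qj)) (zero-at (relation k Qk))))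
          where
          g = form m
          affine : Vect n
          affine l = (g · E 0F) * x l + g · E 1F
          relation : ∀ l → form m · coord (Q l) ≈ 0# → (g · E 2F) * z l + affine l ≈ 0#
          relation l h = trans
            (trans (solve 6 (λ a b c x z e → c :* z :+ (a :* x :+ b) := x :* a :+ (b :+ z :* c)) refl (g · E 0F) (g · E 1F) (g · E 2F) (x l) (z l) 1#)
              (+-congˡ (+-congʳ (sym (*-identityˡ _)))))
            (trans (sym (·-combo g (x l) 1# (z l))) (represents-· {lift z l} {Q l} g (Q-lifts l) h))
          zero-at : ∀ {s t} → s ≈ 0# → s ≈ 0# * t + 0#
          zero-at {s} {t} h = trans h (sym (trans (+-identityʳ _) (zeroˡ t)))
          c≉0 : ¬ g · E 2F ≈ 0#
          c≉0 c≈0 = PLine.nonzero m (zero-form g (proj₁ zeros) (proj₂ zeros) c≈0)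
            where
            on-x : ∀ l → form m · coord (Q l) ≈ 0# → (g · E 0F) * x l + g · E 1F ≈ 0# * x l + 0#
            on-x l h = zero-at (trans (sym (trans (+-congʳ (trans (*-congʳ c≈0) (zeroˡ (z l)))) (+-identityˡ _))) (relation l h))
            zeros = affine-through-two (x i) (x j) (i≢j ∘ x-inj) (on-x i Qi) (on-x j Qj)

        area≈0⇒collinear : ∀ {i j k} → i ≢ j → area x z i j k ≈ 0# → Collinear₃ (Q i) (Q j) (Q k)
        area≈0⇒collinear {i} {j} {k} i≢j h = go (interpolate x x-inj z i≢j)
          where
          go : (∃ λ a → ∃ λ b → AffineAt x z a b i × AffineAt x z a b j) → Collinear₃ (Q i) (Q j) (Q k)
          -- The line z = a x + b through the first two lifts; the last coefficient -1 guarantees a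
          -- nonzero form.
          go (a , b , hi , hj) = go′ (line-through-lifts {a} {b} { - 1#} (inj₂ (inj₂ (λ -1≈0 → 0≉1 (sym (trans (solve 1 (λ e → e := :- (:- e)) refl 1#) (trans (-‿cong -1≈0) -0#≈0#)))))))
            where
            hk : AffineAt x z a b k
            hk = area≈0⇒affine x x-inj {z} i≢j hi hj h
            incident : ∀ {l} → AffineAt x z a b l → x l * a + (1# * b + z l * - 1#) ≈ 0#
            incident {l} hl = trans (+-congˡ (+-cong (*-identityˡ b) (trans (*-comm (z l) (- 1#)) (trans (sym (-‿distribˡ-* 1# (z l))) (-‿cong (trans (*-identityˡ (z l)) hl))))))
              (trans (solve 3 (λ a b x → x :* a :+ (b :- (a :* x :+ b)) := a :- a) refl a b (x l)) (x-x≈0 a))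
            go′ : (∃ λ (m : PLine) → ∀ s t w → s * a + (t * b + w * - 1#) ≈ 0# → form m · combo s t w ≈ 0#) → Collinear₃ (Q i) (Q j) (Q k)
            go′ (m , contains) = m , on-m hi , on-m hj , on-m hk
              where
              on-m : ∀ {l} → AffineAt x z a b l → form m · coord (Q l) ≈ 0#
              on-m {l} hl = ·-represents {lift z l} {Q l} (form m) (Q-lifts l) (contains (x l) 1# (z l) (incident hl))

  module ProjectionFrame (m : PLine) (O : Point) (O∉m : ¬ form m · coord O ≈ 0#) (e₀ e₁ : Vect 3)
    (e₀∈m : form m · e₀ ≈ 0#) (e₁∈m : form m · e₁ ≈ 0#)
    (e-independent : ∀ {a b} → (∀ j → a * e₀ j + b * e₁ j ≈ 0#) → a ≈ 0# × b ≈ 0#) where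

    E : Fin 3 → Vect 3
    E = e₀ ∷ e₁ ∷ λ _ → coord O

    -- The form of `m` vanishes on `e₀` and `e₁` but not on the centre, so pairing a relation with
    -- it isolates the coefficient of the centre.
    E-independent : LinearlyIndependent E
    E-independent c h = λ { zero → proj₁ c₀₁ ; (suc zero) → proj₂ c₀₁ ; (suc (suc zero)) → c₂≈0 }
      where
      f = form m
      h′ : ∀ j → c 0F * e₀ j + (c 1F * e₁ j + c 2F * coord O j) ≈ 0#
      h′ j = trans (+-congˡ (+-congˡ (sym (+-identityʳ _)))) (h j)
      pairing : f · (λ j → c 0F * e₀ j + (c 1F * e₁ j + c 2F * coord O j)) ≈ c 0F * (f · e₀) + (c 1F * (f · e₁) + c 2F * (f · coord O))
      pairing = trans (·-step f (c 0F) e₀ (λ j → c 1F * e₁ j + c 2F * coord O j)) (+-congˡ (trans (·-step f (c 1F) e₁ (scale (c 2F) (coord O))) (+-congˡ (·-scale f (c 2F) (coord O)))))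
      c₂≈0 : c 2F ≈ 0#
      c₂≈0 = *≈0⇒≈0 O∉m (trans (*-comm _ _) (trans
        (sym (trans (+-cong (trans (*-congˡ e₀∈m) (zeroʳ _)) (trans (+-congʳ (trans (*-congˡ e₁∈m) (zeroʳ _))) (+-identityˡ _))) (+-identityˡ _)))
        (trans (sym pairing) (sum-zero (λ j → trans (*-congˡ (h′ j)) (zeroʳ (f j)))))))
      c₀₁ = e-independent (λ j → trans (+-congˡ (sym (trans (+-congˡ (trans (*-congʳ c₂≈0) (zeroˡ _))) (+-identityʳ _)))) (h′ j))

    open Basis E E-independent public

    module _ {n} (x : Vect n) (P : Fin n → Point) (P-represented : ∀ i → base x i represents P i) where

      -- A line through the centre and the base point has an equation between the first two
      -- coordinates only, which makes those of `Q` proportional to (x i , 1). The factor is nonzero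
      -- because `Q` is not the centre, so it can be scaled to 1.
      projection⇒lift : ∀ {i} {Q : Point} → Projects O m Q (P i) → ∃ λ z → combo (x i) 1# z represents Q
      projection⇒lift {i} {Q} (Q≁O , _ , ℓ , O∈ℓ , Q∈ℓ , P∈ℓ) = go (combo-spans (coord Q))
        where
        g = form ℓ
        A = g · e₀
        go : (∃ λ a → ∃ λ b → ∃ λ c → coord Q ≋ combo a b c) → ∃ λ z → combo (x i) 1# z represents Q
        go (a , b , c , Q≋) = go′ (inverse b b≉0)
          where
          xA+B : x i * A + g · e₁ ≈ 0#
          xA+B = trans (+-congˡ (sym (trans (+-cong (*-identityˡ _) (zeroˡ _)) (+-identityʳ _))))
            (trans (sym (·-combo g (x i) 1# 0#)) (represents-· {base x i} {P i} g (P-represented i) P∈ℓ))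
          aA+bB : a * A + b * (g · e₁) ≈ 0#
          aA+bB = trans (+-congˡ (sym (trans (+-congˡ (trans (*-congˡ O∈ℓ) (zeroʳ c))) (+-identityʳ _))))
            (trans (sym (·-combo g a b c)) (trans (·-cong {v = g} (λ _ → refl) (λ j → sym (Q≋ j))) Q∈ℓ))
          A≉0 : ¬ A ≈ 0#
          A≉0 A≈0 = PLine.nonzero ℓ (zero-form g A≈0 (trans (sym (trans (+-congʳ (trans (*-congˡ A≈0) (zeroʳ _))) (+-identityˡ _))) xA+B) O∈ℓ)
          a≈ : a ≈ b * x i
          a≈ = -≈0⇒≈ (*≈0⇒≈0 A≉0 (trans
            (solve 5 (λ A B a b x → A :* (a :- b :* x) := (a :* A :+ b :* B) :- b :* (x :* A :+ B)) refl A (g · e₁) a b (x i))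
            (trans (+-cong aA+bB (-‿cong (trans (*-congˡ xA+B) (zeroʳ b)))) (x-x≈0 0#))))
          b≉0 : ¬ b ≈ 0#
          b≉0 b≈0 = Q≁O (c , c≉0 , λ j → Q≋cO j)
            where
            Q≋cO : coord Q ≋ scale c (coord O)
            Q≋cO j = trans (Q≋ j) (trans (+-cong (trans (*-congʳ (trans a≈ (trans (*-congʳ b≈0) (zeroˡ (x i))))) (zeroˡ _))
              (trans (+-congʳ (trans (*-congʳ b≈0) (zeroˡ _))) (+-identityˡ _))) (+-identityˡ _))
            c≉0 : ¬ c ≈ 0#
            c≉0 c≈0 = nonzero Q (λ j → trans (Q≋cO j) (trans (*-congʳ c≈0) (zeroˡ _)))
          go′ : (∃ λ u → b * u ≈ 1#) → ∃ λ z → combo (x i) 1# z represents Q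
          go′ (u , bu≈1) = u * c , u , inverse≉0 bu≈1 , λ j → sym (trans (*-congˡ (Q≋ j)) (trans (combo-scale u a b c j)
            (combo-cong (trans (*-congˡ a≈) (trans (sym (*-assoc u b (x i))) (trans (*-congʳ ub≈1) (*-identityˡ (x i))))) ub≈1 refl j)))
            where
            ub≈1 : u * b ≈ 1#
            ub≈1 = trans (*-comm u b) bu≈1

      lift-nonzero : ∀ z i → ¬ lift x z i ≋ 𝟎
      lift-nonzero z i h = 0≉1 (sym (proj₁ (proj₂ (combo-injective h))))

      liftPoint : Vect n → Fin n → Point
      liftPoint z i = record { coord = lift x z i ; nonzero = lift-nonzero z i }

      liftPoint-represented : ∀ z i → lift x z i represents liftPoint z i
      liftPoint-represented z i = 1# , (λ h → 0≉1 (sym h)) , λ j → sym (*-identityˡ _)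

      base-on-m : ∀ i → form m · base x i ≈ 0#
      base-on-m i = trans (·-combo (form m) (x i) 1# 0#) (trans (+-cong (trans (*-congˡ e₀∈m) (zeroʳ _))
        (trans (+-cong (trans (*-congˡ e₁∈m) (zeroʳ _)) (zeroˡ _)) (+-identityˡ 0#))) (+-identityˡ 0#))

      lift-projects : ∀ z i → Projects O m (liftPoint z i) (P i)
      -- The form with coefficients 1, - x i, 0 describes the line through the centre and the i-th
      -- base point; it contains every lift of that point.
      lift-projects z i = ≁O , ·-represents {base x i} {P i} (form m) (P-represented i) (base-on-m i) , go (line-through-lifts {1#} { - x i} {0#} (inj₁ (λ h → 0≉1 (sym h))))
        where
        ≁O : ¬ liftPoint z i ∼ O
        ≁O (a , _ , h) = 0≉1 (sym (proj₁ (proj₂ (combo-unique {x i} {1#} {z i} {0#} {0#} {a} λ j → trans (h j) (sym (trans (+-cong (zeroˡ _) (trans (+-congʳ (zeroˡ _)) (+-identityˡ _))) (+-identityˡ _)))))))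
        go : (∃ λ (ℓ : PLine) → ∀ s t w → s * 1# + (t * - x i + w * 0#) ≈ 0# → form ℓ · combo s t w ≈ 0#) → Collinear₃ O (liftPoint z i) (P i)
        go (ℓ , contains) = ℓ
          , trans (·-cong {v = form ℓ} {w = coord O} {w′ = combo 0# 0# 1#} (λ _ → refl) (λ j → sym (trans (+-cong (zeroˡ (e₀ j)) (trans (+-cong (zeroˡ (e₁ j)) (*-identityˡ (coord O j))) (+-identityˡ (coord O j)))) (+-identityˡ (coord O j)))))
              (contains 0# 0# 1# (trans (+-cong (zeroˡ _) (trans (+-cong (zeroˡ _) (zeroʳ _)) (+-identityˡ 0#))) (+-identityˡ 0#)))
          , contains (x i) 1# (z i) (incident (z i))
          , ·-represents {base x i} {P i} (form ℓ) (P-represented i) (contains (x i) 1# 0# (incident 0#))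
          where
          incident : ∀ w → x i * 1# + (1# * - x i + w * 0#) ≈ 0#
          incident w = trans (+-cong (*-identityʳ _) (trans (+-cong (*-identityˡ _) (zeroʳ w)) (+-identityʳ _))) (x-x≈0 (x i))

-- Liftability and the dimension of the solution space

module LiftingTheorem (F : ClassicalField) {n ω} (C : Configuration (⊤ {n})) (C-linear : Linear C)
  (comp : Fin ω → Subset n) (components : AreComponents C comp)
  (matroids : ∀ i → Σ (Matroid (comp i)) λ M → Geometry.Maximal (LinearAlgebra.rawRing F) M × subconfiguration C (comp i) ≐ configuration M) where

  open LinearAlgebra F
  open Enumerations
  open AffineFunctions F
  open ComponentGraph em C
  open GlobalSolutions F C C-linear comp components matroids
  open ProjectiveLift F
  open Solver using (solve; _:=_; _:+_; _:-_; _:*_; :-_)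

  component-triple : ∀ i → ∃ λ p → ∃ λ q → ∃ λ r → Distinct₃ p q r × p ∈ comp i × q ∈ comp i × r ∈ comp i × ¬ OnCommonLine p q r
  component-triple i = go (Component.noncollinear-triple i)
    where
    go : (∃ λ p → ∃ λ q → ∃ λ r → Distinct₃ p q r × p ∈ comp i × q ∈ comp i × r ∈ comp i × ¬ Component.Collinear i p q r) → _
    go (p , q , r , d , p∈ , q∈ , r∈ , non) = p , q , r , d , p∈ , q∈ , r∈ ,
      λ (ℓ , line , p∈ℓ , q∈ℓ , r∈ℓ) → non (ℓ , component-line line p∈ℓ p∈ , p∈ℓ , q∈ℓ , r∈ℓ)

  module _ {x : Vect n} (x-inj : Injective x) (z : Vect n) (sol : Solution C x z)
           (nondegenerate : ∀ {a b c} → Distinct₃ a b c → ¬ OnCommonLine a b c → ¬ area x z a b c ≈ 0#) where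

    private
      generator : Fin 3 → Vect n
      generator zero             = λ _ → 1#
      generator (suc zero)       = x
      generator (suc (suc zero)) = z

      generator-affine : ∀ k {ℓ} → Line C ℓ → ∃ λ a → ∃ λ b → Affine x (generator k) ℓ a b
      generator-affine zero             line = 0# , 1# , λ {i} _ → sym (trans (+-congʳ (zeroˡ (x i))) (+-identityˡ 1#))
      generator-affine (suc zero)       line = 1# , 0# , λ {i} _ → sym (trans (+-identityʳ _) (*-identityˡ (x i)))
      generator-affine (suc (suc zero)) line = solution⇒affineLines C x x-inj {z} sol line (3≤line line)

      local : Fin 3 → Fin ω → Vect n
      local k i = restrict (comp i) (generator k)

      local-solution : ∀ k i → Solution C x (local k i)
      local-solution k i = affineLines⇒solution C x {local k i} λ line → go line (line-component line)
        where
        go : ∀ {ℓ} → Line C ℓ → (∃ λ j → Component.KLine j ℓ) → ∃ λ a → ∃ λ b → Affine x (local k i) ℓ a b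
        go {ℓ} line (j , kline) =
          [ (λ { ≡.refl → let a , b , h = generator-affine k line in a , b , λ q∈ → trans (restrict-∈ (proj₂ kline q∈)) (h q∈) })
          , (λ i≢j → 0# , 0# , λ q∈ → zero-at x-inj {local k i} (restrict-∉ (λ q∈i → i≢j (component-unique components q∈i (proj₂ kline q∈)))))
          ]′ (toSum (i Finₚ.≟ j))

      family : Fin (3 ℕ.* ω) → Vect n
      family t = local (proj₁ (remQuot {3} ω t)) (proj₂ (remQuot {3} ω t))

      family-combine : ∀ k i → family (combine k i) ≡ local k i
      family-combine k i = ≡.cong (λ (k , i) → local k i) (Finₚ.remQuot-combine {3} {ω} k i)

      module _ (c : Vect (3 ℕ.* ω)) (h : combination c family ≋ 𝟎) (i : Fin ω) where

        α β γ : Carrier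
        α = c (combine 0F i)
        β = c (combine 1F i)
        γ = c (combine 2F i)

        relation : ∀ {p} → p ∈ comp i → α + (β * x p + γ * z p) ≈ 0#
        relation {p} p∈ = trans (sym (trans (sum-three term d off) (+-cong (trans (at 0F) (*-identityʳ α)) (+-cong (at 1F) (at 2F))))) (h p)
          where
          term : Fin (3 ℕ.* ω) → Carrier
          term t = c t * family t p
          d : Distinct₃ (combine 0F i) (combine 1F i) (combine 2F i)
          d = distinct (λ eq → contradiction (Finₚ.combine-injectiveˡ 0F i 1F i eq) λ ())
                       (λ eq → contradiction (Finₚ.combine-injectiveˡ 0F i 2F i eq) λ ())
                       (λ eq → contradiction (Finₚ.combine-injectiveˡ 1F i 2F i eq) λ ())
          at : ∀ k → term (combine k i) ≈ c (combine k i) * generator k p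
          at k = *-congˡ (trans (reflexive (≡.cong (λ f → f p) (family-combine k i))) (restrict-∈ p∈))
          excluded : ∀ k → combine k i ≢ combine 0F i → combine k i ≢ combine 1F i → combine k i ≢ combine 2F i → Data.Empty.⊥
          excluded zero             h₀ _ _ = h₀ ≡.refl
          excluded (suc zero)       _ h₁ _ = h₁ ≡.refl
          excluded (suc (suc zero)) _ _ h₂ = h₂ ≡.refl
          off′ : ∀ k j → combine k j ≢ combine 0F i → combine k j ≢ combine 1F i → combine k j ≢ combine 2F i → term (combine k j) ≈ 0#
          off′ k j h₀ h₁ h₂ = trans (*-congˡ (trans (reflexive (≡.cong (λ f → f p) (family-combine k j)))
            (restrict-∉ λ p∈j → excluded′ (component-unique components p∈j p∈)))) (zeroʳ _)
            where
            excluded′ : j ≡ i → Data.Empty.⊥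
            excluded′ ≡.refl = excluded k h₀ h₁ h₂
          off : ∀ t → t ≢ combine 0F i → t ≢ combine 1F i → t ≢ combine 2F i → term t ≈ 0#
          off t = ≡.subst (λ t → t ≢ combine 0F i → t ≢ combine 1F i → t ≢ combine 2F i → term t ≈ 0#)
            (Finₚ.combine-remQuot {3} ω t) (off′ (proj₁ (remQuot {3} ω t)) (proj₂ (remQuot {3} ω t)))

        -- On the component γ z is minus an affine function, so its area vanishes at every triple,
        -- while that of `z` does not at a non-collinear one; this kills γ. The remaining affine
        -- function has two zeros.
        coefficients≈0 : α ≈ 0# × β ≈ 0# × γ ≈ 0#
        coefficients≈0 = go (component-triple i)
          where
          go : (∃ λ p → ∃ λ q → ∃ λ r → Distinct₃ p q r × p ∈ comp i × q ∈ comp i × r ∈ comp i × ¬ OnCommonLine p q r) → _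
          go (p , q , r , d , p∈ , q∈ , r∈ , non) = proj₂ βα≈0 , proj₁ βα≈0 , γ≈0
            where
            affine : Vect n
            affine l = β * x l + α
            vanish : ∀ {l} → l ∈ comp i → AffineAt x (λ l → γ * z l + affine l) 0# 0# l
            vanish {l} l∈ = trans (trans (solve 3 (λ a b c → c :+ (b :+ a) := a :+ (b :+ c)) refl α (β * x l) (γ * z l)) (relation l∈))
              (sym (trans (+-identityʳ _) (zeroˡ (x l))))
            γ≈0 : γ ≈ 0#
            γ≈0 = *≈0⇒≈0 (nondegenerate d non) (trans (*-comm _ _) (trans
              (sym (trans (area-linear x p q r γ z affine) (trans (+-congˡ (affine⇒area≈0 x {affine} refl refl refl)) (+-identityʳ _))))
              (affine⇒area≈0 x {λ l → γ * z l + affine l} {0#} {0#} (vanish p∈) (vanish q∈) (vanish r∈))))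
            on-affine : ∀ {l} → l ∈ comp i → β * x l + α ≈ 0# * x l + 0#
            on-affine {l} l∈ = trans (trans (+-comm _ _) (+-congˡ (sym (trans (+-congˡ (trans (*-congʳ γ≈0) (zeroˡ (z l)))) (+-identityʳ _)))))
              (trans (relation l∈) (sym (trans (+-identityʳ _) (zeroˡ (x l)))))
            βα≈0 : β ≈ 0# × α ≈ 0#
            βα≈0 = affine-unique x x-inj (Distinct₃.p≢q d) (on-affine p∈) (on-affine q∈)

      family-independent : LinearlyIndependent family
      family-independent c h t = ≡.subst (λ t → c t ≈ 0#) (Finₚ.combine-remQuot {3} ω t)
        (at (proj₁ (remQuot {3} ω t)) (proj₂ (remQuot {3} ω t)))
        where
        at : ∀ k i → c (combine k i) ≈ 0#
        at zero             i = proj₁ (coefficients≈0 c h i)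
        at (suc zero)       i = proj₁ (proj₂ (coefficients≈0 c h i))
        at (suc (suc zero)) i = proj₂ (proj₂ (coefficients≈0 c h i))

    nondegenerate⇒large : LargeSolutionSpace x
    nondegenerate⇒large = let d , dim = hasDimension (solution-subspace C x) in
      d , dim , independent≤dimension family family-independent (λ t → local-solution (proj₁ (remQuot {3} ω t)) (proj₂ (remQuot {3} ω t))) dim

  -- The argument from a lift needs two different points, which any component supplies. Without
  -- components the bound 3ω is zero.
  no-components⇒large : ¬ Fin ω → ∀ x → LargeSolutionSpace x
  no-components⇒large none x = let d , dim = hasDimension (solution-subspace C x) in d , dim , 3ω≤ none
    where
    3ω≤ : ∀ {ω d} → ¬ Fin ω → 3 ℕ.* ω ℕ.≤ d
    3ω≤ {zero}  _    = ℕ.z≤n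
    3ω≤ {suc ω} none = ⊥-elim (none zero)

  -- The rows are indexed by a type that is never enumerated. A basis of the row space has the same
  -- annihilator as the rows, and being finite it is accessible to `rank-nullity`.
  dimension+rank : ∀ {x d r} → HasDimension (Solution C x) d → RankΛ C x r → d ℕ.+ r ≡ n
  dimension+rank {x} {d} {r} (w , w∈ , w-ind , w-spans) (b , b∈ , b-ind , b-spans) = rank-nullity b b-ind
    ( w
    , (λ j i → Span⊆ (orthogonal-to (w j)) (Λ C x) (w∈ j) (b∈ i))
    , w-ind
    , λ v h → w-spans v (λ t → Span⊆ (orthogonal-to v) b h (b-spans (Λ C x t) (∈Span (Λ C x) t))))
    where
    orthogonal-to : ∀ v → Subspace (λ u → u · v ≈ 0#)
    orthogonal-to v = record
      { resp  = λ {u} {u′} u≋ h → trans (·-cong {w = v} (λ j → sym (u≋ j)) (λ _ → refl)) h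
      ; zero∈ = sum-zero (λ j → zeroˡ (v j))
      ; step∈ = λ a {u} {u′} h k → trans (·-comm _ v) (trans (·-step v a u u′)
          (trans (+-cong (trans (*-congˡ (trans (·-comm v u) h)) (zeroʳ a)) (trans (·-comm v u′) k)) (+-identityˡ 0#)))
      }

  large⇔rank : ∀ x → LargeSolutionSpace x ⇔ (∃ λ r → RankΛ C x r × 3 ℕ.* ω ℕ.+ r ℕ.≤ n)
  large⇔rank x = mk⇔
    (λ (d , dim , 3ω≤d) → let r , rank = hasDimension (Span-subspace (Λ C x)) in
      r , rank , ℕₚ.≤-trans (ℕₚ.+-monoˡ-≤ r 3ω≤d) (ℕₚ.≤-reflexive (dimension+rank dim rank)))
    (λ (r , rank , ≤n) → let d , dim = hasDimension (solution-subspace C x) in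
      d , dim , ℕₚ.+-cancelʳ-≤ r _ _ (ℕₚ.≤-trans ≤n (ℕₚ.≤-reflexive (≡.sym (dimension+rank dim rank)))))

  LargeAtAllPositions : Set
  LargeAtAllPositions = ∀ P → Distinct P → Collinear P → ∀ x → Coordinates P x → LargeSolutionSpace x

  represented-injective : ∀ {P : Fin n → Point} (e₀ e₁ : Vect 3) (x : Vect n) → Distinct P →
    (∀ j → (λ i → x j * e₀ i + e₁ i) represents P j) → Injective x
  represented-injective {P} e₀ e₁ x P-distinct rep {i} {j} x≈ = decidable-stable (i Finₚ.≟ j) λ i≢j →
    P-distinct i≢j (represent-same⇒∼ {p = P i} {q = P j} (λ l → +-congʳ (*-congʳ x≈)) (rep i) (rep j))

  represents-resp : ∀ {v w} {p : Point} → v ≋ w → v represents p → w represents p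
  represents-resp v≋w (a , a≉0 , h) = a , a≉0 , λ j → trans (sym (v≋w j)) (h j)

  module LiftableToLarge (liftable : Liftable C) {P : Fin n → Point} (P-distinct : Distinct P) (m : PLine) (P∈m : ∀ i → form m · coord (P i) ≈ 0#)
    {x : Vect n} (coordinates : Coordinates P x) {i j : Fin n} (i≢j : i ≢ j) where

    open Coordinates coordinates

    x-inj : Injective x
    x-inj = represented-injective {P} (e 0F) (e 1F) x P-distinct point≡

    on-m : ∀ j → x j * (form m · e 0F) + form m · e 1F ≈ 0# * x j + 0#
    on-m j = trans (trans (sym (·-step (form m) (x j) (e 0F) (e 1F))) (represents-· {p = P j} (form m) (point≡ j) (P∈m j)))
      (sym (trans (+-identityʳ _) (zeroˡ (x j))))

    -- The form of `m` evaluated at x e₀ + e₁ is affine in x and vanishes at two different values,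
    -- those of the i-th and j-th points. So both its coefficients are zero.
    e∈m : form m · e 0F ≈ 0# × form m · e 1F ≈ 0#
    e∈m = affine-unique x x-inj {form m · e 0F} {form m · e 1F} {0#} {0#} i≢j (trans (+-congʳ (*-comm _ _)) (on-m i)) (trans (+-congʳ (*-comm _ _)) (on-m j))

    e-independent : ∀ {a b} → (∀ j → a * e 0F j + b * e 1F j ≈ 0#) → a ≈ 0# × b ≈ 0#
    e-independent {a} {b} h = z 0F , z 1F
      where
      z = basis (a ∷ b ∷ λ _ → 0#) (λ j → trans (+-congˡ (trans (+-congˡ (trans (+-identityʳ _) (zeroˡ _))) (+-identityʳ _))) (h j))

    module _ (O : Point) (O∉m : ¬ form m · coord O ≈ 0#) (Q : Fin n → Point)
             (realisation : NonDegenerateRealisation C Q) (projects : ∀ i → Projects O m (Q i) (P i)) where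

      open NonDegenerateRealisation realisation
      -- The first two basis vectors determine `x`, and Λ depends on `x` alone. So the centre of the
      -- given coordinates may be exchanged for the centre that liftability provides.
      open ProjectionFrame m O O∉m (e 0F) (e 1F) (proj₁ e∈m) (proj₂ e∈m) e-independent

      base-represents : ∀ i → base x i represents P i
      base-represents i = represents-resp {p = P i} (λ j → sym (base≋ x i j)) (point≡ i)

      lifted : ∀ i → ∃ λ z → combo (x i) 1# z represents Q i
      lifted i = projection⇒lift x P base-represents {i} {Q i} (projects i)

      large : (∀ i → ∃ λ z → combo (x i) 1# z represents Q i) → LargeSolutionSpace x
      large lifted = nondegenerate⇒large x-inj z sol λ d non area≈0 → non (Equivalence.from (collinear (Distinct₃.p≢q d) (Distinct₃.p≢r d) (Distinct₃.q≢r d))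
          (area≈0⇒collinear x x-inj z Q (proj₂ ∘ lifted) (Distinct₃.p≢q d) area≈0))
        where
        z : Vect n
        z i = proj₁ (lifted i)
        sol : Solution C x z
        sol t = trans (row C x t z) (collinear⇒area≈0 x x-inj z Q (proj₂ ∘ lifted) i₁≢i₂
            (Equivalence.to (collinear i₁≢i₂ (Finₚ.<⇒≢ (Finₚ.<-trans i₁<i₂ i₂<i₃)) (Finₚ.<⇒≢ i₂<i₃)) (_ , line , i₁∈ℓ , i₂∈ℓ , i₃∈ℓ)))
          where
          open CollinearTriple t
          i₁≢i₂ = Finₚ.<⇒≢ i₁<i₂

    result : LargeSolutionSpace x
    result = go (liftable P P-distinct m P∈m)
      where
      go : (∃ λ O → ¬ form m · coord O ≈ 0# × Σ (Fin n → Point) λ Q → NonDegenerateRealisation C Q × (∀ i → Projects O m (Q i) (P i))) → LargeSolutionSpace x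
      go (O , O∉m , Q , realisation , projects) = large O O∉m Q realisation projects (lifted O O∉m Q realisation projects)

  liftable⇒large : Liftable C → LargeAtAllPositions
  liftable⇒large liftable P P-distinct (m , P∈m) x coordinates = go em
    where
    go : Dec (Fin ω) → LargeSolutionSpace x
    go (no none) = no-components⇒large none x
    go (yes i)   = let _ , _ , _ , d , _ = component-triple i in
      LiftableToLarge.result liftable {P} P-distinct m P∈m {x} coordinates (Distinct₃.p≢q d)

  module _ (large : LargeAtAllPositions) where

    -- The perturbation argument needs freely chosen coordinates instead of given points. Every
    -- injective `x` is realised by the points (x j : 1 : 0) in the standard basis.
    large-everywhere : ∀ x → Injective x → LargeSolutionSpace x
    large-everywhere x x-inj = large P P-distinct (record { form = δ 2F ; nonzero = δ-nonzero } , P∈m) x record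
        { centre  = record { coord = δ 2F ; nonzero = δ-nonzero }
        ; e       = δ
        ; basis   = δ-independent
        ; centre≡ = 1# , (λ h → 0≉1 (sym h)) , λ j → sym (*-identityˡ _)
        ; point≡  = point≡
        }
      where
      δ-nonzero : ¬ δ {3} 2F ≋ 𝟎
      δ-nonzero h = 0≉1 (sym (trans (sym (δ-diagonal 2F)) (h 2F)))
      δ-independent : LinearlyIndependent (δ {3})
      δ-independent c h j = trans (sym (trans (sum-cong-≋ (λ i → *-congˡ {c i} (δ-symmetric i j))) (sum-δ c j))) (h j)
      point : Fin n → Vect 3
      point j i = x j * δ 0F i + δ 1F i
      P : Fin n → Point
      P j = record { coord = point j ; nonzero = λ h → 0≉1 (sym (trans (sym (trans (+-congʳ (zeroʳ (x j))) (+-identityˡ 1#))) (h 1F))) }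
      point≡ : ∀ j → point j represents P j
      point≡ j = 1# , (λ h → 0≉1 (sym h)) , λ i → sym (*-identityˡ _)
      P∈m : ∀ i → δ 2F · point i ≈ 0#
      P∈m i = trans (·-comm (δ 2F) (point i)) (trans (·-δ (point i) 2F) (trans (+-congʳ (zeroʳ (x i))) (+-identityˡ 0#)))
      P-distinct : Distinct P
      P-distinct {i} {j} i≢j (a , _ , h) = i≢j (x-inj (trans (at-0 i) (trans (h 0F) (trans (*-congˡ (sym (at-0 j))) (trans (*-congʳ a≈1) (*-identityˡ (x j)))))))
        where
        at-0 : ∀ i → x i ≈ point i 0F
        at-0 i = sym (trans (+-identityʳ _) (*-identityʳ (x i)))
        at-1 : ∀ i → 1# ≈ point i 1F
        at-1 i = sym (trans (+-congʳ (zeroʳ (x i))) (+-identityˡ 1#))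
        a≈1 : a ≈ 1#
        a≈1 = sym (trans (at-1 i) (trans (h 1F) (trans (*-congˡ (sym (at-1 j))) (*-identityʳ a))))

    module _ {P : Fin n → Point} (P-distinct : Distinct P) (m : PLine) (P∈m : ∀ i → form m · coord (P i) ≈ 0#) where

      LiftsFrom : Set
      LiftsFrom = ∃ λ O → ¬ form m · coord O ≈ 0# × Σ (Fin n → Point) λ Q → NonDegenerateRealisation C Q × (∀ i → Projects O m (Q i) (P i))

      lifts : (O : Point) → ¬ form m · coord O ≈ 0# → (e₀ e₁ : Vect 3) → form m · e₀ ≈ 0# → form m · e₁ ≈ 0# →
        (∀ {a b} → (∀ j → a * e₀ j + b * e₁ j ≈ 0#) → a ≈ 0# × b ≈ 0#) →
        (x : Vect n) → (∀ j → (λ i → x j * e₀ i + e₁ i) represents P j) → LiftsFrom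
      lifts O O∉m e₀ e₁ e₀∈m e₁∈m e-ind x rep = go (GenericSolution.generic-solution frame (large⇒twoLines large-everywhere frame) x-inj)
        where
        x-inj : Injective x
        x-inj = represented-injective {P} e₀ e₁ x P-distinct rep
        open ProjectionFrame m O O∉m e₀ e₁ e₀∈m e₁∈m e-ind
        base-represents : ∀ i → base x i represents P i
        base-represents i = represents-resp {p = P i} (λ j → sym (base≋ x i j)) (rep i)
        go : (∃ λ z → Solution C x z × ∀ {a b c} → Distinct₃ a b c → ¬ OnCommonLine a b c → ¬ area x z a b c ≈ 0#) → LiftsFrom
        go (z , sol , nondegenerate) = O , O∉m , Q , realisation , lift-projects x P base-represents z
          where
          Q = liftPoint x P base-represents z
          represented = liftPoint-represented x P base-represents z
          realisation : NonDegenerateRealisation C Q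
          realisation = record
            { distinct  = lift-distinct x x-inj z Q represented
            ; collinear = λ i≢j i≢k j≢k → mk⇔
                (λ (ℓ , line , i∈ , j∈ , k∈) → area≈0⇒collinear x x-inj z Q represented i≢j
                  (solution⇒area≈0 C x {z} sol line (distinct i≢j i≢k j≢k) i∈ j∈ k∈))
                (λ col → decidable-stable em λ non → nondegenerate (distinct i≢j i≢k j≢k) non
                  (collinear⇒area≈0 x x-inj z Q represented i≢j col))
            }

      nonzero-entry : ∃ λ k → ¬ form m k ≈ 0#
      nonzero-entry = decidable-stable em λ none → PLine.nonzero m (λ k → decidable-stable em λ k≉0 → none (k , k≉0))

      -- A base point e₀ of the line different from all P j, so that the
      -- others have affine coordinates x j.
      lifts-from-basis : (w₀ w₁ : Vect 3) → form m · w₀ ≈ 0# → form m · w₁ ≈ 0# →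
        (∀ {a b} → (∀ j → a * w₀ j + b * w₁ j ≈ 0#) → a ≈ 0# × b ≈ 0#) →
        (s t : Vect n) → (∀ i j → coord (P i) j ≈ s i * w₀ j + t i * w₁ j) → LiftsFrom
      -- With e₀ = w₀ + c w₁ the vector s w₀ + t w₁ becomes s e₀ + τ w₁ for τ = t - c s. So `c` is
      -- chosen with all τ nonzero, and then x = s/τ; `nz` makes this possible.
      lifts-from-basis w₀ w₁ w₀∈m w₁∈m w-ind s t P≋ = go (eventually-witness (eventually-∀ λ i → eventually-linear (- s i) (t i) (nz i)))
        where
        nz : ∀ i → ¬ (- s i ≈ 0# × t i ≈ 0#)
        nz i (-s≈0 , t≈0) = nonzero (P i) (λ j → trans (P≋ i j) (trans (+-cong (trans (*-congʳ s≈0) (zeroˡ (w₀ j))) (trans (*-congʳ t≈0) (zeroˡ (w₁ j)))) (+-identityˡ 0#)))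
          where
          s≈0 : s i ≈ 0#
          s≈0 = trans (solve 1 (λ s → s := :- (:- s)) refl (s i)) (trans (-‿cong -s≈0) -0#≈0#)
        go : (∃ λ c → ∀ i → ¬ c * - s i + t i ≈ 0#) → LiftsFrom
        go (c , τ≉0) = lifts O O∉m e₀ w₁ e₀∈m w₁∈m e-ind x rep
          where
          k = proj₁ nonzero-entry
          -- Any centre off the line will do: a coordinate in which the form of `m` is nonzero gives
          -- a unit vector off `m`.
          O : Point
          O = record { coord = δ k ; nonzero = λ h → 0≉1 (sym (trans (sym (δ-diagonal k)) (h k))) }
          O∉m : ¬ form m · δ k ≈ 0#
          O∉m h = proj₂ nonzero-entry (trans (sym (·-δ (form m) k)) h)
          e₀ : Vect 3
          e₀ j = c * w₁ j + w₀ j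
          e₀∈m : form m · e₀ ≈ 0#
          e₀∈m = trans (·-step (form m) c w₁ w₀) (trans (+-cong (trans (*-congˡ w₁∈m) (zeroʳ c)) w₀∈m) (+-identityˡ 0#))
          e-ind : ∀ {a b} → (∀ j → a * e₀ j + b * w₁ j ≈ 0#) → a ≈ 0# × b ≈ 0#
          e-ind {a} {b} h = a≈0 , trans (sym (trans (+-congʳ (trans (*-congʳ a≈0) (zeroˡ c))) (+-identityˡ b))) (proj₂ ab)
            where
            ab = w-ind {a} {a * c + b} (λ j → trans (solve 5 (λ a b c u v → a :* u :+ (a :* c :+ b) :* v := a :* (c :* v :+ u) :+ b :* v) refl a b c (w₀ j) (w₁ j)) (h j))
            a≈0 = proj₁ ab
          module _ (i : Fin n) where
            τ = c * - s i + t i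
            u = proj₁ (inverse τ (τ≉0 i))
            τu≈1 = proj₂ (inverse τ (τ≉0 i))
          x : Vect n
          x i = s i * u i
          rep : ∀ i → (λ j → x i * e₀ j + w₁ j) represents P i
          rep i = u i , inverse≉0 (τu≈1 i) , λ j → sym (trans (*-congˡ (P≋ i j)) (trans
            (solve 6 (λ u s t c v w → u :* (s :* v :+ t :* w) := (s :* u) :* (c :* w :+ v) :+ ((c :* :- s :+ t) :* u) :* w) refl (u i) (s i) (t i) c (w₀ j) (w₁ j))
            (+-congˡ (trans (*-congʳ (τu≈1 i)) (*-identityˡ (w₁ j))))))

      lifts-somewhere : LiftsFrom
      lifts-somewhere = go (hasDimension (orthogonal-subspace single))
        where
        single : Fin 1 → Vect 3
        single _ = form m
        single-independent : LinearlyIndependent single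
        single-independent c h zero = *≈0⇒≈0 (proj₂ nonzero-entry) (trans (*-comm _ _) (trans (sym (+-identityʳ _)) (h (proj₁ nonzero-entry))))
        OnLine : Vect 3 → Set
        OnLine v = ∀ i → single i · v ≈ 0#
        go : ∃ (HasDimension OnLine) → LiftsFrom
        -- A single nonzero form has rank one, so `d + 1 ≡ 3`: the vectors on the line `m` have a
        -- basis of two elements.
        go (d , dim) = go′ d (ℕₚ.+-cancelʳ-≡ 1 d 2 (rank-nullity single single-independent dim)) dim
          where
          go′ : ∀ d → d ≡ 2 → HasDimension OnLine d → LiftsFrom
          go′ _ ≡.refl (w , w∈ , w-ind , w-spans) = lifts-from-basis (w zero) (w (suc zero)) (w∈ zero zero) (w∈ (suc zero) zero)
              (λ {a} {b} h → let z = w-ind (a ∷ λ _ → b) (λ j → trans (+-congˡ (+-identityʳ _)) (h j)) in z zero , z (suc zero))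
              (λ i → proj₁ (coefficients i) zero) (λ i → proj₁ (coefficients i) (suc zero))
              (λ i j → trans (proj₂ (coefficients i) j) (+-congˡ (+-identityʳ _)))
            where
            coefficients : ∀ i → InSpan w (coord (P i))
            coefficients i = Span⇒InSpan w (w-spans (coord (P i)) (λ _ → P∈m i))

    large⇒liftable : Liftable C
    large⇒liftable P P-distinct m P∈m = lifts-somewhere {P} P-distinct m P∈m

  liftable⇔large : Liftable C ⇔ LargeAtAllPositions
  liftable⇔large = mk⇔ liftable⇒large large⇒liftable

-- The theorem over the complex numbers

module _ (em : ∀ {a : Level} → ExcludedMiddle a) where

  ℂ-field : ClassicalField
  ℂ-field = record
    { em          = em
    ; R           = ComplexField.ℂ-commutativeRing
    ; inverse     = ComplexField.inverseᶜ em
    ; ι           = ComplexField.fromℚ-homomorphism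
    ; ι-injective = ComplexField.fromℚ-injective
    }

open import Defs
open import Data.Nat using (_+_; _*_; _≤_)

lemma3p9 : (∀ {a : Level} → ExcludedMiddle a) →
    ∀ {n ω : ℕ} (C : Configuration (⊤ {n})) → Linear C →
    (comp : Fin ω → Subset n) → AreComponents C comp →
    (∀ i → Σ (Matroid (comp i)) λ M →
    Maximal M × subconfiguration C (comp i) ≐ configuration M) →
    (Liftable C ⇔
    (∀ P → Distinct P → Collinear P → ∀ x → Coordinates P x →
    ∃ λ d → HasDimension (Solution C x) d × 3 * ω ≤ d))
    ×
    (∀ P → Distinct P → Collinear P → ∀ x → Coordinates P x →
    (∃ λ d → HasDimension (Solution C x) d × 3 * ω ≤ d)
    ⇔ (∃ λ r → RankΛ C x r × 3 * ω + r ≤ n))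
lemma3p9 em C C-linear comp components matroids = liftable⇔large , λ P _ _ x _ → large⇔rank x
  where open LiftingTheorem (ℂ-field em) C C-linear comp components matroids
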